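{- Let $m\ge 3$, $n\ge 3$, let $x,y$ be two distinct vertices of the cycle $C_m$ with $p=d(x,y)$ (graph distance in $C_m$), and let $F_n(C_m)$ be the generalized sunflower graph formed from $n$ copies of $C_m$ with marked vertices $x,y$. Kemeny's constant of $F_n(C_m)$ is $$\mathscr K(F_n(C_m))=\frac{(n^2-6n+4)(pm-p^2)+m^2(2n-1)-2n-1}{6}.$$
   Context: For a connected graph $H$ with vertex set $\{1,\dots,N\}$ and Laplacian matrix $L$, the resistance distance between vertices $i,j$ is $r_H(i,j)=(e_i-e_j)^T L^\dagger (e_i-e_j)$, where $e_i$ is the $i$th standard unit vector and $L^\dagger$ is the Moore–Penrose pseudoinverse of $L$. Kemeny's constant of (the simple random walk on) a connected graph $H$ is given by $\mathscr K(H)=\frac{1}{4|E(H)|}\sum_{i,j\in V(H)} d_i d_j\, r_H(i,j)$, where $d_i$ is the degree of $i$ in $H$ and the sum is over ordered pairs; this formula may be taken as the definition. Generalized sunflower graph: fix distinct vertices $x,y$ of the cycle $C_m$. $F_n(C_m)$ is obtained from $n$ vertex-disjoint copies of $C_m$, labelled $1,\dots,n$, with $x_i,y_i$ the copies of $x,y$ in the $i$th copy, by identifying $y_i$ with $x_{i+1}$ for $1\le i<n$ and $y_n$ with $x_1$. -}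

module Defs where

open import Algebra.Bundles using (CommutativeRing)
open import Data.Bool using (if_then_else_)
open import Data.Fin using (Fin; toℕ; _≟_; _<?_; combine; remQuot; punchIn; punchOut)
open import Data.Fin.Properties
  using (any?; toℕ<n; toℕ-fromℕ<; combine-injectiveˡ; combine-injectiveʳ; combine-remQuot;
         punchOut-injective; punchOut-punchIn; punchOut-cong; punchInᵢ≢i)
open import Data.Integer using (+_)
open import Data.List using (allFin; cartesianProduct; filter; length)
open import Data.Nat as ℕ using (ℕ; zero; suc; pred; NonZero; s≤s; z≤n)
open import Data.Nat.DivMod using (_mod_; _%_; m%n<n; m<n⇒m%n≡m; n%n≡0)
open import Data.Nat.Properties as ℕₚ using (m*n≢0)
open import Data.Product using (∃; _×_; _,_)
open import Data.Rational using (ℚ; 0ℚ; 1ℚ; _+_; _*_; _-_; _/_)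
open import Data.Rational.Properties using (+-*-commutativeRing)
open import Data.Sum using (_⊎_; inj₁; inj₂; swap)
open import Data.Vec.Functional using (Vector)
open import Function using (_∘_)
open import Level using (0ℓ)
open import Relation.Binary using (Rel; Decidable; Symmetric)
open import Relation.Binary.Construct.Closure.Equivalence using (EqClosure)
open import Relation.Binary.Construct.Closure.ReflexiveTransitive using (ε; _◅_)
open import Relation.Binary.Construct.Closure.Symmetric using (fwd; bwd)
open import Relation.Binary.PropositionalEquality
  using (_≡_; _≢_; refl; sym; trans; cong; subst)
open import Relation.Nullary using (¬_; Dec; yes; no; contradiction)
open import Relation.Nullary.Decidable using (_×-dec_; _⊎-dec_; does)

open import Algebra.Properties.Semiring.Sum
  (CommutativeRing.semiring +-*-commutativeRing) public
  using (sum; sum-syntax)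

record Graph (N : ℕ) : Set₁ where
  field
    Adj    : Rel (Fin N) 0ℓ
    adj?   : Decidable Adj
    symm   : Symmetric Adj
    irrefl : ∀ {u} → ¬ Adj u u

open Graph public

module _ {N : ℕ} (G : Graph N) where

  data Walk : Fin N → Fin N → ℕ → Set where
    here : ∀ {u} → Walk u u 0
    step : ∀ {u v w ℓ} → Adj G u v → Walk v w ℓ → Walk u w (suc ℓ)

  Connected : Set
  Connected = ∀ u v → ∃ λ ℓ → Walk u v ℓ

  IsDistance : Fin N → Fin N → ℕ → Set
  IsDistance u v d = Walk u v d × (∀ {ℓ} → Walk u v ℓ → d ℕ.≤ ℓ)

  degree : Fin N → ℕ
  degree u = length (filter (adj? G u) (allFin N))

  -- Each edge is counted once, as the pair (u , v) with u < v.
  size : ℕ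
  size = length (filter (λ (u , v) → (u <? v) ×-dec adj? G u v)
                        (cartesianProduct (allFin N) (allFin N)))

Matrix : ℕ → Set
Matrix N = Fin N → Fin N → ℚ

infixl 7 _⊗_
infix  8 _ᵀ
infix  4 _≐_

_⊗_ : ∀ {N} → Matrix N → Matrix N → Matrix N
_⊗_ {N} A B i j = ∑[ k < N ] (A i k * B k j)

_ᵀ : ∀ {N} → Matrix N → Matrix N
(A ᵀ) i j = A j i

_≐_ : ∀ {N} → Matrix N → Matrix N → Set
A ≐ B = ∀ i j → A i j ≡ B i j

-- The four Penrose equations determine the pseudoinverse uniquely.  The
-- pseudoinverse of a rational matrix is rational, so for the Laplacian
-- nothing is lost by working over ℚ instead of ℝ.
record IsPseudoinverse {N : ℕ} (A A† : Matrix N) : Set where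
  field
    AA†A≐A   : A ⊗ A† ⊗ A ≐ A
    A†AA†≐A† : A† ⊗ A ⊗ A† ≐ A†
    AA†-sym  : (A ⊗ A†) ᵀ ≐ A ⊗ A†
    A†A-sym  : (A† ⊗ A) ᵀ ≐ A† ⊗ A

-- Iverson bracket.
⟦_⟧ : ∀ {p} {P : Set p} → Dec P → ℚ
⟦ P? ⟧ = if does P? then 1ℚ else 0ℚ

e : ∀ {N} → Fin N → Vector ℚ N
e i k = ⟦ i ≟ k ⟧

quadraticForm : ∀ {N} → Matrix N → Vector ℚ N → ℚ
quadraticForm {N} A x = ∑[ k < N ] ∑[ l < N ] (x k * A k l * x l)

fromℕ : ℕ → ℚ
fromℕ k = + k / 1

module _ {N : ℕ} (G : Graph N) where

  laplacian : Matrix N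
  laplacian i j = fromℕ (degree G i) * ⟦ i ≟ j ⟧ - ⟦ adj? G i j ⟧

  -- L† stands for the pseudoinverse of the Laplacian.
  resistance : Matrix N → Fin N → Fin N → ℚ
  resistance L† i j = quadraticForm L† (λ k → e i k - e j k)

  kemenyFormula : Matrix N → .{{NonZero (size G)}} → ℚ
  kemenyFormula L† =
    (+ 1 / (4 ℕ.* size G)) {{m*n≢0 4 (size G)}} *
    ∑[ i < N ] ∑[ j < N ]
      (fromℕ (degree G i) * fromℕ (degree G j) * resistance L† i j)

  -- "Kemeny's constant of G is defined and equals κ."
  record IsKemenyConstant (κ : ℚ) : Set where
    field
      connected     : Connected G
      {{hasEdges}}  : NonZero (size G)
      pseudoinverse : ∃ λ L† → IsPseudoinverse laplacian L†
      value         : ∀ L† → IsPseudoinverse laplacian L† → kemenyFormula L† ≡ κ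

-- Cyclic successor: i ↦ i + 1 modulo n.
next : ∀ {n} → Fin n → Fin n
next {suc n} i = suc (toℕ i) mod suc n

next≢ : ∀ {n} → 2 ℕ.≤ n → (i : Fin n) → next i ≢ i
next≢ {suc n} 2≤n i eq = case (ℕₚ.m≤n⇒m<n∨m≡n (toℕ<n i))
  where
  %-eq : suc (toℕ i) % suc n ≡ toℕ i
  %-eq = trans (sym (toℕ-fromℕ< (m%n<n (suc (toℕ i)) (suc n)))) (cong toℕ eq)
  case : ¬ (suc (toℕ i) ℕ.< suc n ⊎ suc (toℕ i) ≡ suc n)
  case (inj₁ lt)   = ℕₚ.1+n≢n (trans (sym (m<n⇒m%n≡m lt)) %-eq)
  case (inj₂ last) = ℕₚ.<⇒≢ 2≤n (trans (cong suc (sym toℕ-zero)) last)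
    where
    toℕ-zero : toℕ i ≡ 0
    toℕ-zero = trans (sym %-eq) (trans (cong (_% suc n) last) (n%n≡0 (suc n)))

cycle : (m : ℕ) → 3 ℕ.≤ m → Graph m
cycle m 3≤m = record
  { Adj    = λ u v → next u ≡ v ⊎ next v ≡ u
  ; adj?   = λ u v → (next u ≟ v) ⊎-dec (next v ≟ u)
  ; symm   = swap
  ; irrefl = λ { (inj₁ p) → next≢ 2≤m _ p ; (inj₂ p) → next≢ 2≤m _ p }
  }
  where
  2≤m : 2 ℕ.≤ m
  2≤m = ℕₚ.≤-trans (s≤s (s≤s z≤n)) 3≤m

-- (i , v) is the copy of v in the i-th of n copies of C_m.  The
-- identification makes y_i equal to x_{i+1}, with i + 1 read cyclically,
-- so each class has exactly one member (i , v) with v ≢ y.  These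
-- representatives are numbered by Fin (n * (m - 1)); `glue` sends a vertex
-- of the disjoint union to the number of its class.
glue : ∀ {m n} (x y : Fin m) → x ≢ y → Fin n × Fin m → Fin (n ℕ.* pred m)
glue {suc _} x y x≢y (i , v) with y ≟ v
... | yes _   = combine (next i) (punchOut (x≢y ∘ sym))
... | no  y≢v = combine i (punchOut y≢v)

data Identified {m n} (x y : Fin m) : Rel (Fin n × Fin m) 0ℓ where
  y~x : ∀ i → Identified x y (i , y) (next i , x)

-- The next three lemmas show that `glue` is the quotient map by the
-- equivalence relation generated by the identifications.
glue-surjective : ∀ {m n} (x y : Fin m) (x≢y : x ≢ y) (u : Fin (n ℕ.* pred m)) →
                  ∃ λ (a : Fin n × Fin m) → glue x y x≢y a ≡ u
glue-surjective {suc m} {n} x y x≢y u =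
  let (i , k) = remQuot {n} m u in (i , punchIn y k) , lemma i k (combine-remQuot {n} m u)
  where
  lemma : ∀ (i : Fin n) k → combine i k ≡ u → glue x y x≢y (i , punchIn y k) ≡ u
  lemma i k eq with y ≟ punchIn y k
  ... | yes p = contradiction (sym p) (punchInᵢ≢i y k)
  ... | no  p = trans (cong (combine i) (trans (punchOut-cong y refl) (punchOut-punchIn y))) eq

glue-sound : ∀ {m n} (x y : Fin m) (x≢y : x ≢ y) {a b : Fin n × Fin m} →
             EqClosure (Identified x y) a b → glue x y x≢y a ≡ glue x y x≢y b
glue-sound {m} {n} x y x≢y = go
  where
  one : ∀ {m} (x y : Fin m) (x≢y : x ≢ y) {a b : Fin n × Fin m} →
        Identified x y a b → glue x y x≢y a ≡ glue x y x≢y b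
  one {suc _} x y x≢y (y~x i) with y ≟ y | y ≟ x
  ... | yes _ | yes p = contradiction (sym p) x≢y
  ... | yes _ | no  _ = cong (combine (next i)) (punchOut-cong y refl)
  ... | no  p | _     = contradiction refl p
  go : ∀ {a b} → EqClosure (Identified x y) a b → glue x y x≢y a ≡ glue x y x≢y b
  go ε            = refl
  go (fwd p ◅ ps) = trans (one x y x≢y p) (go ps)
  go (bwd p ◅ ps) = trans (sym (one x y x≢y p)) (go ps)

glue-complete : ∀ {m n} (x y : Fin m) (x≢y : x ≢ y) {a b : Fin n × Fin m} →
                glue x y x≢y a ≡ glue x y x≢y b → EqClosure (Identified x y) a b
glue-complete {suc m} {n} x y x≢y {i , v} {j , w} eq with y ≟ v | y ≟ w
... | yes refl | yes refl
  with pair ← combine-injectiveˡ (next i) _ (next j) _ eq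
  = fwd (y~x i) ◅ subst (λ k → EqClosure (Identified x y) (k , x) (j , y)) (sym pair)
                        (bwd (y~x j) ◅ ε)
... | yes refl | no y≢w
  with refl ← combine-injectiveˡ (next i) _ j _ eq
     | refl ← punchOut-injective (x≢y ∘ sym) y≢w (combine-injectiveʳ (next i) _ j _ eq)
  = fwd (y~x i) ◅ ε
... | no y≢v | yes refl
  with refl ← combine-injectiveˡ i _ (next j) _ eq
     | refl ← punchOut-injective y≢v (x≢y ∘ sym) (combine-injectiveʳ i _ (next j) _ eq)
  = bwd (y~x j) ◅ ε
... | no y≢v | no y≢w
  with refl ← combine-injectiveˡ i _ j _ eq
     | refl ← punchOut-injective y≢v y≢w (combine-injectiveʳ i _ j _ eq)
  = ε

glue-injectiveʳ : ∀ {m n} → 2 ℕ.≤ n → (x y : Fin m) (x≢y : x ≢ y) (i : Fin n) {v w : Fin m} →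
                  glue x y x≢y (i , v) ≡ glue x y x≢y (i , w) → v ≡ w
glue-injectiveʳ {suc m} 2≤n x y x≢y i {v} {w} eq with y ≟ v | y ≟ w
... | yes p   | yes q   = trans (sym p) q
... | yes _   | no  _   = contradiction (combine-injectiveˡ (next i) _ i _ eq) (next≢ 2≤n i)
... | no  _   | yes _   = contradiction (sym (combine-injectiveˡ i _ (next i) _ eq)) (next≢ 2≤n i)
... | no  y≢v | no  y≢w = punchOut-injective y≢v y≢w (combine-injectiveʳ i _ i _ eq)

-- Two classes are adjacent when they contain adjacent vertices of some
-- common copy of C_m.
sunflower : ∀ {m} n (3≤m : 3 ℕ.≤ m) (3≤n : 3 ℕ.≤ n) (x y : Fin m) → x ≢ y → Graph (n ℕ.* pred m)
sunflower {m} n 3≤m 3≤n x y x≢y = record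
  { Adj    = SAdj
  ; adj?   = λ s t → any? λ i → any? λ v → any? λ w →
               (glue x y x≢y (i , v) ≟ s) ×-dec (glue x y x≢y (i , w) ≟ t) ×-dec adj? Cₘ v w
  ; symm   = λ { (i , v , w , p , q , a) → i , w , v , q , p , symm Cₘ {v} {w} a }
  ; irrefl = λ { (i , v , w , p , q , a) →
               irrefl Cₘ (subst (Adj Cₘ v)
                 (sym (glue-injectiveʳ 2≤n x y x≢y i (trans p (sym q)))) a) }
  }
  where
  Cₘ : Graph m
  Cₘ = cycle m 3≤m
  2≤n : 2 ℕ.≤ n
  2≤n = ℕₚ.≤-trans (s≤s (s≤s z≤n)) 3≤n
  SAdj : Rel (Fin (n ℕ.* pred m)) 0ℓ
  SAdj s t = ∃ λ i → ∃ λ v → ∃ λ w →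
    glue x y x≢y (i , v) ≡ s × glue x y x≢y (i , w) ≡ t × Adj Cₘ v w

{-# OPTIONS --safe #-}

module Submission where

open import Defs
open import Algebra.Bundles using (CommutativeRing)
open import Data.Bool using (true; false)
open import Data.Fin as Fin using (Fin; zero; suc; toℕ; _≟_; _<?_; inject₁)
open import Data.Fin.Permutation using (permutation)
import Data.Fin.Properties as Finₚ
open import Data.Fin.Properties using (any?; combine-injectiveˡ; combine-injectiveʳ; punchOut-injective)
open import Data.Integer as ℤ using (ℤ)
import Data.Integer.Properties as ℤₚ
import Data.Integer.Tactic.RingSolver as ℤ-Solver
open import Data.List as List using (length; filter; map; tabulate; cartesianProduct)
import Data.List.Properties as Listₚ
open import Data.Nat as ℕ using (ℕ; zero; suc; pred; NonZero; ∣_-_∣; s≤s; z≤n)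
open import Data.Nat.DivMod using (_%_; m%n<n; m<n⇒m%n≡m; n%n≡0)
import Data.Nat.Properties as ℕₚ
open import Data.Product using (∃; _×_; _,_; proj₁; proj₂)
open import Data.Rational using (ℚ; 0ℚ; 1ℚ; ½; _/_; fromℚᵘ)
open import Data.Rational.Properties as ℚₚ using (+-*-commutativeRing)
open import Data.Rational.Unnormalised as ℚᵘ using (mkℚᵘ; *≡*)
import Data.Rational.Unnormalised.Properties as ℚᵘₚ
open import Data.Sum using (_⊎_; inj₁; inj₂)
open import Function using (_∘_; id)
open import Level using (0ℓ)
open import Relation.Binary using (Setoid; tri<; tri≈; tri>)
open import Relation.Binary.Construct.Closure.ReflexiveTransitive using (ε; _◅_)
open import Relation.Binary.Construct.Closure.Symmetric using (fwd)
open import Relation.Binary.PropositionalEquality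
import Relation.Binary.Reasoning.Setoid as SetoidReasoning
open import Relation.Nullary using (¬_; Dec; yes; no; contradiction)
open import Relation.Nullary.Decidable using (does; dec-true; dec-false; dec⇒maybe; _×-dec_; _⊎-dec_)
open import Relation.Unary using (Pred; Decidable)
open import Tactic.RingSolver using (solve-∀)
open import Tactic.RingSolver.Core.AlmostCommutativeRing
  using (AlmostCommutativeRing; fromCommutativeRing)

-- A symmetric matrix G with L G = I − u 1ᵀ determines all resistances:
-- r(s,t) = G ss + G tt − G st − G ts, whatever pseudoinverse L† is used.  For
-- the sunflower such a G is assembled from cycles only.  On the cycle Cₙ the
-- product d (n − d) of the two arcs cut out by two vertices has Laplacian
-- 2 − 2n δ.  Grounding x and y in C_m turns it into a Dirichlet Green's
-- function Γ of one copy, and shrinking every copy to a single edge between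
-- its copies of x and y turns the sunflower into the cycle Cₙ; G is the sum
-- of Γ on each copy and the harmonic interpolation of the kernel of Cₙ.
-- Degrees in the sunflower are 2 per copy of a vertex, so Kemeny's constant
-- is a sum over all pairs (copy, vertex), which splits into power sums along
-- the arcs.

-- The vector u is left free on purpose. For the pseudoinverse itself the compensating current is
-- spread over all vertices, and it would disturb every copy from inside. Here it leaves through the
-- n junctions only, so that inside a copy a unit source is all there is and a Dirichlet kernel fits
-- without correction. Let k = -d (m - d) / (2m), which inverts the Laplacian of C_m up to
-- constants. The kernel Γ is k, minus its harmonic interpolation from x and y in either variable,
-- plus the interpolation in both. The ring solver knows no division. Hence 1/m, 1/n and the inverse
-- of the arc product A of x and y enter as variables μ, ν, α with the equations μ m = 1, ν n = 1, α
-- A = 1. Long identities are first brought into a form where these products stand as factors, which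
-- are then replaced by 1. The vertices x and y influence the result only through A. The distance p
-- is one of the two arcs, and A does not tell which, so p may be put in at the very end.

-- Integers and fractions inside the rationals.

module RationalArithmetic where

  open import Data.Integer using (+_)
  open import Data.Rational using (_+_; _*_; _-_; -_)

  ℚ-ring : AlmostCommutativeRing 0ℓ 0ℓ
  ℚ-ring = fromCommutativeRing +-*-commutativeRing λ x → dec⇒maybe (0ℚ ℚₚ.≟ x)

  -- `_/_` cancels common factors, so sums of fractions do not compute symbolically. Identities are
  -- therefore checked on unnormalised rationals, where equality is cross-multiplication, and
  -- transported along `fromℚᵘ`.
  fromℚᵘ-homo-+ : ∀ p q → fromℚᵘ (p ℚᵘ.+ q) ≡ fromℚᵘ p + fromℚᵘ q
  fromℚᵘ-homo-+ p q = ℚₚ.toℚᵘ-injective (ℚᵘₚ.≃-trans (ℚₚ.toℚᵘ-fromℚᵘ (p ℚᵘ.+ q)) (ℚᵘₚ.≃-sym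
    (ℚᵘₚ.≃-trans (ℚₚ.toℚᵘ-homo-+ (fromℚᵘ p) (fromℚᵘ q))
                 (ℚᵘₚ.+-cong (ℚₚ.toℚᵘ-fromℚᵘ p) (ℚₚ.toℚᵘ-fromℚᵘ q)))))

  fromℚᵘ-homo-* : ∀ p q → fromℚᵘ (p ℚᵘ.* q) ≡ fromℚᵘ p * fromℚᵘ q
  fromℚᵘ-homo-* p q = ℚₚ.toℚᵘ-injective (ℚᵘₚ.≃-trans (ℚₚ.toℚᵘ-fromℚᵘ (p ℚᵘ.* q)) (ℚᵘₚ.≃-sym
    (ℚᵘₚ.≃-trans (ℚₚ.toℚᵘ-homo-* (fromℚᵘ p) (fromℚᵘ q))
                 (ℚᵘₚ.*-cong (ℚₚ.toℚᵘ-fromℚᵘ p) (ℚₚ.toℚᵘ-fromℚᵘ q)))))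

  fromℤ : ℤ → ℚ
  fromℤ z = z / 1

  fromℤ-+ : ∀ i j → fromℤ (i ℤ.+ j) ≡ fromℤ i + fromℤ j
  fromℤ-+ i j = trans (ℚₚ.fromℚᵘ-cong {mkℚᵘ (i ℤ.+ j) 0} {mkℚᵘ i 0 ℚᵘ.+ mkℚᵘ j 0} (*≡* (identity i j)))
                        (fromℚᵘ-homo-+ (mkℚᵘ i 0) (mkℚᵘ j 0))
    where
    identity : ∀ i j → (i ℤ.+ j) ℤ.* + 1 ≡ (i ℤ.* + 1 ℤ.+ j ℤ.* + 1) ℤ.* + 1
    identity = ℤ-Solver.solve-∀

  fromℤ-* : ∀ i j → fromℤ (i ℤ.* j) ≡ fromℤ i * fromℤ j
  fromℤ-* i j = fromℚᵘ-homo-* (mkℚᵘ i 0) (mkℚᵘ j 0)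

  fromℤ-- : ∀ i j → fromℤ (i ℤ.- j) ≡ fromℤ i - fromℤ j
  fromℤ-- i j = trans (move (fromℤ (i ℤ.- j)) (fromℤ j))
    (cong (_- fromℤ j) (trans (sym (fromℤ-+ (i ℤ.- j) j)) (cong fromℤ (cancel i j))))
    where
    move : ∀ a b → a ≡ a + b - b
    move = solve-∀ ℚ-ring
    cancel : ∀ i j → i ℤ.- j ℤ.+ j ≡ i
    cancel = ℤ-Solver.solve-∀

  fromℕ-+ : ∀ a b → fromℕ (a ℕ.+ b) ≡ fromℕ a + fromℕ b
  fromℕ-+ a b = fromℤ-+ (+ a) (+ b)

  fromℕ-* : ∀ a b → fromℕ (a ℕ.* b) ≡ fromℕ a * fromℕ b
  fromℕ-* a b = trans (cong fromℤ (ℤₚ.pos-* a b)) (fromℤ-* (+ a) (+ b))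


  fromℕ-suc : ∀ a → fromℕ (suc a) ≡ 1ℚ + fromℕ a
  fromℕ-suc = fromℕ-+ 1

  /-cancel : ∀ z d .{{_ : NonZero d}} → z / d * fromℕ d ≡ fromℤ z
  /-cancel z d@(suc d-1) = trans (sym (fromℚᵘ-homo-* (mkℚᵘ z d-1) (mkℚᵘ (+ d) 0)))
    (ℚₚ.fromℚᵘ-cong {mkℚᵘ z d-1 ℚᵘ.* mkℚᵘ (+ d) 0} {mkℚᵘ z 0} (*≡* (identity z (+ d))))
    where
    identity : ∀ z d → z ℤ.* d ℤ.* + 1 ≡ z ℤ.* (d ℤ.* + 1)
    identity = ℤ-Solver.solve-∀

  recip : ∀ d .{{_ : NonZero d}} → + 1 / d * fromℕ d ≡ 1ℚ
  recip = /-cancel (+ 1)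

open RationalArithmetic

-- Finite sums, indicators and counting.

module FiniteSums where

  open import Data.Rational using (_+_; _*_; _-_; -_)

  open import Algebra.Properties.Semiring.Sum (CommutativeRing.semiring +-*-commutativeRing) public
    using (∑-distrib-+; ∑-comm; ∑-permute; *-distribˡ-sum; *-distribʳ-sum)
    renaming (sum-cong-≗ to ∑-cong)

  ∑-cong₂ : ∀ {M N} {f g : Fin M → Fin N → ℚ} → (∀ i j → f i j ≡ g i j) →
            ∑[ i < M ] ∑[ j < N ] f i j ≡ ∑[ i < M ] ∑[ j < N ] g i j
  ∑-cong₂ f≡g = ∑-cong λ i → ∑-cong (f≡g i)

  ∑-const : ∀ N c → ∑[ i < N ] c ≡ fromℕ N * c
  ∑-const zero    c = sym (ℚₚ.*-zeroˡ c)
  ∑-const (suc N) c = trans (cong (c +_) (∑-const N c))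
    (trans (collect (fromℕ N) c) (cong (_* c) (sym (fromℕ-suc N))))
    where
    collect : ∀ a c → c + a * c ≡ (1ℚ + a) * c
    collect = solve-∀ ℚ-ring

  ∑-zero : ∀ {N} {f : Fin N → ℚ} → (∀ i → f i ≡ 0ℚ) → ∑[ i < N ] f i ≡ 0ℚ
  ∑-zero {N} f≡0 = trans (∑-cong f≡0) (trans (∑-const N 0ℚ) (ℚₚ.*-zeroʳ (fromℕ N)))

  ∑-distrib-- : ∀ {N} (f g : Fin N → ℚ) → ∑[ i < N ] (f i - g i) ≡ ∑[ i < N ] f i - ∑[ i < N ] g i
  ∑-distrib-- {zero}  f g = refl
  ∑-distrib-- {suc N} f g = trans (cong (f zero - g zero +_) (∑-distrib-- (f ∘ suc) (g ∘ suc)))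
    (shuffle (f zero) (g zero) _ _)
    where
    shuffle : ∀ a b c d → a - b + (c - d) ≡ a + c - (b + d)
    shuffle = solve-∀ ℚ-ring

  ⟦⟧-true : ∀ {p} {P : Set p} (P? : Dec P) → P → ⟦ P? ⟧ ≡ 1ℚ
  ⟦⟧-true P? p rewrite dec-true P? p = refl

  ⟦⟧-false : ∀ {p} {P : Set p} (P? : Dec P) → ¬ P → ⟦ P? ⟧ ≡ 0ℚ
  ⟦⟧-false P? ¬p rewrite dec-false P? ¬p = refl

  ⟦⟧-cong : ∀ {p q} {P : Set p} {Q : Set q} (P? : Dec P) (Q? : Dec Q) →
            (P → Q) → (Q → P) → ⟦ P? ⟧ ≡ ⟦ Q? ⟧
  ⟦⟧-cong (yes p) Q? to from = sym (⟦⟧-true Q? (to p))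
  ⟦⟧-cong (no ¬p) Q? to from = sym (⟦⟧-false Q? (¬p ∘ from))

  ⟦≟⟧-sym : ∀ {N} (i j : Fin N) → ⟦ i ≟ j ⟧ ≡ ⟦ j ≟ i ⟧
  ⟦≟⟧-sym i j = ⟦⟧-cong (i ≟ j) (j ≟ i) sym sym

  ⟦⟧-× : ∀ {p q} {P : Set p} {Q : Set q} (P? : Dec P) (Q? : Dec Q) →
         ⟦ P? ×-dec Q? ⟧ ≡ ⟦ P? ⟧ * ⟦ Q? ⟧
  ⟦⟧-× P? Q? with does P? | does Q?
  ... | true  | true  = refl
  ... | true  | false = refl
  ... | false | true  = refl
  ... | false | false = refl

  ⟦⟧-⊎ : ∀ {p q} {P : Set p} {Q : Set q} (P? : Dec P) (Q? : Dec Q) → ¬ (P × Q) →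
         ⟦ P? ⊎-dec Q? ⟧ ≡ ⟦ P? ⟧ + ⟦ Q? ⟧
  ⟦⟧-⊎ (yes p) (yes q) ¬pq = contradiction (p , q) ¬pq
  ⟦⟧-⊎ (yes p) (no _)  _   = refl
  ⟦⟧-⊎ (no _)  (yes q) _   = refl
  ⟦⟧-⊎ (no _)  (no _)  _   = refl

  ⟦≟⟧-subst : ∀ {N} (i j : Fin N) (f : Fin N → ℚ) → ⟦ i ≟ j ⟧ * f j ≡ ⟦ i ≟ j ⟧ * f i
  ⟦≟⟧-subst i j f with i ≟ j
  ... | yes refl = refl
  ... | no  _    = trans (ℚₚ.*-zeroˡ (f j)) (sym (ℚₚ.*-zeroˡ (f i)))

  ∑-δ : ∀ {N} (i : Fin N) (f : Fin N → ℚ) → ∑[ k < N ] (⟦ i ≟ k ⟧ * f k) ≡ f i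
  ∑-δ zero    f = trans (cong₂ _+_ (ℚₚ.*-identityˡ (f zero)) (∑-zero λ k → ℚₚ.*-zeroˡ (f (suc k))))
                        (ℚₚ.+-identityʳ (f zero))
  ∑-δ (suc i) f = trans (cong₂ _+_ (ℚₚ.*-zeroˡ (f zero)) (∑-δ i (f ∘ suc))) (ℚₚ.+-identityˡ _)

  ∑-δ′ : ∀ {N} (i : Fin N) (f : Fin N → ℚ) → ∑[ k < N ] (⟦ k ≟ i ⟧ * f k) ≡ f i
  ∑-δ′ i f = trans (∑-cong λ k → cong (_* f k) (⟦≟⟧-sym k i)) (∑-δ i f)

  -- A unique solution makes the sum a single delta. This is what turns the existentially defined
  -- adjacency of the sunflower into a sum of products.
  ∑-⟦⟧-unique : ∀ {N p} {P : Pred (Fin N) p} (P? : Decidable P) →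
                (∀ {i j} → P i → P j → i ≡ j) → ∑[ i < N ] ⟦ P? i ⟧ ≡ ⟦ any? P? ⟧
  ∑-⟦⟧-unique P? unique = go (any? P?)
    where
    go : (d : Dec (∃ _)) → sum (λ i → ⟦ P? i ⟧) ≡ ⟦ d ⟧
    go (yes (i , p)) = trans
      (∑-cong λ k → trans (⟦⟧-cong (P? k) (i ≟ k) (unique p) λ { refl → p }) (sym (ℚₚ.*-identityʳ _)))
      (∑-δ i λ _ → 1ℚ)
    go (no ¬p) = ∑-zero λ k → ⟦⟧-false (P? k) λ p → ¬p (k , p)

  length-filter-tabulate : ∀ {a p} {A : Set a} {P : Pred A p} (P? : Decidable P) {N} (f : Fin N → A) →
    fromℕ (length (filter P? (tabulate f))) ≡ ∑[ k < N ] ⟦ P? (f k) ⟧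
  length-filter-tabulate P? {zero}  f = refl
  length-filter-tabulate P? {suc N} f with does (P? (f zero))
  ... | true  = trans (fromℕ-suc (length (filter P? (tabulate (f ∘ suc))))) (cong (1ℚ +_) (length-filter-tabulate P? (f ∘ suc)))
  ... | false = trans (length-filter-tabulate P? (f ∘ suc)) (sym (ℚₚ.+-identityˡ _))

  length-filter-cartesianProduct : ∀ {a b p} {A : Set a} {B : Set b} {P : Pred (A × B) p}
    (P? : Decidable P) {M N} (f : Fin M → A) (g : Fin N → B) →
    fromℕ (length (filter P? (cartesianProduct (tabulate f) (tabulate g)))) ≡
    ∑[ i < M ] ∑[ j < N ] ⟦ P? (f i , g j) ⟧
  length-filter-cartesianProduct P? {zero}  f g = refl
  length-filter-cartesianProduct P? {suc M} f g = begin
    fromℕ (length (filter P? (row List.++ rest)))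
      ≡⟨ cong (fromℕ ∘ length) (Listₚ.filter-++ P? row rest) ⟩
    fromℕ (length (filter P? row List.++ filter P? rest))
      ≡⟨ cong fromℕ (Listₚ.length-++ (filter P? row)) ⟩
    fromℕ (length (filter P? row) ℕ.+ length (filter P? rest))
      ≡⟨ fromℕ-+ (length (filter P? row)) (length (filter P? rest)) ⟩
    fromℕ (length (filter P? row)) + fromℕ (length (filter P? rest))
      ≡⟨ cong₂ _+_
           (trans (cong (fromℕ ∘ length ∘ filter P?) (Listₚ.map-tabulate g (f zero ,_)))
                  (length-filter-tabulate P? ((f zero ,_) ∘ g)))
           (length-filter-cartesianProduct P? (f ∘ suc) g) ⟩
    _ ∎
    where
    open ≡-Reasoning
    row  = map (f zero ,_) (tabulate g)
    rest = cartesianProduct (tabulate (f ∘ suc)) (tabulate g)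

open FiniteSums

-- Resistances from a Green's matrix of the Laplacian.

module GreenMatrices where

  open import Data.Integer using (+_)
  open import Data.Rational using (_+_; _*_; _-_; -_)

  ≐-setoid : ℕ → Setoid 0ℓ 0ℓ
  ≐-setoid N = record
    { Carrier       = Matrix N
    ; _≈_           = _≐_
    ; isEquivalence = record
      { refl  = λ i j → refl
      ; sym   = λ p i j → sym (p i j)
      ; trans = λ p q i j → trans (p i j) (q i j)
      }
    }

  module ≐-Reasoning {N : ℕ} = SetoidReasoning (≐-setoid N)

  module _ {N : ℕ} where

    open Setoid (≐-setoid N) using () renaming (trans to ≐-trans) public

    ⊗-congˡ : ∀ (A : Matrix N) {B C} → B ≐ C → A ⊗ B ≐ A ⊗ C
    ⊗-congˡ A p i j = ∑-cong λ k → cong (A i k *_) (p k j)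

    ⊗-congʳ : ∀ (A : Matrix N) {B C} → B ≐ C → B ⊗ A ≐ C ⊗ A
    ⊗-congʳ A p i j = ∑-cong λ k → cong (_* A k j) (p i k)

    ⊗-assoc : ∀ (A B C : Matrix N) → A ⊗ B ⊗ C ≐ A ⊗ (B ⊗ C)
    ⊗-assoc A B C i j = begin
      ∑[ k < N ] (∑[ l < N ] (A i l * B l k) * C k j)
        ≡⟨ ∑-cong (λ k → *-distribʳ-sum (C k j) (λ l → A i l * B l k)) ⟩
      ∑[ k < N ] ∑[ l < N ] (A i l * B l k * C k j)
        ≡⟨ ∑-comm (λ k l → A i l * B l k * C k j) ⟩
      ∑[ l < N ] ∑[ k < N ] (A i l * B l k * C k j)
        ≡⟨ ∑-cong₂ (λ l k → ℚₚ.*-assoc (A i l) (B l k) (C k j)) ⟩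
      ∑[ l < N ] ∑[ k < N ] (A i l * (B l k * C k j))
        ≡⟨ ∑-cong (λ l → *-distribˡ-sum (A i l) (λ k → B l k * C k j)) ⟨
      ∑[ l < N ] (A i l * ∑[ k < N ] (B l k * C k j)) ∎
      where open ≡-Reasoning

    ᵀ-⊗ : ∀ (A B : Matrix N) → (A ⊗ B) ᵀ ≐ B ᵀ ⊗ A ᵀ
    ᵀ-⊗ A B i j = ∑-cong λ k → ℚₚ.*-comm (A j k) (B k i)

    -- I − u 1ᵀ
    rankOneDefect : (Fin N → ℚ) → Matrix N
    rankOneDefect u i j = ⟦ i ≟ j ⟧ - u i

    -- The correction is u times the row 1ᵀX of column sums, which vanishes. Since u is arbitrary,
    -- the lemma serves both the projection `P` and the defect of `L ⊗ G`.
    rankOneDefect-⊗ : ∀ u (X : Matrix N) → (∀ j → ∑[ k < N ] X k j ≡ 0ℚ) → rankOneDefect u ⊗ X ≐ X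
    rankOneDefect-⊗ u X columns i j = begin
      ∑[ k < N ] ((⟦ i ≟ k ⟧ - u i) * X k j)
        ≡⟨ ∑-cong (λ k → expand ⟦ i ≟ k ⟧ (u i) (X k j)) ⟩
      ∑[ k < N ] (⟦ i ≟ k ⟧ * X k j - u i * X k j)
        ≡⟨ ∑-distrib-- (λ k → ⟦ i ≟ k ⟧ * X k j) (λ k → u i * X k j) ⟩
      ∑[ k < N ] (⟦ i ≟ k ⟧ * X k j) - ∑[ k < N ] (u i * X k j)
        ≡⟨ cong₂ _-_ (∑-δ i (λ k → X k j)) (sym (*-distribˡ-sum (u i) (λ k → X k j))) ⟩
      X i j - u i * ∑[ k < N ] X k j
        ≡⟨ cong (λ z → X i j - u i * z) (columns j) ⟩
      X i j - u i * 0ℚ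
        ≡⟨ drop (X i j) (u i) ⟩
      X i j ∎
      where
      open ≡-Reasoning
      expand : ∀ a b c → (a - b) * c ≡ a * c - b * c
      expand = solve-∀ ℚ-ring
      drop : ∀ a b → a - b * 0ℚ ≡ a
      drop = solve-∀ ℚ-ring

  -- A symmetric matrix G with L G = I − u 1ᵀ is the pseudoinverse of L up to
  -- the projection I − J/N onto the range of L.
  module GreenMatrix {N : ℕ} .{{_ : NonZero N}} (L G : Matrix N) (u : Fin N → ℚ)
    (L-sym : L ᵀ ≐ L) (L-columns : ∀ j → ∑[ k < N ] L k j ≡ 0ℚ)
    (G-sym : G ᵀ ≐ G) (LG : L ⊗ G ≐ rankOneDefect u) where

    P M : Matrix N
    P = rankOneDefect λ _ → + 1 / N
    M = P ⊗ G ⊗ P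

    P-sym : P ᵀ ≐ P
    P-sym i j = cong (_- + 1 / N) (⟦≟⟧-sym j i)

    P-columns : ∀ j → ∑[ k < N ] P k j ≡ 0ℚ
    P-columns j = trans (∑-distrib-- (λ k → ⟦ k ≟ j ⟧) (λ _ → + 1 / N))
      (trans (cong₂ _-_
               (trans (∑-cong λ k → sym (ℚₚ.*-identityʳ ⟦ k ≟ j ⟧)) (∑-δ′ j λ _ → 1ℚ))
               (trans (∑-const N (+ 1 / N)) (trans (ℚₚ.*-comm (fromℕ N) (+ 1 / N)) (recip N))))
             (ℚₚ.+-inverseʳ 1ℚ))

    PL : P ⊗ L ≐ L
    PL = rankOneDefect-⊗ _ L L-columns

    LP : L ⊗ P ≐ L
    LP = begin
      L ⊗ P         ≈⟨ ⊗-congʳ P L-sym ⟨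
      L ᵀ ⊗ P       ≈⟨ ⊗-congˡ (L ᵀ) P-sym ⟨
      L ᵀ ⊗ P ᵀ     ≈⟨ ᵀ-⊗ P L ⟨
      (P ⊗ L) ᵀ     ≈⟨ (λ i j → PL j i) ⟩
      L ᵀ           ≈⟨ L-sym ⟩
      L             ∎
      where open ≐-Reasoning

    -- `L` absorbs the left factor `P`, and the right factor removes the defect u 1ᵀ of `L ⊗ G`
    -- because 1ᵀP = 0.
    LM : L ⊗ M ≐ P
    LM = begin
      L ⊗ (P ⊗ G ⊗ P)         ≈⟨ ⊗-assoc L (P ⊗ G) P ⟨
      L ⊗ (P ⊗ G) ⊗ P         ≈⟨ ⊗-congʳ P (⊗-assoc L P G) ⟨
      L ⊗ P ⊗ G ⊗ P           ≈⟨ ⊗-congʳ P (⊗-congʳ G LP) ⟩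
      L ⊗ G ⊗ P               ≈⟨ ⊗-congʳ P LG ⟩
      rankOneDefect u ⊗ P     ≈⟨ rankOneDefect-⊗ u P P-columns ⟩
      P                       ∎
      where open ≐-Reasoning

    M-sym : M ᵀ ≐ M
    M-sym = begin
      (P ⊗ G ⊗ P) ᵀ           ≈⟨ ᵀ-⊗ (P ⊗ G) P ⟩
      P ᵀ ⊗ (P ⊗ G) ᵀ         ≈⟨ ⊗-congˡ (P ᵀ) (ᵀ-⊗ P G) ⟩
      P ᵀ ⊗ (G ᵀ ⊗ P ᵀ)       ≈⟨ ⊗-congʳ (G ᵀ ⊗ P ᵀ) P-sym ⟩
      P ⊗ (G ᵀ ⊗ P ᵀ)         ≈⟨ ⊗-congˡ P (⊗-congʳ (P ᵀ) G-sym) ⟩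
      P ⊗ (G ⊗ P ᵀ)           ≈⟨ ⊗-congˡ P (⊗-congˡ G P-sym) ⟩
      P ⊗ (G ⊗ P)             ≈⟨ ⊗-assoc P G P ⟨
      P ⊗ G ⊗ P               ∎
      where open ≐-Reasoning

    ML : M ⊗ L ≐ P
    ML = begin
      M ⊗ L         ≈⟨ ⊗-congʳ L M-sym ⟨
      M ᵀ ⊗ L       ≈⟨ ⊗-congˡ (M ᵀ) L-sym ⟨
      M ᵀ ⊗ L ᵀ     ≈⟨ ᵀ-⊗ L M ⟨
      (L ⊗ M) ᵀ     ≈⟨ (λ i j → LM j i) ⟩
      P ᵀ           ≈⟨ P-sym ⟩
      P             ∎
      where open ≐-Reasoning

    M-columns : ∀ j → ∑[ k < N ] M k j ≡ 0ℚ
    M-columns j = begin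
      ∑[ k < N ] M k j                                  ≡⟨ ∑-cong (λ k → ⊗-assoc P G P k j) ⟩
      ∑[ k < N ] ∑[ l < N ] (P k l * (G ⊗ P) l j)       ≡⟨ ∑-comm (λ k l → P k l * (G ⊗ P) l j) ⟩
      ∑[ l < N ] ∑[ k < N ] (P k l * (G ⊗ P) l j)       ≡⟨ ∑-zero vanish ⟩
      0ℚ                                                ∎
      where
      open ≡-Reasoning
      vanish : ∀ l → ∑[ k < N ] (P k l * (G ⊗ P) l j) ≡ 0ℚ
      vanish l = trans (sym (*-distribʳ-sum ((G ⊗ P) l j) (λ k → P k l)))
        (trans (cong (_* (G ⊗ P) l j) (P-columns l)) (ℚₚ.*-zeroˡ ((G ⊗ P) l j)))

    isPseudoinverse : IsPseudoinverse L M
    isPseudoinverse = record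
      { AA†A≐A   = ≐-trans {i = L ⊗ M ⊗ L} (⊗-congʳ L LM) PL
      ; A†AA†≐A† = ≐-trans {i = M ⊗ L ⊗ M} (⊗-congʳ M ML) (rankOneDefect-⊗ _ M M-columns)
      ; AA†-sym  = λ i j → trans (LM j i) (trans (P-sym i j) (sym (LM i j)))
      ; A†A-sym  = λ i j → trans (ML j i) (trans (P-sym i j) (sym (ML i j)))
      }

    -- The potential f of a unit current from i to j satisfies L f = eᵢ − eⱼ,
    -- and then (L f)ᵀ L† (L f) = fᵀ L f = f i − f j for every L† with
    -- L L† L = L.
    module _ (i j : Fin N) where

      f : Fin N → ℚ
      f k = G k i - G k j
      -- The vectors f and eᵢ - eⱼ are stored as matrices with equal columns, so that the calculus
      -- of `⊗` applies; any entry of ZᵀL†Z is then the quadratic form.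
      F Z : Matrix N
      F k _ = f k
      Z k _ = e i k - e j k

      -- The defect u is the same in every column of `L ⊗ G`, so it drops out of the difference of
      -- two columns.
      LF : L ⊗ F ≐ Z
      LF k _ = trans (∑-cong λ l → expand (L k l) (G l i) (G l j))
        (trans (∑-distrib-- (λ l → L k l * G l i) (λ l → L k l * G l j))
        (trans (cong₂ _-_ (LG k i) (LG k j))
        (trans (cancel ⟦ k ≟ i ⟧ (u k) ⟦ k ≟ j ⟧) (cong₂ _-_ (⟦≟⟧-sym k i) (⟦≟⟧-sym k j)))))
        where
        expand : ∀ a b c → a * (b - c) ≡ a * b - a * c
        expand = solve-∀ ℚ-ring
        cancel : ∀ a b c → a - b - (c - b) ≡ a - c
        cancel = solve-∀ ℚ-ring

      ZᵀL : Z ᵀ ≐ F ᵀ ⊗ L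
      ZᵀL = begin
        Z ᵀ           ≈⟨ (λ k l → LF l k) ⟨
        (L ⊗ F) ᵀ     ≈⟨ ᵀ-⊗ L F ⟩
        F ᵀ ⊗ L ᵀ     ≈⟨ ⊗-congˡ (F ᵀ) L-sym ⟩
        F ᵀ ⊗ L       ∎
        where open ≐-Reasoning

      energy : ∀ {L†} → IsPseudoinverse L L† → Z ᵀ ⊗ L† ⊗ Z ≐ F ᵀ ⊗ Z
      energy {L†} isPinv = begin
        Z ᵀ ⊗ L† ⊗ Z                 ≈⟨ ⊗-congʳ Z (⊗-congʳ L† ZᵀL) ⟩
        F ᵀ ⊗ L ⊗ L† ⊗ Z             ≈⟨ ⊗-congˡ (F ᵀ ⊗ L ⊗ L†) LF ⟨
        F ᵀ ⊗ L ⊗ L† ⊗ (L ⊗ F)       ≈⟨ ⊗-assoc (F ᵀ ⊗ L ⊗ L†) L F ⟨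
        F ᵀ ⊗ L ⊗ L† ⊗ L ⊗ F         ≈⟨ ⊗-congʳ F (⊗-congʳ L (⊗-assoc (F ᵀ) L L†)) ⟩
        F ᵀ ⊗ (L ⊗ L†) ⊗ L ⊗ F       ≈⟨ ⊗-congʳ F (⊗-assoc (F ᵀ) (L ⊗ L†) L) ⟩
        F ᵀ ⊗ (L ⊗ L† ⊗ L) ⊗ F       ≈⟨ ⊗-congʳ F (⊗-congˡ (F ᵀ) (IsPseudoinverse.AA†A≐A isPinv)) ⟩
        F ᵀ ⊗ L ⊗ F                  ≈⟨ ⊗-assoc (F ᵀ) L F ⟩
        F ᵀ ⊗ (L ⊗ F)                ≈⟨ ⊗-congˡ (F ᵀ) LF ⟩
        F ᵀ ⊗ Z                      ∎
        where open ≐-Reasoning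

      quadraticForm-pseudoinverse : ∀ {L†} → IsPseudoinverse L L† →
        quadraticForm L† (λ k → e i k - e j k) ≡ G i i + G j j - G i j - G j i
      quadraticForm-pseudoinverse {L†} isPinv = begin
        ∑[ k < N ] ∑[ l < N ] (Z k i * L† k l * Z l i)
          ≡⟨ ∑-comm (λ k l → Z k i * L† k l * Z l i) ⟩
        ∑[ l < N ] ∑[ k < N ] (Z k i * L† k l * Z l i)
          ≡⟨ ∑-cong (λ l → *-distribʳ-sum (Z l i) (λ k → Z k i * L† k l)) ⟨
        (Z ᵀ ⊗ L† ⊗ Z) i i
          ≡⟨ energy isPinv i i ⟩
        ∑[ k < N ] (f k * (e i k - e j k))
          ≡⟨ ∑-cong (λ k → swap (f k) (e i k) (e j k)) ⟩
        ∑[ k < N ] (e i k * f k - e j k * f k)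
          ≡⟨ ∑-distrib-- (λ k → e i k * f k) (λ k → e j k * f k) ⟩
        ∑[ k < N ] (e i k * f k) - ∑[ k < N ] (e j k * f k)
          ≡⟨ cong₂ _-_ (∑-δ i f) (∑-δ j f) ⟩
        f i - f j
          ≡⟨ regroup (G i i) (G i j) (G j i) (G j j) ⟩
        G i i + G j j - G i j - G j i ∎
        where
        open ≡-Reasoning
        swap : ∀ a b c → a * (b - c) ≡ b * a - c * a
        swap = solve-∀ ℚ-ring
        regroup : ∀ a b c d → a - b - (c - d) ≡ a + d - b - c
        regroup = solve-∀ ℚ-ring

open GreenMatrices

-- The kernel d (n - d) on a cycle and its Laplacian.

module CycleResistances where

  open import Data.Rational using (_+_; _*_; _-_; -_)

  toℕ-next : ∀ {n} (v : Fin n) →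
             toℕ (next v) ≡ suc (toℕ v) ⊎ (suc (toℕ v) ≡ n × toℕ (next v) ≡ 0)
  toℕ-next {suc n} v = case (ℕₚ.m≤n⇒m<n∨m≡n (Finₚ.toℕ<n v))
    where
    reduce : toℕ (next v) ≡ suc (toℕ v) % suc n
    reduce = Finₚ.toℕ-fromℕ< (m%n<n (suc (toℕ v)) (suc n))
    case : suc (toℕ v) ℕ.< suc n ⊎ suc (toℕ v) ≡ suc n → _
    case (inj₁ lt)   = inj₁ (trans reduce (m<n⇒m%n≡m lt))
    case (inj₂ last) = inj₂ (last , trans reduce (trans (cong (_% suc n) last) (n%n≡0 (suc n))))

  prev : ∀ {n} → Fin n → Fin n
  prev {suc n} zero    = Fin.fromℕ n
  prev {suc n} (suc v) = inject₁ v

  next-prev : ∀ {n} (v : Fin n) → next (prev v) ≡ v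
  next-prev {suc n} zero with toℕ-next (Fin.fromℕ n)
  ... | inj₁ eq = contradiction (trans eq (cong suc (Finₚ.toℕ-fromℕ n))) 
                                  (ℕₚ.<⇒≢ (Finₚ.toℕ<n (next (Fin.fromℕ n))))
  ... | inj₂ (_ , eq) = Finₚ.toℕ-injective eq
  next-prev {suc n} (suc v) with toℕ-next (inject₁ v)
  ... | inj₁ eq = Finₚ.toℕ-injective (trans eq (cong suc (Finₚ.toℕ-inject₁ v)))
  ... | inj₂ (eq , _) = contradiction (trans (cong suc (sym (Finₚ.toℕ-inject₁ v))) eq)
                                      (ℕₚ.<⇒≢ (s≤s (Finₚ.toℕ<n v)))

  next-injective : ∀ {n} {v w : Fin n} → next v ≡ next w → v ≡ w
  next-injective {n} {v} {w} eq with toℕ-next v | toℕ-next w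
  ... | inj₁ p       | inj₁ q       = Finₚ.toℕ-injective (ℕₚ.suc-injective (trans (sym p) (trans (cong toℕ eq) q)))
  ... | inj₁ p       | inj₂ (_ , q) = contradiction (trans (sym p) (trans (cong toℕ eq) q)) ℕₚ.1+n≢0
  ... | inj₂ (_ , p) | inj₁ q       = contradiction (trans (sym q) (trans (cong toℕ (sym eq)) p)) ℕₚ.1+n≢0
  ... | inj₂ (p , _) | inj₂ (q , _) = Finₚ.toℕ-injective (ℕₚ.suc-injective (trans p (sym q)))

  prev-next : ∀ {n} (v : Fin n) → prev (next v) ≡ v
  prev-next v = next-injective (next-prev (next v))

  ∑-next : ∀ {n} (f : Fin n → ℚ) → ∑[ i < n ] f (next i) ≡ ∑[ i < n ] f i
  ∑-next f = sym (∑-permute f (permutation next prev next-prev prev-next))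

  -- For m this says that the two neighbours of a vertex of C_m differ; for n it will say that two
  -- copies share at most one vertex.
  next²≢ : ∀ {n} → 3 ℕ.≤ n → (v : Fin n) → next (next v) ≢ v
  next²≢ {n} 3≤n v eq with toℕ-next v | toℕ-next (next v)
  ... | inj₁ p       | inj₁ q       =
    ℕₚ.<⇒≢ (ℕₚ.m<n+m (toℕ v) {2} (s≤s z≤n)) (trans (sym (cong toℕ eq)) (trans q (cong suc p)))
  ... | inj₁ p       | inj₂ (r , q) = ℕₚ.<⇒≢ 3≤n
    (trans (cong (2 ℕ.+_) (trans (sym q) (cong toℕ eq))) (trans (cong suc (sym p)) r))
  ... | inj₂ (r , p) | inj₁ q       = ℕₚ.<⇒≢ 3≤n
    (trans (cong suc (trans (cong suc (sym p)) (trans (sym q) (cong toℕ eq)))) r)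
  ... | inj₂ (_ , p) | inj₂ (r , _) = ℕₚ.<⇒≢ (ℕₚ.≤-trans (s≤s (s≤s z≤n)) 3≤n) (trans (cong suc (sym p)) r)

  -- The Laplacian of the cycle acting on functions, with the sign of degree minus adjacency.
  Δ : ∀ {n} → (Fin n → ℚ) → Fin n → ℚ
  Δ f v = f v + f v - (f (next v) + f (prev v))

  dist : ℕ → ℕ → ℚ
  dist a b = fromℕ ∣ a - b ∣

  -- Vertices a and b cut Cₙ into two arcs of lengths d and n - d, so this is
  -- n times their resistance distance.
  arcProduct : ℕ → ℕ → ℕ → ℚ
  arcProduct n a b = dist a b * (fromℕ n - dist a b)

  arcs : ∀ {n} → Matrix n
  arcs {n} v w = arcProduct n (toℕ v) (toℕ w)

  arcProduct-sym : ∀ n a b → arcProduct n a b ≡ arcProduct n b a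
  arcProduct-sym n a b = cong (λ d → fromℕ d * (fromℕ n - fromℕ d)) (ℕₚ.∣-∣-comm a b)

  arcs-sym : ∀ {n} (v w : Fin n) → arcs v w ≡ arcs w v
  arcs-sym {n} v w = arcProduct-sym n (toℕ v) (toℕ w)

  arcs-diag : ∀ {n} (v : Fin n) → arcs v v ≡ 0ℚ
  arcs-diag {n} v = trans (cong (λ d → fromℕ d * (fromℕ n - fromℕ d)) (ℕₚ.∣n-n∣≡0 (toℕ v)))
                          (ℚₚ.*-zeroˡ (fromℕ n - 0ℚ))

  -- Seen from n instead of 0, the two arcs to b trade places.
  arcProduct-periodic : ∀ {n b} → b ℕ.≤ n → arcProduct n n b ≡ arcProduct n 0 b
  arcProduct-periodic {n} {b} b≤n with r , refl ← ℕₚ.m≤n⇒∃[o]m+o≡n b≤n = begin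
    dist (b ℕ.+ r) b * (fromℕ (b ℕ.+ r) - dist (b ℕ.+ r) b)
      ≡⟨ cong₂ (λ d N → fromℕ d * (N - fromℕ d))
           (trans (ℕₚ.∣-∣-comm (b ℕ.+ r) b) (ℕₚ.∣m-m+n∣≡n b r)) (fromℕ-+ b r) ⟩
    fromℕ r * (fromℕ b + fromℕ r - fromℕ r)
      ≡⟨ identity (fromℕ b) (fromℕ r) ⟩
    fromℕ b * (fromℕ b + fromℕ r - fromℕ b)
      ≡⟨ cong (λ N → fromℕ b * (N - fromℕ b)) (fromℕ-+ b r) ⟨
    fromℕ b * (fromℕ (b ℕ.+ r) - fromℕ b) ∎
    where
    open ≡-Reasoning
    identity : ∀ b r → r * (b + r - r) ≡ b * (b + r - b)
    identity = solve-∀ ℚ-ring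

  -- Allows the position n as another name of 0, so that the successor can be written as
  -- `suc (toℕ v)` without a case for the wraparound.
  arcs-next : ∀ {n} (v w : Fin n) → arcs (next v) w ≡ arcProduct n (suc (toℕ v)) (toℕ w)
  arcs-next {n} v w with toℕ-next v
  ... | inj₁ p       = cong (λ a → arcProduct n a (toℕ w)) p
  ... | inj₂ (r , p) = begin
    arcProduct n (toℕ (next v)) (toℕ w)  ≡⟨ cong (λ a → arcProduct n a (toℕ w)) p ⟩
    arcProduct n 0 (toℕ w)               ≡⟨ arcProduct-periodic (ℕₚ.<⇒≤ (Finₚ.toℕ<n w)) ⟨
    arcProduct n n (toℕ w)               ≡⟨ cong (λ a → arcProduct n a (toℕ w)) r ⟨
    arcProduct n (suc (toℕ v)) (toℕ w)   ∎
    where open ≡-Reasoning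

  -- Squaring removes the absolute value, so in d n - d² only the linear term is not a polynomial in
  -- the positions.
  dist² : ∀ a b → dist a b * dist a b ≡ (fromℕ a - fromℕ b) * (fromℕ a - fromℕ b)
  dist² zero    b       = identity (fromℕ b)
    where
    identity : ∀ b → b * b ≡ (0ℚ - b) * (0ℚ - b)
    identity = solve-∀ ℚ-ring
  dist² (suc a) zero    = identity (fromℕ (suc a))
    where
    identity : ∀ a → a * a ≡ (a - 0ℚ) * (a - 0ℚ)
    identity = solve-∀ ℚ-ring
  dist² (suc a) (suc b) = begin
    dist a b * dist a b
      ≡⟨ dist² a b ⟩
    (fromℕ a - fromℕ b) * (fromℕ a - fromℕ b)
      ≡⟨ identity (fromℕ a) (fromℕ b) ⟩
    (1ℚ + fromℕ a - (1ℚ + fromℕ b)) * (1ℚ + fromℕ a - (1ℚ + fromℕ b))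
      ≡⟨ cong₂ (λ x y → (x - y) * (x - y)) (fromℕ-suc a) (fromℕ-suc b) ⟨
    (fromℕ (suc a) - fromℕ (suc b)) * (fromℕ (suc a) - fromℕ (suc b)) ∎
    where
    open ≡-Reasoning
    identity : ∀ a b → (a - b) * (a - b) ≡ (1ℚ + a - (1ℚ + b)) * (1ℚ + a - (1ℚ + b))
    identity = solve-∀ ℚ-ring

  -- The slope of the absolute value jumps from -1 to 1 at b and is constant elsewhere.
  dist-convex : ∀ a b → dist a b + dist (2 ℕ.+ a) b ≡
                dist (suc a) b + dist (suc a) b + (⟦ suc a ℕ.≟ b ⟧ + ⟦ suc a ℕ.≟ b ⟧)
  dist-convex a zero = begin
    dist a 0 + fromℕ (2 ℕ.+ a)
      ≡⟨ cong₂ _+_ (cong fromℕ (ℕₚ.∣-∣-identityʳ a)) (trans (fromℕ-suc (suc a)) (cong (1ℚ +_) (fromℕ-suc a))) ⟩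
    fromℕ a + (1ℚ + (1ℚ + fromℕ a))
      ≡⟨ identity (fromℕ a) ⟩
    1ℚ + fromℕ a + (1ℚ + fromℕ a) + (0ℚ + 0ℚ)
      ≡⟨ cong (λ s → s + s + (0ℚ + 0ℚ)) (fromℕ-suc a) ⟨
    fromℕ (suc a) + fromℕ (suc a) + (0ℚ + 0ℚ) ∎
    where
    open ≡-Reasoning
    identity : ∀ a → a + (1ℚ + (1ℚ + a)) ≡ 1ℚ + a + (1ℚ + a) + (0ℚ + 0ℚ)
    identity = solve-∀ ℚ-ring
  dist-convex zero    (suc zero)    = refl
  dist-convex zero    (suc (suc b)) = begin
    fromℕ (2 ℕ.+ b) + fromℕ b
      ≡⟨ cong (_+ fromℕ b) (trans (fromℕ-suc (suc b)) (cong (1ℚ +_) (fromℕ-suc b))) ⟩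
    1ℚ + (1ℚ + fromℕ b) + fromℕ b
      ≡⟨ identity (fromℕ b) ⟩
    1ℚ + fromℕ b + (1ℚ + fromℕ b) + (0ℚ + 0ℚ)
      ≡⟨ cong (λ s → s + s + (0ℚ + 0ℚ)) (fromℕ-suc b) ⟨
    fromℕ (suc b) + fromℕ (suc b) + (0ℚ + 0ℚ) ∎
    where
    open ≡-Reasoning
    identity : ∀ b → 1ℚ + (1ℚ + b) + b ≡ 1ℚ + b + (1ℚ + b) + (0ℚ + 0ℚ)
    identity = solve-∀ ℚ-ring
  dist-convex (suc a) (suc b) = dist-convex a b

  -- In n d - d² the square contributes the constant 2, and the kink of d at b contributes -2n
  -- there.
  arcProduct-concave : ∀ n a b → let ψ = λ c → arcProduct n c b in
    ψ (suc a) + ψ (suc a) - (ψ (2 ℕ.+ a) + ψ a) ≡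
    fromℕ 2 - fromℕ 2 * fromℕ n * ⟦ suc a ℕ.≟ b ⟧
  arcProduct-concave n a b = begin
    ψ (suc a) + ψ (suc a) - (ψ (2 ℕ.+ a) + ψ a)
      ≡⟨ cong₂ _-_ (cong₂ _+_ (quadratic (suc a)) (quadratic (suc a))) (cong₂ _+_ (quadratic (2 ℕ.+ a)) (quadratic a)) ⟩
    q (suc a) + q (suc a) - (q (2 ℕ.+ a) + q a)
      ≡⟨ cong₂ (λ s₁ s₂ → let p₁ = s₁ - fromℕ b; p₂ = s₂ - fromℕ b in
                  d₁ * N - p₁ * p₁ + (d₁ * N - p₁ * p₁) - (d₂ * N - p₂ * p₂ + q a))
               (fromℕ-suc a) (trans (fromℕ-suc (suc a)) (cong (1ℚ +_) (fromℕ-suc a))) ⟩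
    _ ≡⟨ expand d₀ d₁ d₂ N (fromℕ a) (fromℕ b) ⟩
    fromℕ 2 - N * (d₀ + d₂ - (d₁ + d₁))
      ≡⟨ cong (λ z → fromℕ 2 - N * (z - (d₁ + d₁))) (dist-convex a b) ⟩
    fromℕ 2 - N * (d₁ + d₁ + (t + t) - (d₁ + d₁))
      ≡⟨ collect N d₁ t ⟩
    fromℕ 2 - fromℕ 2 * N * t ∎
    where
    open ≡-Reasoning
    ψ q : ℕ → ℚ
    ψ c = arcProduct n c b
    q c = dist c b * fromℕ n - (fromℕ c - fromℕ b) * (fromℕ c - fromℕ b)
    N d₀ d₁ d₂ t : ℚ
    N = fromℕ n
    d₀ = dist a b
    d₁ = dist (suc a) b
    d₂ = dist (2 ℕ.+ a) b
    t = ⟦ suc a ℕ.≟ b ⟧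
    distribute : ∀ d N → d * (N - d) ≡ d * N - d * d
    distribute = solve-∀ ℚ-ring
    quadratic : ∀ c → ψ c ≡ q c
    quadratic c = trans (distribute (dist c b) N) (cong (_-_ (dist c b * N)) (dist² c b))
    expand : ∀ d₀ d₁ d₂ N a b →
      d₁ * N - (1ℚ + a - b) * (1ℚ + a - b) + (d₁ * N - (1ℚ + a - b) * (1ℚ + a - b))
        - (d₂ * N - (1ℚ + (1ℚ + a) - b) * (1ℚ + (1ℚ + a) - b) + (d₀ * N - (a - b) * (a - b))) ≡
      fromℕ 2 - N * (d₀ + d₂ - (d₁ + d₁))
    expand = solve-∀ ℚ-ring
    collect : ∀ N d t → fromℕ 2 - N * (d + d + (t + t) - (d + d)) ≡ fromℕ 2 - fromℕ 2 * N * t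
    collect = solve-∀ ℚ-ring

  -- Centring at `next v` makes the three points v, v + 1, v + 2, which are consecutive naturals up
  -- to periodicity unless `next v` is the vertex 0.
  arcs-Δ-next : ∀ {n} (v w : Fin n) →
    arcs (next v) w + arcs (next v) w - (arcs (next (next v)) w + arcs v w) ≡
    fromℕ 2 - fromℕ 2 * fromℕ n * ⟦ next v ≟ w ⟧
  arcs-Δ-next {n} v w with toℕ-next v
  ... | inj₁ p = begin
    arcs (next v) w + arcs (next v) w - (arcs (next (next v)) w + arcs v w)
      ≡⟨ cong₂ (λ s t → s + s - (t + arcs v w)) (arcs-next v w)
           (trans (arcs-next (next v) w) (cong (λ a → arcProduct n (suc a) (toℕ w)) p)) ⟩
    _ ≡⟨ arcProduct-concave n (toℕ v) (toℕ w) ⟩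
    fromℕ 2 - fromℕ 2 * fromℕ n * ⟦ suc (toℕ v) ℕ.≟ toℕ w ⟧
      ≡⟨ cong (λ z → fromℕ 2 - fromℕ 2 * fromℕ n * z)
           (⟦⟧-cong (suc (toℕ v) ℕ.≟ toℕ w) (next v ≟ w)
             (λ eq → Finₚ.toℕ-injective (trans p eq)) (λ { refl → sym p })) ⟩
    fromℕ 2 - fromℕ 2 * fromℕ n * ⟦ next v ≟ w ⟧ ∎
    where open ≡-Reasoning
  -- The centre is 0 and its neighbours sit at 1 and n - 1, so `arcProduct-concave` does not apply;
  -- `wrap` evaluates the three products directly, with n written as `suc a`.
  ... | inj₂ (last , p) = begin
    arcs (next v) w + arcs (next v) w - (arcs (next (next v)) w + arcs v w)
      ≡⟨ cong₂ (λ s t → s + s - (t + arcs v w)) (cong (λ a → arcProduct n a (toℕ w)) p)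
           (trans (arcs-next (next v) w) (cong (λ a → arcProduct n (suc a) (toℕ w)) p)) ⟩
    arcProduct n 0 b + arcProduct n 0 b - (arcProduct n 1 b + arcProduct n a b)
      ≡⟨ cong (λ k → arcProduct k 0 b + arcProduct k 0 b - (arcProduct k 1 b + arcProduct k a b)) last ⟨
    arcProduct (suc a) 0 b + arcProduct (suc a) 0 b - (arcProduct (suc a) 1 b + arcProduct (suc a) a b)
      ≡⟨ wrap a b (ℕₚ.≤-pred (subst (toℕ w ℕ.<_) (sym last) (Finₚ.toℕ<n w))) ⟩
    fromℕ 2 - fromℕ 2 * fromℕ (suc a) * ⟦ 0 ℕ.≟ b ⟧
      ≡⟨ cong₂ (λ k z → fromℕ 2 - fromℕ 2 * fromℕ k * z) last
           (⟦⟧-cong (0 ℕ.≟ b) (next v ≟ w)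
             (λ eq → Finₚ.toℕ-injective (trans p eq)) (λ { refl → sym p })) ⟩
    fromℕ 2 - fromℕ 2 * fromℕ n * ⟦ next v ≟ w ⟧ ∎
    where
    open ≡-Reasoning
    a b : ℕ
    a = toℕ v
    b = toℕ w
    wrap : ∀ a b → b ℕ.≤ a →
      arcProduct (suc a) 0 b + arcProduct (suc a) 0 b - (arcProduct (suc a) 1 b + arcProduct (suc a) a b) ≡
      fromℕ 2 - fromℕ 2 * fromℕ (suc a) * ⟦ 0 ℕ.≟ b ⟧
    wrap a zero _ = begin
      0ℚ * (fromℕ (suc a) - 0ℚ) + 0ℚ * (fromℕ (suc a) - 0ℚ)
        - (1ℚ * (fromℕ (suc a) - 1ℚ) + dist a 0 * (fromℕ (suc a) - dist a 0))
        ≡⟨ cong₂ (λ s d → 0ℚ * (s - 0ℚ) + 0ℚ * (s - 0ℚ) - (1ℚ * (s - 1ℚ) + d * (s - d)))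
             (fromℕ-suc a) (cong fromℕ (ℕₚ.∣-∣-identityʳ a)) ⟩
      _ ≡⟨ identity (fromℕ a) ⟩
      fromℕ 2 - fromℕ 2 * (1ℚ + fromℕ a) * 1ℚ
        ≡⟨ cong (λ s → fromℕ 2 - fromℕ 2 * s * 1ℚ) (fromℕ-suc a) ⟨
      fromℕ 2 - fromℕ 2 * fromℕ (suc a) * 1ℚ ∎
      where
      identity : ∀ a → 0ℚ * (1ℚ + a - 0ℚ) + 0ℚ * (1ℚ + a - 0ℚ) - (1ℚ * (1ℚ + a - 1ℚ) + a * (1ℚ + a - a))
                       ≡ fromℕ 2 - fromℕ 2 * (1ℚ + a) * 1ℚ
      identity = solve-∀ ℚ-ring
    wrap a (suc b) b<a with r , refl ← ℕₚ.m≤n⇒∃[o]m+o≡n b<a = begin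
      fromℕ (suc b) * (N - fromℕ (suc b)) + fromℕ (suc b) * (N - fromℕ (suc b))
        - (fromℕ b * (N - fromℕ b) + dist (suc b ℕ.+ r) (suc b) * (N - dist (suc b ℕ.+ r) (suc b)))
        ≡⟨ cong₂ (λ s d → s * (N - s) + s * (N - s) - (fromℕ b * (N - fromℕ b) + d * (N - d)))
             (fromℕ-suc b) (cong fromℕ (trans (ℕₚ.∣-∣-comm (suc b ℕ.+ r) (suc b)) (ℕₚ.∣m-m+n∣≡n (suc b) r))) ⟩
      q N
        ≡⟨ cong q (trans (fromℕ-suc (suc b ℕ.+ r)) (cong (_+_ 1ℚ) (trans (fromℕ-suc (b ℕ.+ r)) (cong (_+_ 1ℚ) (fromℕ-+ b r))))) ⟩
      q (1ℚ + (1ℚ + (fromℕ b + fromℕ r)))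
        ≡⟨ identity (fromℕ b) (fromℕ r) ⟩
      fromℕ 2
        ≡⟨ drop N ⟩
      fromℕ 2 - fromℕ 2 * N * 0ℚ ∎
      where
      N : ℚ
      N = fromℕ (suc (suc b ℕ.+ r))
      q : ℚ → ℚ
      q N = let s = 1ℚ + fromℕ b in
        s * (N - s) + s * (N - s) - (fromℕ b * (N - fromℕ b) + fromℕ r * (N - fromℕ r))
      identity : ∀ b r → let N = 1ℚ + (1ℚ + (b + r)); s = 1ℚ + b in
        s * (N - s) + s * (N - s) - (b * (N - b) + r * (N - r)) ≡ fromℕ 2
      identity = solve-∀ ℚ-ring
      drop : ∀ N → fromℕ 2 ≡ fromℕ 2 - fromℕ 2 * N * 0ℚ
      drop = solve-∀ ℚ-ring

  arcs-Δ : ∀ {n} (v w : Fin n) → Δ (λ u → arcs u w) v ≡ fromℕ 2 - fromℕ 2 * fromℕ n * ⟦ v ≟ w ⟧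
  arcs-Δ {n} v w = subst
    (λ s → arcs s w + arcs s w - (arcs (next s) w + arcs (prev v) w) ≡ fromℕ 2 - fromℕ 2 * fromℕ n * ⟦ s ≟ w ⟧)
    (next-prev v) (arcs-Δ-next (prev v) w)

  arcs-next-diag : ∀ {n} (v : Fin n) → arcs v (next v) ≡ fromℕ n - 1ℚ
  arcs-next-diag {n} v = begin
    arcs v (next v)                                ≡⟨ arcs-sym v (next v) ⟩
    arcs (next v) v                                ≡⟨ arcs-next v v ⟩
    arcProduct n (suc (toℕ v)) (toℕ v)             ≡⟨ cong (λ d → fromℕ d * (fromℕ n - fromℕ d)) (dist-suc (toℕ v)) ⟩
    1ℚ * (fromℕ n - 1ℚ)                            ≡⟨ ℚₚ.*-identityˡ _ ⟩
    fromℕ n - 1ℚ                                   ∎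
    where
    open ≡-Reasoning
    dist-suc : ∀ a → ∣ suc a - a ∣ ≡ 1
    dist-suc zero    = refl
    dist-suc (suc a) = dist-suc a

  -- Power sums along the arcs of a cycle.

  ∑-last : ∀ n (f : ℕ → ℚ) → ∑[ v < suc n ] f (toℕ v) ≡ ∑[ v < n ] f (toℕ v) + f n
  ∑-last zero    f = ℚₚ.+-comm (f 0) 0ℚ
  ∑-last (suc n) f = trans (cong (_+_ (f 0)) (∑-last n (f ∘ suc)))
                           (sym (ℚₚ.+-assoc (f 0) (∑[ v < n ] f (suc (toℕ v))) (f (suc n))))

  -- Rotation of the cycle by one step, used to move a marked vertex down to 0.
  ∑-shift : ∀ n (f : ℕ → ℚ) → f n ≡ f 0 → ∑[ v < n ] f (suc (toℕ v)) ≡ ∑[ v < n ] f (toℕ v)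
  ∑-shift n f periodic = begin
    S                              ≡⟨ move (f 0) S ⟩
    f 0 + S - f 0                  ≡⟨ cong (_- f 0) (∑-last n f) ⟩
    ∑[ v < n ] f (toℕ v) + f n - f 0 ≡⟨ cong (λ z → ∑[ v < n ] f (toℕ v) + z - f 0) periodic ⟩
    ∑[ v < n ] f (toℕ v) + f 0 - f 0 ≡⟨ back (∑[ v < n ] f (toℕ v)) (f 0) ⟩
    ∑[ v < n ] f (toℕ v)           ∎
    where
    open ≡-Reasoning
    S : ℚ
    S = ∑[ v < n ] f (suc (toℕ v))
    move : ∀ a s → s ≡ a + s - a
    move = solve-∀ ℚ-ring
    back : ∀ s a → s + a - a ≡ s
    back = solve-∀ ℚ-ring

  ∑-split : ∀ a r (f : ℕ → ℚ) →
    ∑[ v < a ℕ.+ r ] f (toℕ v) ≡ ∑[ v < a ] f (toℕ v) + ∑[ v < r ] f (a ℕ.+ toℕ v)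
  ∑-split zero    r f = sym (ℚₚ.+-identityˡ _)
  ∑-split (suc a) r f = trans (cong (_+_ (f 0)) (∑-split a r (f ∘ suc)))
                              (sym (ℚₚ.+-assoc (f 0) (∑[ v < a ] f (suc (toℕ v))) (∑[ v < r ] f (suc a ℕ.+ toℕ v))))

  -- The factor 6 clears the denominators of the closed forms for the sums of v and of v².
  ∑-quadratic : ∀ K α β γ →
    fromℕ 6 * ∑[ v < K ] (α + β * fromℕ (toℕ v) + γ * (fromℕ (toℕ v) * fromℕ (toℕ v))) ≡
    fromℕ 6 * α * fromℕ K + fromℕ 3 * β * fromℕ K * (fromℕ K - 1ℚ)
      + γ * fromℕ K * (fromℕ K - 1ℚ) * (fromℕ 2 * fromℕ K - 1ℚ)
  ∑-quadratic zero    α β γ = base α β γ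
    where
    base : ∀ α β γ → fromℕ 6 * 0ℚ ≡ fromℕ 6 * α * 0ℚ + fromℕ 3 * β * 0ℚ * (0ℚ - 1ℚ)
             + γ * 0ℚ * (0ℚ - 1ℚ) * (fromℕ 2 * 0ℚ - 1ℚ)
    base = solve-∀ ℚ-ring
  ∑-quadratic (suc K) α β γ = begin
    fromℕ 6 * ∑[ v < suc K ] f (toℕ v)               ≡⟨ cong (_*_ (fromℕ 6)) (∑-last K f) ⟩
    fromℕ 6 * (∑[ v < K ] f (toℕ v) + f K)           ≡⟨ ℚₚ.*-distribˡ-+ (fromℕ 6) (∑[ v < K ] f (toℕ v)) (f K) ⟩
    fromℕ 6 * ∑[ v < K ] f (toℕ v) + fromℕ 6 * f K   ≡⟨ cong (_+ fromℕ 6 * f K) (∑-quadratic K α β γ) ⟩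
    _                                                ≡⟨ increment (fromℕ K) α β γ ⟩
    q (1ℚ + fromℕ K)                                 ≡⟨ cong q (fromℕ-suc K) ⟨
    q (fromℕ (suc K))                                ∎
    where
    open ≡-Reasoning
    f : ℕ → ℚ
    f v = α + β * fromℕ v + γ * (fromℕ v * fromℕ v)
    q : ℚ → ℚ
    q K = fromℕ 6 * α * K + fromℕ 3 * β * K * (K - 1ℚ) + γ * K * (K - 1ℚ) * (fromℕ 2 * K - 1ℚ)
    increment : ∀ K α β γ →
      fromℕ 6 * α * K + fromℕ 3 * β * K * (K - 1ℚ) + γ * K * (K - 1ℚ) * (fromℕ 2 * K - 1ℚ)
        + fromℕ 6 * (α + β * K + γ * (K * K)) ≡
      fromℕ 6 * α * (1ℚ + K) + fromℕ 3 * β * (1ℚ + K) * (1ℚ + K - 1ℚ)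
        + γ * (1ℚ + K) * (1ℚ + K - 1ℚ) * (fromℕ 2 * (1ℚ + K) - 1ℚ)
    increment = solve-∀ ℚ-ring

  ∑-arcProduct : ∀ n b → b ℕ.≤ n →
    fromℕ 6 * ∑[ v < n ] arcProduct n (toℕ v) b ≡ fromℕ n * (fromℕ n * fromℕ n - 1ℚ)
  ∑-arcProduct n zero    _   = begin
    fromℕ 6 * ∑[ v < n ] arcProduct n (toℕ v) 0
      ≡⟨ cong (_*_ (fromℕ 6)) (∑-cong {n} λ v → trans
           (cong (λ d → fromℕ d * (fromℕ n - fromℕ d)) (ℕₚ.∣-∣-identityʳ (toℕ v)))
           (expand (fromℕ n) (fromℕ (toℕ v)))) ⟩
    fromℕ 6 * ∑[ v < n ] (0ℚ + fromℕ n * fromℕ (toℕ v) + (- 1ℚ) * (fromℕ (toℕ v) * fromℕ (toℕ v)))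
      ≡⟨ ∑-quadratic n 0ℚ (fromℕ n) (- 1ℚ) ⟩
    _ ≡⟨ simplify (fromℕ n) ⟩
    fromℕ n * (fromℕ n * fromℕ n - 1ℚ) ∎
    where
    open ≡-Reasoning
    expand : ∀ n v → v * (n - v) ≡ 0ℚ + n * v + (- 1ℚ) * (v * v)
    expand = solve-∀ ℚ-ring
    simplify : ∀ n → fromℕ 6 * 0ℚ * n + fromℕ 3 * n * n * (n - 1ℚ)
      + (- 1ℚ) * n * (n - 1ℚ) * (fromℕ 2 * n - 1ℚ) ≡ n * (n * n - 1ℚ)
    simplify = solve-∀ ℚ-ring
  -- The distance from `suc v` to `suc b` computes to the distance from v to b, so one rotation
  -- lowers b by one.
  ∑-arcProduct n (suc b) b<n = trans
    (cong (_*_ (fromℕ 6)) (sym (∑-shift n (λ a → arcProduct n a (suc b)) (arcProduct-periodic b<n))))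
    (∑-arcProduct n b (ℕₚ.<⇒≤ b<n))

  ∑-arcs : ∀ {n} (w : Fin n) → fromℕ 6 * ∑[ v < n ] arcs v w ≡ fromℕ n * (fromℕ n * fromℕ n - 1ℚ)
  ∑-arcs {n} w = ∑-arcProduct n (toℕ w) (ℕₚ.<⇒≤ (Finₚ.toℕ<n w))

  ∑-square : ∀ K α β γ → let f = λ v → γ * (α + β * fromℕ v) in
    fromℕ 6 * ∑[ v < K ] (f (toℕ v) * f (toℕ v)) ≡
    γ * γ * (fromℕ 6 * (α * α) * fromℕ K + fromℕ 3 * (fromℕ 2 * α * β) * fromℕ K * (fromℕ K - 1ℚ)
      + β * β * fromℕ K * (fromℕ K - 1ℚ) * (fromℕ 2 * fromℕ K - 1ℚ))
  ∑-square K α β γ = begin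
    fromℕ 6 * ∑[ v < K ] (f (toℕ v) * f (toℕ v))
      ≡⟨ cong (_*_ (fromℕ 6)) (∑-cong {K} λ v → expand α β γ (fromℕ (toℕ v))) ⟩
    fromℕ 6 * ∑[ v < K ] (γ * γ * g v)
      ≡⟨ cong (_*_ (fromℕ 6)) (*-distribˡ-sum (γ * γ) g) ⟨
    fromℕ 6 * (γ * γ * ∑[ v < K ] g v)
      ≡⟨ swap (fromℕ 6) (γ * γ) (∑[ v < K ] g v) ⟩
    γ * γ * (fromℕ 6 * ∑[ v < K ] g v)
      ≡⟨ cong (_*_ (γ * γ)) (∑-quadratic K (α * α) (fromℕ 2 * α * β) (β * β)) ⟩
    _ ∎
    where
    open ≡-Reasoning
    f : ℕ → ℚ
    f v = γ * (α + β * fromℕ v)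
    g : Fin K → ℚ
    g v = α * α + fromℕ 2 * α * β * fromℕ (toℕ v) + β * β * (fromℕ (toℕ v) * fromℕ (toℕ v))
    expand : ∀ α β γ v → γ * (α + β * v) * (γ * (α + β * v)) ≡
             γ * γ * (α * α + fromℕ 2 * α * β * v + β * β * (v * v))
    expand = solve-∀ ℚ-ring
    swap : ∀ a b c → a * (b * c) ≡ b * (a * c)
    swap = solve-∀ ℚ-ring

  ∑-squares : ℕ → ℕ → ℕ → ℚ
  ∑-squares n x y = ∑[ v < n ] ((arcProduct n (toℕ v) x - arcProduct n (toℕ v) y) *
                                (arcProduct n (toℕ v) x - arcProduct n (toℕ v) y))

  -- On the two arcs between 0 and a, the difference of the arc products is an
  -- affine function of the position.
  ∑-squares-zero : ∀ a r → let A = arcProduct (a ℕ.+ r) 0 a in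
    fromℕ 3 * ∑-squares (a ℕ.+ r) 0 a ≡ fromℕ (a ℕ.+ r) * A * (A + fromℕ 2)
  ∑-squares-zero a r = begin
    fromℕ 3 * ∑[ v < n ] F (toℕ v)
      ≡⟨ cong (_*_ (fromℕ 3)) (trans (∑-split a r F) (cong₂ _+_ (∑-cong near) (∑-cong far))) ⟩
    fromℕ 3 * (∑[ v < a ] (f (toℕ v) * f (toℕ v)) + ∑[ v < r ] (g (toℕ v) * g (toℕ v)))
      ≡⟨ halve (∑[ v < a ] (f (toℕ v) * f (toℕ v))) (∑[ v < r ] (g (toℕ v) * g (toℕ v))) ⟩
    ½ * (fromℕ 6 * ∑[ v < a ] (f (toℕ v) * f (toℕ v)) + fromℕ 6 * ∑[ v < r ] (g (toℕ v) * g (toℕ v)))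
      ≡⟨ cong (_*_ ½) (cong₂ _+_ (∑-square a (- â) (fromℕ 2) r̂) (∑-square r r̂ (- fromℕ 2) â)) ⟩
    _ ≡⟨ simplify â r̂ ⟩
    (â + r̂) * (â * (â + r̂ - â)) * (â * (â + r̂ - â) + fromℕ 2)
      ≡⟨ cong (λ N → N * (â * (N - â)) * (â * (N - â) + fromℕ 2)) (fromℕ-+ a r) ⟨
    fromℕ n * (â * (fromℕ n - â)) * (â * (fromℕ n - â) + fromℕ 2) ∎
    where
    open ≡-Reasoning
    n : ℕ
    n = a ℕ.+ r
    â r̂ : ℚ
    â = fromℕ a
    r̂ = fromℕ r
    F f g : ℕ → ℚ
    F v = (arcProduct n v 0 - arcProduct n v a) * (arcProduct n v 0 - arcProduct n v a)
    f v = r̂ * (- â + fromℕ 2 * fromℕ v)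
    g v = â * (r̂ + (- fromℕ 2) * fromℕ v)
    near-identity : ∀ v s r → let a = v + s in
      v * (a + r - v) - s * (a + r - s) ≡ r * (- a + fromℕ 2 * v)
    near-identity = solve-∀ ℚ-ring
    far-identity : ∀ a v r → (a + v) * (a + r - (a + v)) - v * (a + r - v) ≡ a * (r + (- fromℕ 2) * v)
    far-identity = solve-∀ ℚ-ring
    near-≤ : ∀ v → v ℕ.≤ a → arcProduct n v 0 - arcProduct n v a ≡ f v
    near-≤ v v≤a with s , refl ← ℕₚ.m≤n⇒∃[o]m+o≡n v≤a = begin
      dist v 0 * (fromℕ n - dist v 0) - dist v a * (fromℕ n - dist v a)
        ≡⟨ cong₂ (λ d d′ → fromℕ d * (fromℕ n - fromℕ d) - fromℕ d′ * (fromℕ n - fromℕ d′))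
             (ℕₚ.∣-∣-identityʳ v) (ℕₚ.∣m-m+n∣≡n v s) ⟩
      fromℕ v * (fromℕ n - fromℕ v) - fromℕ s * (fromℕ n - fromℕ s)
        ≡⟨ cong (λ N → fromℕ v * (N - fromℕ v) - fromℕ s * (N - fromℕ s))
             (trans (fromℕ-+ a r) (cong (_+ r̂) (fromℕ-+ v s))) ⟩
      fromℕ v * (fromℕ v + fromℕ s + r̂ - fromℕ v) - fromℕ s * (fromℕ v + fromℕ s + r̂ - fromℕ s)
        ≡⟨ near-identity (fromℕ v) (fromℕ s) r̂ ⟩
      r̂ * (- (fromℕ v + fromℕ s) + fromℕ 2 * fromℕ v)
        ≡⟨ cong (λ A → r̂ * (- A + fromℕ 2 * fromℕ v)) (fromℕ-+ v s) ⟨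
      f v ∎
    near : ∀ v → F (toℕ v) ≡ f (toℕ v) * f (toℕ v)
    near v = cong (λ z → z * z) (near-≤ (toℕ v) (ℕₚ.<⇒≤ (Finₚ.toℕ<n {a} v)))
    far : ∀ v → F (a ℕ.+ toℕ {r} v) ≡ g (toℕ v) * g (toℕ v)
    far w = let v = toℕ w in cong (λ z → z * z) (begin
      dist (a ℕ.+ v) 0 * (fromℕ n - dist (a ℕ.+ v) 0) - dist (a ℕ.+ v) a * (fromℕ n - dist (a ℕ.+ v) a)
        ≡⟨ cong₂ (λ d d′ → fromℕ d * (fromℕ n - fromℕ d) - fromℕ d′ * (fromℕ n - fromℕ d′))
             (ℕₚ.∣-∣-identityʳ (a ℕ.+ v)) (trans (ℕₚ.∣-∣-comm (a ℕ.+ v) a) (ℕₚ.∣m-m+n∣≡n a v)) ⟩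
      fromℕ (a ℕ.+ v) * (fromℕ n - fromℕ (a ℕ.+ v)) - fromℕ v * (fromℕ n - fromℕ v)
        ≡⟨ cong₂ (λ N s → s * (N - s) - fromℕ v * (N - fromℕ v)) (fromℕ-+ a r) (fromℕ-+ a v) ⟩
      (â + fromℕ v) * (â + r̂ - (â + fromℕ v)) - fromℕ v * (â + r̂ - fromℕ v)
        ≡⟨ far-identity â (fromℕ v) r̂ ⟩
      g v ∎)
    halve : ∀ s t → fromℕ 3 * (s + t) ≡ ½ * (fromℕ 6 * s + fromℕ 6 * t)
    halve = solve-∀ ℚ-ring
    simplify : ∀ a r →
      ½ * (r * r * (fromℕ 6 * ((- a) * (- a)) * a + fromℕ 3 * (fromℕ 2 * (- a) * fromℕ 2) * a * (a - 1ℚ)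
             + fromℕ 2 * fromℕ 2 * a * (a - 1ℚ) * (fromℕ 2 * a - 1ℚ))
         + a * a * (fromℕ 6 * (r * r) * r + fromℕ 3 * (fromℕ 2 * r * (- fromℕ 2)) * r * (r - 1ℚ)
             + (- fromℕ 2) * (- fromℕ 2) * r * (r - 1ℚ) * (fromℕ 2 * r - 1ℚ))) ≡
      (a + r) * (a * (a + r - a)) * (a * (a + r - a) + fromℕ 2)
    simplify = solve-∀ ℚ-ring

  ∑-squares-sym : ∀ n x y → ∑-squares n x y ≡ ∑-squares n y x
  ∑-squares-sym n x y = ∑-cong {n} λ v → square-sym (arcProduct n (toℕ v) x) (arcProduct n (toℕ v) y)
    where
    square-sym : ∀ a b → (a - b) * (a - b) ≡ (b - a) * (b - a)
    square-sym = solve-∀ ℚ-ring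

  -- Rotation lowers both marked vertices together until one of them is 0, and a swap puts that one
  -- first.
  ∑-squares-formula : ∀ n x y → x ℕ.≤ n → y ℕ.≤ n → let A = arcProduct n x y in
    fromℕ 3 * ∑-squares n x y ≡ fromℕ n * A * (A + fromℕ 2)
  ∑-squares-formula n zero    y       _   y≤n with r , refl ← ℕₚ.m≤n⇒∃[o]m+o≡n y≤n = ∑-squares-zero y r
  ∑-squares-formula n (suc x) zero    x≤n y≤n = begin
    fromℕ 3 * ∑-squares n (suc x) 0
      ≡⟨ cong (_*_ (fromℕ 3)) (∑-squares-sym n (suc x) 0) ⟩
    fromℕ 3 * ∑-squares n 0 (suc x)
      ≡⟨ ∑-squares-formula n 0 (suc x) y≤n x≤n ⟩
    fromℕ n * arcProduct n 0 (suc x) * (arcProduct n 0 (suc x) + fromℕ 2)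
      ≡⟨⟩
    fromℕ n * arcProduct n (suc x) 0 * (arcProduct n (suc x) 0 + fromℕ 2) ∎
    where open ≡-Reasoning
  ∑-squares-formula n (suc x) (suc y) x≤n y≤n = trans
    (cong (_*_ (fromℕ 3)) (sym (∑-shift n
      (λ a → (arcProduct n a (suc x) - arcProduct n a (suc y)) * (arcProduct n a (suc x) - arcProduct n a (suc y)))
      (cong₂ (λ s t → (s - t) * (s - t)) (arcProduct-periodic x≤n) (arcProduct-periodic y≤n)))))
    (∑-squares-formula n x y (ℕₚ.<⇒≤ x≤n) (ℕₚ.<⇒≤ y≤n))

  ∑-arcs-squares : ∀ {n} (x y : Fin n) →
    fromℕ 3 * ∑[ v < n ] ((arcs v x - arcs v y) * (arcs v x - arcs v y)) ≡
    fromℕ n * arcs x y * (arcs x y + fromℕ 2)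
  ∑-arcs-squares {n} x y =
    ∑-squares-formula n (toℕ x) (toℕ y) (ℕₚ.<⇒≤ (Finₚ.toℕ<n x)) (ℕₚ.<⇒≤ (Finₚ.toℕ<n y))

  dist<n : ∀ {n} (x y : Fin n) → ∣ toℕ x - toℕ y ∣ ℕ.< n
  dist<n x y = ℕₚ.≤-<-trans (ℕₚ.∣m-n∣≤m⊔n (toℕ x) (toℕ y)) (ℕₚ.⊔-lub (Finₚ.toℕ<n x) (Finₚ.toℕ<n y))

  -- Both arcs between distinct vertices have positive length; the inverse is the product of the
  -- reciprocals of the two lengths.
  arcs-invertible : ∀ {n} {x y : Fin n} → x ≢ y → ∃ λ α → α * arcs x y ≡ 1ℚ
  arcs-invertible {n} {x} {y} x≢y = go ∣ toℕ x - toℕ y ∣ (n ℕ.∸ ∣ toℕ x - toℕ y ∣) refl (ℕₚ.m+[n∸m]≡n (ℕₚ.<⇒≤ (dist<n x y)))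
    where
    open ≡-Reasoning
    identity : ∀ u v s t → u * s ≡ 1ℚ → v * t ≡ 1ℚ → u * v * (s * (s + t - s)) ≡ 1ℚ
    identity u v s t p q = trans (rearrange u v s t) (cong₂ _*_ p q)
      where
      rearrange : ∀ u v s t → u * v * (s * (s + t - s)) ≡ u * s * (v * t)
      rearrange = solve-∀ ℚ-ring
    go : ∀ d r → ∣ toℕ x - toℕ y ∣ ≡ d → d ℕ.+ r ≡ n → ∃ λ α → α * arcs x y ≡ 1ℚ
    go zero    r       eq _  = contradiction (Finₚ.toℕ-injective (ℕₚ.∣m-n∣≡0⇒m≡n eq)) x≢y
    go (suc d) zero    eq eq′ = contradiction (trans eq (trans (sym (ℕₚ.+-identityʳ (suc d))) eq′)) (ℕₚ.<⇒≢ (dist<n x y))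
    go (suc d) (suc r) eq eq′ = α , (begin
      α * arcs x y
        ≡⟨ cong₂ (λ d n → α * (fromℕ d * (fromℕ n - fromℕ d))) eq (sym eq′) ⟩
      α * (fromℕ (suc d) * (fromℕ (suc d ℕ.+ suc r) - fromℕ (suc d)))
        ≡⟨ cong (λ N → α * (fromℕ (suc d) * (N - fromℕ (suc d)))) (fromℕ-+ (suc d) (suc r)) ⟩
      _ ≡⟨ identity (ℤ.+ 1 / suc d) (ℤ.+ 1 / suc r) (fromℕ (suc d)) (fromℕ (suc r)) (recip (suc d)) (recip (suc r)) ⟩
      1ℚ ∎)
      where
      α : ℚ
      α = ℤ.+ 1 / suc d * (ℤ.+ 1 / suc r)

open CycleResistances

-- Walks and distances in a cycle.

module CycleWalks where

  open import Data.Rational using (_+_; _*_; _-_; -_)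

  module _ {N : ℕ} {G : Graph N} where

    infixr 5 _++ʷ_

    _++ʷ_ : ∀ {u v w k ℓ} → Walk G u v k → Walk G v w ℓ → Walk G u w (k ℕ.+ ℓ)
    here     ++ʷ q = q
    step a p ++ʷ q = step a (p ++ʷ q)

    reverseWalk : ∀ {u v ℓ} → Walk G u v ℓ → Walk G v u ℓ
    reverseWalk here = here
    reverseWalk (step {ℓ = ℓ} a p) =
      subst (Walk G _ _) (ℕₚ.+-comm ℓ 1) (reverseWalk p ++ʷ step (symm G a) here)

  module _ {n : ℕ} (3≤n : 3 ℕ.≤ n) where

    private
      C : Graph n
      C = cycle n 3≤n

    ascend : ∀ k (u w : Fin n) → toℕ u ℕ.+ k ≡ toℕ w → Walk C u w k
    ascend zero    u w eq = subst (λ v → Walk C u v 0)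
      (Finₚ.toℕ-injective (trans (sym (ℕₚ.+-identityʳ (toℕ u))) eq)) here
    ascend (suc k) u w eq with toℕ-next u
    ... | inj₁ p = step (inj₁ refl)
      (ascend k (next u) w (trans (cong (ℕ._+ k) p) (trans (sym (ℕₚ.+-suc (toℕ u) k)) eq)))
    ... | inj₂ (last , _) = contradiction
      (ℕₚ.≤-trans (ℕₚ.≤-reflexive (sym last)) (ℕₚ.≤-trans (ℕₚ.m≤m+n (suc (toℕ u)) k)
        (ℕₚ.≤-reflexive (trans (sym (ℕₚ.+-suc (toℕ u) k)) eq))))
      (ℕₚ.<⇒≱ (Finₚ.toℕ<n w))

    ascend-around : ∀ k (u w : Fin n) → toℕ u ℕ.+ k ≡ n ℕ.+ toℕ w → Walk C u w k
    ascend-around zero    u w eq = contradiction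
      (ℕₚ.≤-trans (ℕₚ.m≤m+n n (toℕ w)) (ℕₚ.≤-reflexive (trans (sym eq) (ℕₚ.+-identityʳ (toℕ u)))))
      (ℕₚ.<⇒≱ (Finₚ.toℕ<n u))
    ascend-around (suc k) u w eq with toℕ-next u
    ... | inj₁ p = step (inj₁ refl)
      (ascend-around k (next u) w (trans (cong (ℕ._+ k) p) (trans (sym (ℕₚ.+-suc (toℕ u) k)) eq)))
    ... | inj₂ (last , p) = step (inj₁ refl) (ascend k (next u) w (trans (cong (ℕ._+ k) p)
      (ℕₚ.+-cancelˡ-≡ n k (toℕ w) (trans (cong (ℕ._+ k) (sym last)) (trans (sym (ℕₚ.+-suc (toℕ u) k)) eq)))))

    arcWalks-≤ : ∀ (x y : Fin n) d r → toℕ x ℕ.+ d ≡ toℕ y → d ℕ.+ r ≡ n → Walk C x y d × Walk C y x r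
    arcWalks-≤ x y d r eq eq′ = ascend d x y eq , ascend-around r y x (begin
      toℕ y ℕ.+ r            ≡⟨ cong (ℕ._+ r) eq ⟨
      toℕ x ℕ.+ d ℕ.+ r      ≡⟨ ℕₚ.+-assoc (toℕ x) d r ⟩
      toℕ x ℕ.+ (d ℕ.+ r)    ≡⟨ cong (toℕ x ℕ.+_) eq′ ⟩
      toℕ x ℕ.+ n            ≡⟨ ℕₚ.+-comm (toℕ x) n ⟩
      n ℕ.+ toℕ x            ∎)
      where open ≡-Reasoning

    arcWalks : ∀ (x y : Fin n) r → ∣ toℕ x - toℕ y ∣ ℕ.+ r ≡ n →
               Walk C x y ∣ toℕ x - toℕ y ∣ × Walk C x y r
    arcWalks x y r eq with ℕₚ.≤-total (toℕ x) (toℕ y)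
    ... | inj₁ x≤y = let p , q = arcWalks-≤ x y _ r
                           (trans (cong (toℕ x ℕ.+_) (ℕₚ.m≤n⇒∣m-n∣≡n∸m x≤y)) (ℕₚ.m+[n∸m]≡n x≤y)) eq
                     in p , reverseWalk q
    ... | inj₂ y≤x = let p , q = arcWalks-≤ y x _ r
                           (trans (cong (toℕ y ℕ.+_) (trans (ℕₚ.∣-∣-comm (toℕ x) (toℕ y)) (ℕₚ.m≤n⇒∣m-n∣≡n∸m y≤x)))
                             (ℕₚ.m+[n∸m]≡n y≤x)) eq
                     in reverseWalk p , q

    cycle-connected : Connected C
    cycle-connected x y =
      _ , proj₁ (arcWalks x y (n ℕ.∸ ∣ toℕ x - toℕ y ∣) (ℕₚ.m+[n∸m]≡n (ℕₚ.<⇒≤ (dist<n x y))))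

    -- A step changes the linear distance to w by one, except that the step
    -- between the last vertex and 0 exchanges the two arcs.
    next-arc : ∀ (u w : Fin n) → let d = ∣ toℕ u - toℕ w ∣; d′ = ∣ toℕ (next u) - toℕ w ∣ in
               (d ℕ.≤ suc d′ × d′ ℕ.≤ suc d) ⊎ suc (d ℕ.+ d′) ≡ n
    next-arc u w with toℕ-next u
    ... | inj₁ p rewrite p = inj₁ (∣-∣-suc (toℕ u) (toℕ w))
      where
      ∣-∣-suc : ∀ a b → ∣ a - b ∣ ℕ.≤ suc ∣ suc a - b ∣ × ∣ suc a - b ∣ ℕ.≤ suc ∣ a - b ∣
      ∣-∣-suc a b =
        (ℕₚ.≤-trans (ℕₚ.∣-∣-triangle a (suc a) b)
          (ℕₚ.+-monoˡ-≤ _ (ℕₚ.≤-reflexive (trans (ℕₚ.∣-∣-comm a (suc a)) (dist-one a))))) ,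
        (ℕₚ.≤-trans (ℕₚ.∣-∣-triangle (suc a) a b) (ℕₚ.+-monoˡ-≤ _ (ℕₚ.≤-reflexive (dist-one a))))
        where
        dist-one : ∀ a → ∣ suc a - a ∣ ≡ 1
        dist-one zero    = refl
        dist-one (suc a) = dist-one a
    ... | inj₂ (last , p) rewrite p = inj₂ (trans (cong suc (begin
      ∣ toℕ u - toℕ w ∣ ℕ.+ toℕ w     ≡⟨ cong (ℕ._+ toℕ w) (trans (ℕₚ.∣-∣-comm (toℕ u) (toℕ w)) (ℕₚ.m≤n⇒∣m-n∣≡n∸m w≤u)) ⟩
      toℕ u ℕ.∸ toℕ w ℕ.+ toℕ w       ≡⟨ ℕₚ.m∸n+n≡m w≤u ⟩
      toℕ u                           ∎)) last)
      where
      open ≡-Reasoning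
      w≤u : toℕ w ℕ.≤ toℕ u
      w≤u = ℕₚ.≤-pred (subst (toℕ w ℕ.<_) (sym last) (Finₚ.toℕ<n w))

    -- A walk is at least as long as one of the two arcs. The disjunction is the invariant of the
    -- induction: a step across the gap between n - 1 and 0 exchanges its alternatives. The second
    -- arc n - d is moved to the other side to avoid truncated subtraction.
    walk-≥-arc : ∀ {u w ℓ} → Walk C u w ℓ → let d = ∣ toℕ u - toℕ w ∣ in d ℕ.≤ ℓ ⊎ n ℕ.≤ d ℕ.+ ℓ
    walk-≥-arc {u} here = inj₁ (ℕₚ.≤-reflexive (ℕₚ.∣n-n∣≡0 (toℕ u)))
    walk-≥-arc {u} {w} (step {v = v} {ℓ = ℓ} a p) = merge (adjacent a) (walk-≥-arc p)
      where
      d d′ : ℕ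
      d  = ∣ toℕ u - toℕ w ∣
      d′ = ∣ toℕ v - toℕ w ∣
      adjacent : next u ≡ v ⊎ next v ≡ u → (d ℕ.≤ suc d′ × d′ ℕ.≤ suc d) ⊎ suc (d ℕ.+ d′) ≡ n
      adjacent (inj₁ refl) = next-arc u w
      adjacent (inj₂ refl) with next-arc v w
      ... | inj₁ (p , q) = inj₁ (q , p)
      ... | inj₂ p       = inj₂ (trans (cong suc (ℕₚ.+-comm d d′)) p)
      open ℕₚ.≤-Reasoning
      merge : (d ℕ.≤ suc d′ × d′ ℕ.≤ suc d) ⊎ suc (d ℕ.+ d′) ≡ n → d′ ℕ.≤ ℓ ⊎ n ℕ.≤ d′ ℕ.+ ℓ →
                d ℕ.≤ suc ℓ ⊎ n ℕ.≤ d ℕ.+ suc ℓ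
      merge (inj₁ (p , _)) (inj₁ q) = inj₁ (ℕₚ.≤-trans p (s≤s q))
      merge (inj₁ (_ , p)) (inj₂ q) = inj₂ (begin
        n                ≤⟨ q ⟩
        d′ ℕ.+ ℓ         ≤⟨ ℕₚ.+-monoˡ-≤ ℓ p ⟩
        suc d ℕ.+ ℓ      ≡⟨ ℕₚ.+-suc d ℓ ⟨
        d ℕ.+ suc ℓ      ∎)
      merge (inj₂ p) (inj₁ q) = inj₂ (begin
        n                ≡⟨ p ⟨
        suc (d ℕ.+ d′)   ≡⟨ ℕₚ.+-suc d d′ ⟨
        d ℕ.+ suc d′     ≤⟨ ℕₚ.+-monoʳ-≤ d (s≤s q) ⟩
        d ℕ.+ suc ℓ      ∎)
      -- Cancelling d′ in d′ + (d + 1) = n ≤ d′ + ℓ gives even d + 1 ≤ ℓ.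
      merge (inj₂ p) (inj₂ q) = inj₁ (ℕₚ.≤-trans (ℕₚ.n≤1+n d) (ℕₚ.≤-trans (ℕₚ.+-cancelˡ-≤ d′ (suc d) ℓ (begin
        d′ ℕ.+ suc d     ≡⟨ ℕₚ.+-suc d′ d ⟩
        suc (d′ ℕ.+ d)   ≡⟨ cong suc (ℕₚ.+-comm d′ d) ⟩
        suc (d ℕ.+ d′)   ≡⟨ p ⟩
        n                ≤⟨ q ⟩
        d′ ℕ.+ ℓ         ∎)) (ℕₚ.n≤1+n ℓ)))

    -- Both arcs are walks, so p is at most either length, and by `walk-≥-arc` it is at least one of
    -- them. Hence p is the length of some arc, and the product of the two lengths is the same from
    -- either.
    distance-arcs : ∀ {x y p} → IsDistance C x y p → arcs x y ≡ fromℕ p * (fromℕ n - fromℕ p)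
    distance-arcs {x} {y} {p} (walk , shortest) = conclude (walk-≥-arc walk)
      where
      d r : ℕ
      d = ∣ toℕ x - toℕ y ∣
      r = n ℕ.∸ d
      d+r≡n : d ℕ.+ r ≡ n
      d+r≡n = ℕₚ.m+[n∸m]≡n (ℕₚ.<⇒≤ (dist<n x y))
      walks : Walk C x y d × Walk C x y r
      walks = arcWalks x y r d+r≡n
      complement : ∀ d r → d * (d + r - d) ≡ r * (d + r - r)
      complement = solve-∀ ℚ-ring
      conclude : d ℕ.≤ p ⊎ n ℕ.≤ d ℕ.+ p → arcs x y ≡ fromℕ p * (fromℕ n - fromℕ p)
      conclude (inj₁ d≤p) = cong (λ k → fromℕ k * (fromℕ n - fromℕ k)) (ℕₚ.≤-antisym d≤p (shortest (proj₁ walks)))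
      conclude (inj₂ n≤d+p) = begin
        fromℕ d * (fromℕ n - fromℕ d)              ≡⟨ cong (λ N → fromℕ d * (N - fromℕ d)) n≡d+r ⟩
        fromℕ d * (fromℕ d + fromℕ r - fromℕ d)    ≡⟨ complement (fromℕ d) (fromℕ r) ⟩
        fromℕ r * (fromℕ d + fromℕ r - fromℕ r)    ≡⟨ cong (λ N → fromℕ r * (N - fromℕ r)) n≡d+r ⟨
        fromℕ r * (fromℕ n - fromℕ r)              ≡⟨ cong (λ k → fromℕ k * (fromℕ n - fromℕ k)) r≡p ⟩
        fromℕ p * (fromℕ n - fromℕ p)              ∎
        where
        open ≡-Reasoning
        n≡d+r : fromℕ n ≡ fromℕ d + fromℕ r
        n≡d+r = trans (cong fromℕ (sym d+r≡n)) (fromℕ-+ d r)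
        r≡p : r ≡ p
        r≡p = ℕₚ.≤-antisym (ℕₚ.m≤n+o⇒m∸n≤o n d n≤d+p) (shortest (proj₂ walks))

open CycleWalks

-- Edges, degrees, Laplacian and connectedness of the sunflower.

module SunflowerGraphs where

  open import Data.Rational using (_+_; _*_; _-_; -_)

  ∑-pull : ∀ {M N} (Y : Fin M → Fin N → ℚ) (F : Fin N → ℚ) →
           ∑[ t < N ] (∑[ i < M ] Y i t * F t) ≡ ∑[ i < M ] ∑[ t < N ] (Y i t * F t)
  ∑-pull {M} Y F = trans (∑-cong λ t → *-distribʳ-sum (F t) (λ i → Y i t))
                         (∑-comm λ t i → Y i t * F t)

  module _ {N : ℕ} (G : Graph N) where

    fromℕ-degree : ∀ u → fromℕ (degree G u) ≡ ∑[ v < N ] ⟦ adj? G u v ⟧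
    fromℕ-degree u = length-filter-tabulate (adj? G u) id

    ⟦adj⟧-sym : ∀ u v → ⟦ adj? G u v ⟧ ≡ ⟦ adj? G v u ⟧
    ⟦adj⟧-sym u v = ⟦⟧-cong (adj? G u v) (adj? G v u) (symm G) (symm G)

    laplacian-action : ∀ (F : Fin N → ℚ) s →
      ∑[ k < N ] (laplacian G s k * F k) ≡ fromℕ (degree G s) * F s - ∑[ k < N ] (⟦ adj? G s k ⟧ * F k)
    laplacian-action F s = begin
      ∑[ k < N ] ((d * ⟦ s ≟ k ⟧ - ⟦ adj? G s k ⟧) * F k)
        ≡⟨ ∑-cong (λ k → expand d ⟦ s ≟ k ⟧ ⟦ adj? G s k ⟧ (F k)) ⟩
      ∑[ k < N ] (⟦ s ≟ k ⟧ * (d * F k) - ⟦ adj? G s k ⟧ * F k)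
        ≡⟨ ∑-distrib-- (λ k → ⟦ s ≟ k ⟧ * (d * F k)) (λ k → ⟦ adj? G s k ⟧ * F k) ⟩
      ∑[ k < N ] (⟦ s ≟ k ⟧ * (d * F k)) - A
        ≡⟨ cong (_- A) (∑-δ s (λ k → d * F k)) ⟩
      d * F s - A ∎
      where
      open ≡-Reasoning
      d A : ℚ
      d = fromℕ (degree G s)
      A = ∑[ k < N ] (⟦ adj? G s k ⟧ * F k)
      expand : ∀ d t a f → (d * t - a) * f ≡ t * (d * f) - a * f
      expand = solve-∀ ℚ-ring

    laplacian-sym : laplacian G ᵀ ≐ laplacian G
    laplacian-sym i j = cong₂ _-_ diagonal (⟦adj⟧-sym j i)
      where
      d : Fin N → ℚ
      d k = fromℕ (degree G k)
      diagonal : d j * ⟦ j ≟ i ⟧ ≡ d i * ⟦ i ≟ j ⟧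
      diagonal = begin
        d j * ⟦ j ≟ i ⟧    ≡⟨ ℚₚ.*-comm (d j) ⟦ j ≟ i ⟧ ⟩
        ⟦ j ≟ i ⟧ * d j    ≡⟨ ⟦≟⟧-subst j i d ⟨
        ⟦ j ≟ i ⟧ * d i    ≡⟨ ℚₚ.*-comm ⟦ j ≟ i ⟧ (d i) ⟩
        d i * ⟦ j ≟ i ⟧    ≡⟨ cong (d i *_) (⟦≟⟧-sym j i) ⟩
        d i * ⟦ i ≟ j ⟧    ∎
        where open ≡-Reasoning

    laplacian-columns : ∀ j → ∑[ k < N ] laplacian G k j ≡ 0ℚ
    laplacian-columns j = begin
      ∑[ k < N ] laplacian G k j
        ≡⟨ ∑-cong (λ k → trans (laplacian-sym j k) (sym (ℚₚ.*-identityʳ (laplacian G j k)))) ⟩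
      ∑[ k < N ] (laplacian G j k * 1ℚ)
        ≡⟨ laplacian-action (λ _ → 1ℚ) j ⟩
      fromℕ (degree G j) * 1ℚ - ∑[ k < N ] (⟦ adj? G j k ⟧ * 1ℚ)
        ≡⟨ cong₂ _-_ (trans (ℚₚ.*-identityʳ _) (fromℕ-degree j)) (∑-cong (λ k → ℚₚ.*-identityʳ ⟦ adj? G j k ⟧)) ⟩
      D - D
        ≡⟨ ℚₚ.+-inverseʳ D ⟩
      0ℚ ∎
      where
      open ≡-Reasoning
      D : ℚ
      D = ∑[ k < N ] ⟦ adj? G j k ⟧

    handshake : fromℕ (size G) + fromℕ (size G) ≡ ∑[ u < N ] fromℕ (degree G u)
    handshake = begin
      fromℕ (size G) + fromℕ (size G)
        ≡⟨ cong₂ _+_ size≡ (trans size≡ (∑-comm upper)) ⟩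
      ∑[ u < N ] ∑[ v < N ] upper u v + ∑[ u < N ] ∑[ v < N ] upper v u
        ≡⟨ trans (∑-cong (λ u → ∑-distrib-+ (upper u) (λ v → upper v u))) (∑-distrib-+ (λ u → sum (upper u)) (λ u → sum (λ v → upper v u))) ⟨
      ∑[ u < N ] ∑[ v < N ] (upper u v + upper v u)
        ≡⟨ ∑-cong₂ both ⟩
      ∑[ u < N ] ∑[ v < N ] ⟦ adj? G u v ⟧
        ≡⟨ ∑-cong fromℕ-degree ⟨
      ∑[ u < N ] fromℕ (degree G u) ∎
      where
      open ≡-Reasoning
      upper : Fin N → Fin N → ℚ
      upper u v = ⟦ (u <? v) ×-dec adj? G u v ⟧
      size≡ : fromℕ (size G) ≡ ∑[ u < N ] ∑[ v < N ] upper u v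
      size≡ = length-filter-cartesianProduct (λ (u , v) → (u <? v) ×-dec adj? G u v) id id
      true-false : ∀ u v → u Fin.< v → Adj G u v → upper u v + upper v u ≡ 1ℚ
      true-false u v u<v a = cong₂ _+_ (⟦⟧-true ((u <? v) ×-dec adj? G u v) (u<v , a))
        (⟦⟧-false ((v <? u) ×-dec adj? G v u) λ (v<u , _) → Finₚ.<-asym u<v v<u)
      both : ∀ u v → upper u v + upper v u ≡ ⟦ adj? G u v ⟧
      both u v = go (adj? G u v)
        where
        go : (d : Dec (Adj G u v)) → upper u v + upper v u ≡ ⟦ d ⟧
        go (no ¬a) = cong₂ _+_ (⟦⟧-false ((u <? v) ×-dec adj? G u v) (¬a ∘ proj₂))
                               (⟦⟧-false ((v <? u) ×-dec adj? G v u) (¬a ∘ symm G ∘ proj₂))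
        go (yes a) with Finₚ.<-cmp u v
        ... | tri< u<v _ _  = true-false u v u<v a
        ... | tri≈ _ refl _ = contradiction a (irrefl G)
        ... | tri> _ _ v<u  = trans (ℚₚ.+-comm (upper u v) (upper v u)) (true-false v u v<u (symm G a))

  ∑-cycle-adj : ∀ {m} (3≤m : 3 ℕ.≤ m) (f : Fin m → ℚ) v →
    ∑[ w < m ] (⟦ adj? (cycle m 3≤m) v w ⟧ * f w) ≡ f (next v) + f (prev v)
  ∑-cycle-adj {m} 3≤m f v = begin
    ∑[ w < m ] (⟦ adj? (cycle m 3≤m) v w ⟧ * f w)
      ≡⟨ ∑-cong (λ w → cong (_* f w) (trans (⟦⟧-⊎ (next v ≟ w) (next w ≟ v) (disjoint w)) (cong (⟦ next v ≟ w ⟧ +_)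
           (⟦⟧-cong (next w ≟ v) (prev v ≟ w) (λ { refl → prev-next w }) (λ { refl → next-prev v }))))) ⟩
    ∑[ w < m ] ((⟦ next v ≟ w ⟧ + ⟦ prev v ≟ w ⟧) * f w)
      ≡⟨ ∑-cong (λ w → ℚₚ.*-distribʳ-+ (f w) ⟦ next v ≟ w ⟧ ⟦ prev v ≟ w ⟧) ⟩
    ∑[ w < m ] (⟦ next v ≟ w ⟧ * f w + ⟦ prev v ≟ w ⟧ * f w)
      ≡⟨ ∑-distrib-+ (λ w → ⟦ next v ≟ w ⟧ * f w) (λ w → ⟦ prev v ≟ w ⟧ * f w) ⟩
    ∑[ w < m ] (⟦ next v ≟ w ⟧ * f w) + ∑[ w < m ] (⟦ prev v ≟ w ⟧ * f w)
      ≡⟨ cong₂ _+_ (∑-δ (next v) f) (∑-δ (prev v) f) ⟩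
    f (next v) + f (prev v) ∎
    where
    open ≡-Reasoning
    disjoint : ∀ w → ¬ (next v ≡ w × next w ≡ v)
    disjoint w (refl , q) = next²≢ 3≤m v q

  -- A class has at most two members, so two equal images are either the same pair or differ by a
  -- single identification, read in one of its two directions.
  glue-cases : ∀ {m n} (x y : Fin m) (x≢y : x ≢ y) {i j : Fin n} {v w : Fin m} →
    glue x y x≢y (i , v) ≡ glue x y x≢y (j , w) →
    (i ≡ j × v ≡ w) ⊎ (v ≡ y × w ≡ x × next i ≡ j) ⊎ (v ≡ x × w ≡ y × next j ≡ i)
  glue-cases {suc m} x y x≢y {i} {j} {v} {w} eq with y ≟ v | y ≟ w
  ... | yes p   | yes q   = inj₁ (next-injective (combine-injectiveˡ (next i) _ (next j) _ eq) , trans (sym p) q)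
  ... | yes p   | no  y≢w = inj₂ (inj₁ (sym p ,
    sym (punchOut-injective (x≢y ∘ sym) y≢w (combine-injectiveʳ (next i) _ j _ eq)) ,
    combine-injectiveˡ (next i) _ j _ eq))
  ... | no  y≢v | yes q   = inj₂ (inj₂ (
    punchOut-injective y≢v (x≢y ∘ sym) (combine-injectiveʳ i _ (next j) _ eq) ,
    sym q , sym (combine-injectiveˡ i _ (next j) _ eq)))
  ... | no  y≢v | no  y≢w = inj₁ (combine-injectiveˡ i _ j _ eq ,
    punchOut-injective y≢v y≢w (combine-injectiveʳ i _ j _ eq))

  module Sunflower {m n : ℕ} (3≤m : 3 ℕ.≤ m) (3≤n : 3 ℕ.≤ n) (x y : Fin m) (x≢y : x ≢ y) where

    N : ℕ
    N = n ℕ.* pred m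

    C : Graph m
    C = cycle m 3≤m

    F : Graph N
    F = sunflower n 3≤m 3≤n x y x≢y

    g : Fin n → Fin m → Fin N
    g i v = glue x y x≢y (i , v)

    g-y : ∀ i → g i y ≡ g (next i) x
    g-y i = glue-sound x y x≢y (fwd (y~x i) ◅ ε)

    -- An edge belongs to one copy only. Two different copies sharing both of its ends would have to
    -- follow each other cyclically in both directions, which 3 ≤ n excludes.
    same-copy : ∀ {i j v v′ w w′} → g i v ≡ g j v′ → g i w ≡ g j w′ → v ≢ w → i ≡ j
    same-copy {i} {j} p q v≢w with glue-cases x y x≢y p | glue-cases x y x≢y q
    ... | inj₁ (i≡j , _) | _              = i≡j
    ... | inj₂ _         | inj₁ (i≡j , _) = i≡j
    ... | inj₂ (inj₁ (v≡y , _)) | inj₂ (inj₁ (w≡y , _)) = contradiction (trans v≡y (sym w≡y)) v≢w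
    ... | inj₂ (inj₂ (v≡x , _)) | inj₂ (inj₂ (w≡x , _)) = contradiction (trans v≡x (sym w≡x)) v≢w
    ... | inj₂ (inj₁ (_ , _ , refl)) | inj₂ (inj₂ (_ , _ , r)) = contradiction r (next²≢ 3≤n i)
    ... | inj₂ (inj₂ (_ , _ , refl)) | inj₂ (inj₁ (_ , _ , r)) = contradiction r (next²≢ 3≤n j)

    -- An adjacency has exactly one witness (i, v, w): the copy by `same-copy`, the two vertices
    -- because `glue` is injective on a copy. So each of the three existentials becomes a sum, and
    -- no edge is counted twice.
    ⟦adj⟧-expand : ∀ s t → ⟦ adj? F s t ⟧ ≡
      ∑[ i < n ] ∑[ v < m ] ∑[ w < m ] (⟦ g i v ≟ s ⟧ * (⟦ g i w ≟ t ⟧ * ⟦ adj? C v w ⟧))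
    ⟦adj⟧-expand s t = begin
      ⟦ adj? F s t ⟧
        ≡⟨ ∑-⟦⟧-unique (λ i → any? λ v → any? (Q? i v)) unique-i ⟨
      ∑[ i < n ] ⟦ any? (λ v → any? (Q? i v)) ⟧
        ≡⟨ ∑-cong (λ i → ∑-⟦⟧-unique (λ v → any? (Q? i v)) (λ (_ , p , _) (_ , q , _) → injective i p q)) ⟨
      ∑[ i < n ] ∑[ v < m ] ⟦ any? (Q? i v) ⟧
        ≡⟨ ∑-cong₂ (λ i v → ∑-⟦⟧-unique (Q? i v) (λ (_ , p , _) (_ , q , _) → injective i p q)) ⟨
      ∑[ i < n ] ∑[ v < m ] ∑[ w < m ] ⟦ Q? i v w ⟧
        ≡⟨ ∑-cong₂ (λ i v → ∑-cong λ w → trans (⟦⟧-× (g i v ≟ s) ((g i w ≟ t) ×-dec adj? C v w))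
             (cong (⟦ g i v ≟ s ⟧ *_) (⟦⟧-× (g i w ≟ t) (adj? C v w)))) ⟩
      ∑[ i < n ] ∑[ v < m ] ∑[ w < m ] (⟦ g i v ≟ s ⟧ * (⟦ g i w ≟ t ⟧ * ⟦ adj? C v w ⟧)) ∎
      where
      open ≡-Reasoning
      Q : Fin n → Fin m → Fin m → Set
      Q i v w = g i v ≡ s × g i w ≡ t × Adj C v w
      Q? : ∀ i v w → Dec (Q i v w)
      Q? i v w = (g i v ≟ s) ×-dec (g i w ≟ t) ×-dec adj? C v w
      injective : ∀ i {v w r} → g i v ≡ r → g i w ≡ r → v ≡ w
      injective i p q = glue-injectiveʳ (ℕₚ.≤-trans (s≤s (s≤s z≤n)) 3≤n) x y x≢y i (trans p (sym q))
      unique-i : ∀ {i j} → (∃ λ v → ∃ λ w → Q i v w) → (∃ λ v → ∃ λ w → Q j v w) → i ≡ j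
      unique-i (v , w , p , q , a) (v′ , w′ , p′ , q′ , _) =
        same-copy (trans p (sym p′)) (trans q (sym q′)) λ { refl → irrefl C a }

    ∑-adj : ∀ (f : Fin N → ℚ) s → ∑[ t < N ] (⟦ adj? F s t ⟧ * f t) ≡
      ∑[ i < n ] ∑[ v < m ] (⟦ g i v ≟ s ⟧ * (f (g i (next v)) + f (g i (prev v))))
    ∑-adj f s = begin
      ∑[ t < N ] (⟦ adj? F s t ⟧ * f t)
        ≡⟨ ∑-cong (λ t → cong (_* f t) (⟦adj⟧-expand s t)) ⟩
      _ ≡⟨ ∑-pull (λ i t → ∑[ v < m ] ∑[ w < m ] a i v w t) f ⟩
      _ ≡⟨ ∑-cong (λ i → ∑-pull (λ v t → ∑[ w < m ] a i v w t) f) ⟩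
      _ ≡⟨ ∑-cong₂ (λ i v → ∑-pull (λ w t → a i v w t) f) ⟩
      ∑[ i < n ] ∑[ v < m ] ∑[ w < m ] ∑[ t < N ] (a i v w t * f t)
        ≡⟨ ∑-cong₂ (λ i v → ∑-cong (λ w → contract i v w)) ⟩
      ∑[ i < n ] ∑[ v < m ] ∑[ w < m ] (⟦ g i v ≟ s ⟧ * (⟦ adj? C v w ⟧ * f (g i w)))
        ≡⟨ ∑-cong₂ (λ i v → *-distribˡ-sum ⟦ g i v ≟ s ⟧ (λ w → ⟦ adj? C v w ⟧ * f (g i w))) ⟨
      ∑[ i < n ] ∑[ v < m ] (⟦ g i v ≟ s ⟧ * ∑[ w < m ] (⟦ adj? C v w ⟧ * f (g i w)))
        ≡⟨ ∑-cong₂ (λ i v → cong (⟦ g i v ≟ s ⟧ *_) (∑-cycle-adj 3≤m (f ∘ g i) v)) ⟩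
      _ ∎
      where
      open ≡-Reasoning
      a : Fin n → Fin m → Fin m → Fin N → ℚ
      a i v w t = ⟦ g i v ≟ s ⟧ * (⟦ g i w ≟ t ⟧ * ⟦ adj? C v w ⟧)
      rearrange : ∀ a b c f → a * (b * c) * f ≡ b * (a * (c * f))
      rearrange = solve-∀ ℚ-ring
      contract : ∀ i v w → ∑[ t < N ] (a i v w t * f t) ≡ ⟦ g i v ≟ s ⟧ * (⟦ adj? C v w ⟧ * f (g i w))
      contract i v w = trans
        (∑-cong λ t → rearrange ⟦ g i v ≟ s ⟧ ⟦ g i w ≟ t ⟧ ⟦ adj? C v w ⟧ (f t))
        (∑-δ (g i w) λ t → ⟦ g i v ≟ s ⟧ * (⟦ adj? C v w ⟧ * f t))

    degree-expand : ∀ s → fromℕ (degree F s) ≡ ∑[ i < n ] ∑[ v < m ] (⟦ g i v ≟ s ⟧ * fromℕ 2)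
    degree-expand s = trans (fromℕ-degree F s)
      (trans (∑-cong λ t → sym (ℚₚ.*-identityʳ ⟦ adj? F s t ⟧)) (∑-adj (λ _ → 1ℚ) s))

    ∑-degree : ∀ (f : Fin N → ℚ) →
      ∑[ s < N ] (fromℕ (degree F s) * f s) ≡ ∑[ i < n ] ∑[ v < m ] (fromℕ 2 * f (g i v))
    ∑-degree f = begin
      ∑[ s < N ] (fromℕ (degree F s) * f s)
        ≡⟨ ∑-cong (λ s → cong (_* f s) (degree-expand s)) ⟩
      _ ≡⟨ ∑-pull (λ i s → ∑[ v < m ] (⟦ g i v ≟ s ⟧ * fromℕ 2)) f ⟩
      _ ≡⟨ ∑-cong (λ i → ∑-pull (λ v s → ⟦ g i v ≟ s ⟧ * fromℕ 2) f) ⟩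
      ∑[ i < n ] ∑[ v < m ] ∑[ s < N ] (⟦ g i v ≟ s ⟧ * fromℕ 2 * f s)
        ≡⟨ ∑-cong₂ (λ i v → trans (∑-cong λ s → ℚₚ.*-assoc ⟦ g i v ≟ s ⟧ (fromℕ 2) (f s))
                                  (∑-δ (g i v) λ s → fromℕ 2 * f s)) ⟩
      ∑[ i < n ] ∑[ v < m ] (fromℕ 2 * f (g i v)) ∎
      where open ≡-Reasoning

    -- The copies partition the edges, so the Laplacian is the sum of the cycle Laplacians of the
    -- copies; a junction collects the contributions of two of them.
    sunflower-laplacian : ∀ (f : Fin N → ℚ) s →
      ∑[ t < N ] (laplacian F s t * f t) ≡ ∑[ i < n ] ∑[ v < m ] (⟦ g i v ≟ s ⟧ * Δ (f ∘ g i) v)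
    sunflower-laplacian f s = begin
      ∑[ t < N ] (laplacian F s t * f t)
        ≡⟨ laplacian-action F f s ⟩
      fromℕ (degree F s) * f s - ∑[ t < N ] (⟦ adj? F s t ⟧ * f t)
        ≡⟨ cong₂ _-_ diagonal (∑-adj f s) ⟩
      ∑[ i < n ] ∑[ v < m ] D i v - ∑[ i < n ] ∑[ v < m ] A i v
        ≡⟨ trans (∑-cong (λ i → ∑-distrib-- (D i) (A i))) (∑-distrib-- (λ i → sum (D i)) (λ i → sum (A i))) ⟨
      ∑[ i < n ] ∑[ v < m ] (D i v - A i v)
        ≡⟨ ∑-cong₂ (λ i v → factor ⟦ g i v ≟ s ⟧ (f (g i v)) (f (g i (next v)) + f (g i (prev v)))) ⟩
      ∑[ i < n ] ∑[ v < m ] (⟦ g i v ≟ s ⟧ * Δ (f ∘ g i) v) ∎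
      where
      open ≡-Reasoning
      D A : Fin n → Fin m → ℚ
      D i v = ⟦ g i v ≟ s ⟧ * f (g i v) * fromℕ 2
      A i v = ⟦ g i v ≟ s ⟧ * (f (g i (next v)) + f (g i (prev v)))
      factor : ∀ t a b → t * a * fromℕ 2 - t * b ≡ t * (a + a - b)
      factor = solve-∀ ℚ-ring
      swap : ∀ t c a → t * c * a ≡ t * a * c
      swap = solve-∀ ℚ-ring
      diagonal : fromℕ (degree F s) * f s ≡ ∑[ i < n ] ∑[ v < m ] D i v
      diagonal = trans (cong (_* f s) (degree-expand s))
        (trans (*-distribʳ-sum (f s) (λ i → ∑[ v < m ] (⟦ g i v ≟ s ⟧ * fromℕ 2)))
        (∑-cong λ i → trans (*-distribʳ-sum (f s) (λ v → ⟦ g i v ≟ s ⟧ * fromℕ 2))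
        (∑-cong λ v → trans (swap ⟦ g i v ≟ s ⟧ (fromℕ 2) (f s))
                            (cong (_* fromℕ 2) (⟦≟⟧-subst (g i v) s f)))))

    fromℕ-size : fromℕ (size F) ≡ fromℕ n * fromℕ m
    fromℕ-size = begin
      S                                                 ≡⟨ halve S ⟩
      ½ * (S + S)                                       ≡⟨ cong (½ *_) (handshake F) ⟩
      ½ * ∑[ s < N ] fromℕ (degree F s)
        ≡⟨ cong (½ *_) (trans (∑-cong {N} λ s → sym (ℚₚ.*-identityʳ _)) (∑-degree λ _ → 1ℚ)) ⟩
      ½ * ∑[ i < n ] ∑[ v < m ] fromℕ 2
        ≡⟨ cong (½ *_) (trans (∑-cong {n} λ _ → ∑-const m (fromℕ 2)) (∑-const n (fromℕ m * fromℕ 2))) ⟩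
      ½ * (fromℕ n * (fromℕ m * fromℕ 2))               ≡⟨ double (fromℕ n) (fromℕ m) ⟩
      fromℕ n * fromℕ m                                 ∎
      where
      open ≡-Reasoning
      S : ℚ
      S = fromℕ (size F)
      halve : ∀ s → s ≡ ½ * (s + s)
      halve = solve-∀ ℚ-ring
      double : ∀ a b → ½ * (a * (b * fromℕ 2)) ≡ a * b
      double = solve-∀ ℚ-ring

    Reachable : Fin N → Fin N → Set
    Reachable s t = ∃ λ ℓ → Walk F s t ℓ

    reachable-copy : ∀ i v w → Reachable (g i v) (g i w)
    reachable-copy i v w = let ℓ , p = cycle-connected 3≤m v w in ℓ , lift p
      where
      lift : ∀ {v w ℓ} → Walk C v w ℓ → Walk F (g i v) (g i w) ℓ
      lift here       = here
      lift (step a p) = step (i , _ , _ , refl , refl , a) (lift p)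

    reachable-x : ∀ {i j ℓ} → Walk (cycle n 3≤n) i j ℓ → Reachable (g i x) (g j x)
    reachable-x here = 0 , here
    reachable-x (step {i} a p) = let _ , q = link a; _ , r = reachable-x p in _ , q ++ʷ r
      where
      forward : ∀ i → Reachable (g i x) (g (next i) x)
      forward i = subst (Reachable (g i x)) (g-y i) (reachable-copy i x y)
      link : ∀ {j} → next i ≡ j ⊎ next j ≡ i → Reachable (g i x) (g j x)
      link     (inj₁ refl) = forward i
      link {j} (inj₂ refl) = let _ , q = forward j in _ , reverseWalk q

    sunflower-connected : Connected F
    sunflower-connected s t with glue-surjective {n = n} x y x≢y s | glue-surjective {n = n} x y x≢y t
    ... | (i , v) , refl | (j , w) , refl =
      let _ , p = reachable-copy i v x
          _ , q = reachable-x (proj₂ (cycle-connected 3≤n i j))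
          _ , r = reachable-copy j x w
      in _ , p ++ʷ q ++ʷ r

open SunflowerGraphs

-- Green's function of the sunflower.

module SunflowerGreen where

  open import Data.Rational using (_+_; _*_; _-_; -_)

  -- The shape of `green` in its first vertex: an affine combination of the arc products to w, x and
  -- y and of the potential `t`.
  Δ-affine : ∀ {n} c₀ c₁ c₂ c₃ c₄ (f₁ f₂ f₃ f₄ : Fin n → ℚ) v →
    Δ (λ u → c₀ + c₁ * f₁ u + c₂ * f₂ u + c₃ * f₃ u + c₄ * f₄ u) v ≡
    c₁ * Δ f₁ v + c₂ * Δ f₂ v + c₃ * Δ f₃ v + c₄ * Δ f₄ v
  Δ-affine c₀ c₁ c₂ c₃ c₄ f₁ f₂ f₃ f₄ v = trans
    (split (c₀ + c₁ * f₁ v + c₂ * f₂ v + c₃ * f₃ v) (c₄ * f₄ v)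
           (c₀ + c₁ * f₁ v⁺ + c₂ * f₂ v⁺ + c₃ * f₃ v⁺) (c₄ * f₄ v⁺)
           (c₀ + c₁ * f₁ v⁻ + c₂ * f₂ v⁻ + c₃ * f₃ v⁻) (c₄ * f₄ v⁻))
    (cong₂ _+_ (trans
      (split (c₀ + c₁ * f₁ v + c₂ * f₂ v) (c₃ * f₃ v)
             (c₀ + c₁ * f₁ v⁺ + c₂ * f₂ v⁺) (c₃ * f₃ v⁺)
             (c₀ + c₁ * f₁ v⁻ + c₂ * f₂ v⁻) (c₃ * f₃ v⁻))
      (cong₂ _+_
        (two c₀ c₁ c₂ (f₁ v) (f₁ v⁺) (f₁ v⁻) (f₂ v) (f₂ v⁺) (f₂ v⁻))
        (scale c₃ (f₃ v) (f₃ v⁺) (f₃ v⁻))))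
      (scale c₄ (f₄ v) (f₄ v⁺) (f₄ v⁻)))
    where
    v⁺ v⁻ : Fin _
    v⁺ = next v
    v⁻ = prev v
    split : ∀ a b a⁺ b⁺ a⁻ b⁻ → a + b + (a + b) - (a⁺ + b⁺ + (a⁻ + b⁻)) ≡
            a + a - (a⁺ + a⁻) + (b + b - (b⁺ + b⁻))
    split = solve-∀ ℚ-ring
    scale : ∀ c a a⁺ a⁻ → c * a + c * a - (c * a⁺ + c * a⁻) ≡ c * (a + a - (a⁺ + a⁻))
    scale = solve-∀ ℚ-ring
    two : ∀ c₀ c₁ c₂ a a⁺ a⁻ b b⁺ b⁻ →
      c₀ + c₁ * a + c₂ * b + (c₀ + c₁ * a + c₂ * b) - (c₀ + c₁ * a⁺ + c₂ * b⁺ + (c₀ + c₁ * a⁻ + c₂ * b⁻)) ≡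
      c₁ * (a + a - (a⁺ + a⁻)) + c₂ * (b + b - (b⁺ + b⁻))
    two = solve-∀ ℚ-ring

  Δ-cong : ∀ {n} {f g : Fin n → ℚ} → (∀ v → f v ≡ g v) → ∀ v → Δ f v ≡ Δ g v
  Δ-cong f≡g v = cong₂ _-_ (cong₂ _+_ (f≡g v) (f≡g v)) (cong₂ _+_ (f≡g (next v)) (f≡g (prev v)))

  mix : ℚ → ℚ → ℚ → ℚ
  mix t a b = (1ℚ - t) * a + t * b

  module Green {m n : ℕ} (3≤m : 3 ℕ.≤ m) (3≤n : 3 ℕ.≤ n) (x y : Fin m) (x≢y : x ≢ y)
    (μ ν α : ℚ) (μM : μ * fromℕ m ≡ 1ℚ) (νK : ν * fromℕ n ≡ 1ℚ) (αA : α * arcs x y ≡ 1ℚ) where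

    open Sunflower 3≤m 3≤n x y x≢y

    -- Between x and y a copy has resistance A/m, and -d (n - d) / (2n) inverts the Laplacian of Cₙ
    -- up to constants. The factor κ = (A/m) / (2n) thus belongs to a cycle Cₙ whose edges have
    -- resistance A/m.
    M K A κ : ℚ
    M = fromℕ m
    K = fromℕ n
    A = arcs x y
    κ = ½ * A * μ * ν

    -- The potential on a copy of the cycle when x is grounded and y is held
    -- at potential 1.
    t : Fin m → ℚ
    t v = ½ + ½ * α * (arcs v x - arcs v y)

    t-x : t x ≡ 0ℚ
    t-x = trans (cong₂ (λ a b → ½ + ½ * α * (a - b)) (arcs-diag x) refl)
      (trans (expand α A) (trans (cong (λ z → ½ - ½ * z) αA) refl))
      where
      expand : ∀ α A → ½ + ½ * α * (0ℚ - A) ≡ ½ - ½ * (α * A)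
      expand = solve-∀ ℚ-ring

    t-y : t y ≡ 1ℚ
    t-y = trans (cong₂ (λ a b → ½ + ½ * α * (a - b)) (arcs-sym y x) (arcs-diag y))
      (trans (expand α A) (trans (cong (λ z → ½ + ½ * z) αA) refl))
      where
      expand : ∀ α A → ½ + ½ * α * (A - 0ℚ) ≡ ½ + ½ * (α * A)
      expand = solve-∀ ℚ-ring

    -- α M = m/A is the conductance of a copy, so under unit voltage this current enters at y and
    -- leaves at x.
    Δt : ∀ v → Δ t v ≡ α * M * (⟦ v ≟ y ⟧ - ⟦ v ≟ x ⟧)
    Δt v = trans
      (linear α (arcs v x) (arcs (next v) x) (arcs (prev v) x) (arcs v y) (arcs (next v) y) (arcs (prev v) y))
      (trans (cong₂ (λ a b → ½ * α * (a - b)) (arcs-Δ v x) (arcs-Δ v y))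
             (simplify α M ⟦ v ≟ x ⟧ ⟦ v ≟ y ⟧))
      where
      linear : ∀ α a a⁺ a⁻ b b⁺ b⁻ →
        ½ + ½ * α * (a - b) + (½ + ½ * α * (a - b)) - (½ + ½ * α * (a⁺ - b⁺) + (½ + ½ * α * (a⁻ - b⁻))) ≡
        ½ * α * ((a + a - (a⁺ + a⁻)) - (b + b - (b⁺ + b⁻)))
      linear = solve-∀ ℚ-ring
      simplify : ∀ α M a b → ½ * α * ((fromℕ 2 - fromℕ 2 * M * a) - (fromℕ 2 - fromℕ 2 * M * b)) ≡ α * M * (b - a)
      simplify = solve-∀ ℚ-ring

    -- The definition of `t` solved for the difference of the arc products. In `green-Δ` it cancels
    -- the coefficient with which `t` enters through Γ.
    arcs-t : ∀ w → arcs y w - arcs x w ≡ A * (1ℚ - fromℕ 2 * t w)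
    arcs-t w = begin
      arcs y w - arcs x w                          ≡⟨ cong₂ _-_ (arcs-sym y w) (arcs-sym x w) ⟩
      arcs w y - arcs w x                          ≡⟨ ℚₚ.*-identityˡ _ ⟨
      1ℚ * (arcs w y - arcs w x)                   ≡⟨ cong (_* (arcs w y - arcs w x)) αA ⟨
      α * A * (arcs w y - arcs w x)                ≡⟨ rearrange α A (arcs w x) (arcs w y) ⟩
      A * (1ℚ - fromℕ 2 * t w)                     ∎
      where
      open ≡-Reasoning
      rearrange : ∀ α A a b → α * A * (b - a) ≡ A * (1ℚ - fromℕ 2 * (½ + ½ * α * (a - b)))
      rearrange = solve-∀ ℚ-ring

    -- Green's function of one copy, with x and y grounded.
    Γ : Fin m → Fin m → ℚ
    Γ v w = ½ * μ * (mix (t v) (arcs x w) (arcs y w) + mix (t w) (arcs v x) (arcs v y) - arcs v w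
                     - A * mix (t v) (t w) (1ℚ - t w))

    Γ-x : ∀ w → Γ x w ≡ 0ℚ
    Γ-x w = trans (cong₂ (λ τ d → ½ * μ * (mix τ (arcs x w) (arcs y w) + mix (t w) d A - arcs x w
                                           - A * mix τ (t w) (1ℚ - t w)))
                         t-x (arcs-diag x))
                  (vanish μ A (t w) (arcs x w) (arcs y w))
      where
      vanish : ∀ μ A τ a b →
        ½ * μ * ((1ℚ - 0ℚ) * a + 0ℚ * b + ((1ℚ - τ) * 0ℚ + τ * A) - a - A * ((1ℚ - 0ℚ) * τ + 0ℚ * (1ℚ - τ))) ≡ 0ℚ
      vanish = solve-∀ ℚ-ring

    Γ-y : ∀ w → Γ y w ≡ 0ℚ
    Γ-y w = trans (cong₂ (λ τ d → ½ * μ * (mix τ (arcs x w) (arcs y w) + mix (t w) (arcs y x) d - arcs y w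
                                           - A * mix τ (t w) (1ℚ - t w)))
                         t-y (arcs-diag y))
            (trans (cong (λ d → ½ * μ * (mix 1ℚ (arcs x w) (arcs y w) + mix (t w) d 0ℚ - arcs y w
                                           - A * mix 1ℚ (t w) (1ℚ - t w))) (arcs-sym y x))
                  (vanish μ A (t w) (arcs x w) (arcs y w)))
      where
      vanish : ∀ μ A τ a b →
        ½ * μ * ((1ℚ - 1ℚ) * a + 1ℚ * b + ((1ℚ - τ) * A + τ * 0ℚ) - b - A * ((1ℚ - 1ℚ) * τ + 1ℚ * (1ℚ - τ))) ≡ 0ℚ
      vanish = solve-∀ ℚ-ring

    Γ-sym : ∀ v w → Γ v w ≡ Γ w v
    Γ-sym v w = begin
      Γ v w
        ≡⟨ cong₂ (λ a b → ½ * μ * (mix (t v) a b + mix (t w) (arcs v x) (arcs v y) - arcs v w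
                                     - A * mix (t v) (t w) (1ℚ - t w))) (arcs-sym x w) (arcs-sym y w) ⟩
      _ ≡⟨ cong₂ (λ a b → ½ * μ * (mix (t v) (arcs w x) (arcs w y) + mix (t w) a b - arcs v w
                                     - A * mix (t v) (t w) (1ℚ - t w))) (arcs-sym v x) (arcs-sym v y) ⟩
      _ ≡⟨ cong (λ a → ½ * μ * (mix (t v) (arcs w x) (arcs w y) + mix (t w) (arcs x v) (arcs y v) - a
                                     - A * mix (t v) (t w) (1ℚ - t w))) (arcs-sym v w) ⟩
      _ ≡⟨ swap μ A (t v) (t w) (mix (t v) (arcs w x) (arcs w y)) (mix (t w) (arcs x v) (arcs y v)) (arcs w v) ⟩
      Γ w v ∎
      where
      open ≡-Reasoning
      swap : ∀ μ A s τ a b c →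
        ½ * μ * (a + b - c - A * ((1ℚ - s) * τ + s * (1ℚ - τ))) ≡
        ½ * μ * (b + a - c - A * ((1ℚ - τ) * s + τ * (1ℚ - s)))
      swap = solve-∀ ℚ-ring

    -- Vertex i of Cₙ stands for the copy of x numbered i. A unit charge at (j, w) acts on Cₙ like
    -- charges 1 - t w at j and t w at `next j`; up to the factor -κ, `φ j w` is their potential.
    φ : Fin n → Fin m → Fin n → ℚ
    φ j w i = mix (t w) (arcs i j) (arcs i (next j))

    green : Fin n → Fin m → Fin n → Fin m → ℚ
    green i v j w = ⟦ i ≟ j ⟧ * Γ v w - κ * mix (t v) (φ j w i) (φ j w (next i))

    green-sym : ∀ i v j w → green i v j w ≡ green j w i v
    green-sym i v j w = cong₂ _-_ (cong₂ _*_ (⟦≟⟧-sym i j) (Γ-sym v w)) (cong (κ *_) (begin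
      mix (t v) (mix (t w) (arcs i j) (arcs i j⁺)) (mix (t w) (arcs i⁺ j) (arcs i⁺ j⁺))
        ≡⟨ cong₂ (λ a b → mix (t v) a b)
             (cong₂ (mix (t w)) (arcs-sym i j) (arcs-sym i j⁺)) (cong₂ (mix (t w)) (arcs-sym i⁺ j) (arcs-sym i⁺ j⁺)) ⟩
      mix (t v) (mix (t w) (arcs j i) (arcs j⁺ i)) (mix (t w) (arcs j i⁺) (arcs j⁺ i⁺))
        ≡⟨ exchange (t v) (t w) (arcs j i) (arcs j⁺ i) (arcs j i⁺) (arcs j⁺ i⁺) ⟩
      mix (t w) (mix (t v) (arcs j i) (arcs j i⁺)) (mix (t v) (arcs j⁺ i) (arcs j⁺ i⁺)) ∎))
      where
      open ≡-Reasoning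
      i⁺ j⁺ : Fin n
      i⁺ = next i
      j⁺ = next j
      exchange : ∀ s τ a b c d →
        (1ℚ - s) * ((1ℚ - τ) * a + τ * b) + s * ((1ℚ - τ) * c + τ * d) ≡
        (1ℚ - τ) * ((1ℚ - s) * a + s * c) + τ * ((1ℚ - s) * b + s * d)
      exchange = solve-∀ ℚ-ring

    -- Γ vanishes at both ends of a copy, so either name of the junction sees only the value of φ at
    -- `next i`. Hence `green` descends to the glued vertices.
    green-glued : ∀ i j w → green i y j w ≡ green (next i) x j w
    green-glued i j w = begin
      ⟦ i ≟ j ⟧ * Γ y w - κ * mix (t y) (φ j w i) (φ j w (next i))
        ≡⟨ cong₂ (λ γ τ → ⟦ i ≟ j ⟧ * γ - κ * mix τ (φ j w i) (φ j w (next i))) (Γ-y w) t-y ⟩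
      ⟦ i ≟ j ⟧ * 0ℚ - κ * mix 1ℚ (φ j w i) (φ j w (next i))
        ≡⟨ identity κ ⟦ i ≟ j ⟧ ⟦ next i ≟ j ⟧ (φ j w i) (φ j w (next i)) (φ j w (next (next i))) ⟩
      ⟦ next i ≟ j ⟧ * 0ℚ - κ * mix 0ℚ (φ j w (next i)) (φ j w (next (next i)))
        ≡⟨ cong₂ (λ γ τ → ⟦ next i ≟ j ⟧ * γ - κ * mix τ (φ j w (next i)) (φ j w (next (next i)))) (Γ-x w) t-x ⟨
      ⟦ next i ≟ j ⟧ * Γ x w - κ * mix (t x) (φ j w (next i)) (φ j w (next (next i))) ∎
      where
      open ≡-Reasoning
      identity : ∀ κ p q a b c → p * 0ℚ - κ * ((1ℚ - 1ℚ) * a + 1ℚ * b) ≡ q * 0ℚ - κ * ((1ℚ - 0ℚ) * b + 0ℚ * c)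
      identity = solve-∀ ℚ-ring

    green-cong : ∀ {i v i′ v′} → g i v ≡ g i′ v′ → ∀ j w → green i v j w ≡ green i′ v′ j w
    green-cong {i} {v} {i′} {v′} eq j w = split (glue-cases x y x≢y eq)
      where
      split : (i ≡ i′ × v ≡ v′) ⊎ (v ≡ y × v′ ≡ x × next i ≡ i′) ⊎ (v ≡ x × v′ ≡ y × next i′ ≡ i) →
              green i v j w ≡ green i′ v′ j w
      split (inj₁ (refl , refl))               = refl
      split (inj₂ (inj₁ (refl , refl , refl))) = green-glued i j w
      split (inj₂ (inj₂ (refl , refl , refl))) = sym (green-glued i′ j w)

    -- Three currents meet in a copy: the unit source at w, the parts 1 - t w and t w of it drawn
    -- off by the grounded ends, and the current through the copy caused by the unequal potentials
    -- of its ends. The last has strength κ α M per unit of φ, which is ½ ν.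
    green-Δ : ∀ i j v w → let slope = ½ * ν * (φ j w (next i) - φ j w i) in
      Δ (λ u → green i u j w) v ≡
      ⟦ i ≟ j ⟧ * ⟦ v ≟ w ⟧ + (slope - ⟦ i ≟ j ⟧ * (1ℚ - t w)) * ⟦ v ≟ x ⟧
        + (- slope - ⟦ i ≟ j ⟧ * t w) * ⟦ v ≟ y ⟧
    green-Δ i j v w = begin
      Δ (λ u → green i u j w) v
        ≡⟨ Δ-cong (λ u → affine I μ κ A (t u) τ (arcs u x) (arcs u y) (arcs u w) a b φ₀ φ₁) v ⟩
      _ ≡⟨ Δ-affine (I * ½ * μ * (a - A * τ) - κ * φ₀) c₁ c₂ c₃ c₄ (λ u → arcs u w) (λ u → arcs u x) (λ u → arcs u y) t v ⟩
      c₁ * Δ (λ u → arcs u w) v + c₂ * Δ (λ u → arcs u x) v + c₃ * Δ (λ u → arcs u y) v + c₄ * Δ t v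
        ≡⟨ cong₂ _+_ (cong₂ _+_ (cong₂ _+_ (cong (c₁ *_) (arcs-Δ v w)) (cong (c₂ *_) (arcs-Δ v x)))
                                (cong (c₃ *_) (arcs-Δ v y)))
                     (cong₂ _*_ (cong (λ z → I * ½ * μ * (z - A * (1ℚ - fromℕ 2 * τ)) - κ * (φ₁ - φ₀)) (arcs-t w))
                                (Δt v)) ⟩
      _ ≡⟨ collect I μ A τ M α ν φ₀ φ₁ ⟦ v ≟ w ⟧ ⟦ v ≟ x ⟧ ⟦ v ≟ y ⟧ ⟩
      (μ * M) * (I * (⟦ v ≟ w ⟧ - (1ℚ - τ) * ⟦ v ≟ x ⟧ - τ * ⟦ v ≟ y ⟧)
          - (α * A) * (½ * ν * (φ₁ - φ₀) * (⟦ v ≟ y ⟧ - ⟦ v ≟ x ⟧)))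
        ≡⟨ cong₂ (λ p q → p * (I * (⟦ v ≟ w ⟧ - (1ℚ - τ) * ⟦ v ≟ x ⟧ - τ * ⟦ v ≟ y ⟧)
             - q * (½ * ν * (φ₁ - φ₀) * (⟦ v ≟ y ⟧ - ⟦ v ≟ x ⟧)))) μM αA ⟩
      _ ≡⟨ tidy I τ (½ * ν * (φ₁ - φ₀)) ⟦ v ≟ w ⟧ ⟦ v ≟ x ⟧ ⟦ v ≟ y ⟧ ⟩
      _ ∎
      where
      open ≡-Reasoning
      I τ a b φ₀ φ₁ c₁ c₂ c₃ c₄ : ℚ
      I = ⟦ i ≟ j ⟧
      τ = t w
      a = arcs x w
      b = arcs y w
      φ₀ = φ j w i
      φ₁ = φ j w (next i)
      c₁ = - (I * ½ * μ)
      c₂ = I * ½ * μ * (1ℚ - τ)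
      c₃ = I * ½ * μ * τ
      c₄ = I * ½ * μ * (b - a - A * (1ℚ - fromℕ 2 * τ)) - κ * (φ₁ - φ₀)
      affine : ∀ I μ κ A s τ X Y W a b φ₀ φ₁ →
        I * (½ * μ * ((1ℚ - s) * a + s * b + ((1ℚ - τ) * X + τ * Y) - W - A * ((1ℚ - s) * τ + s * (1ℚ - τ))))
          - κ * ((1ℚ - s) * φ₀ + s * φ₁) ≡
        I * ½ * μ * (a - A * τ) - κ * φ₀ + (- (I * ½ * μ)) * W + I * ½ * μ * (1ℚ - τ) * X + I * ½ * μ * τ * Y
          + (I * ½ * μ * (b - a - A * (1ℚ - fromℕ 2 * τ)) - κ * (φ₁ - φ₀)) * s
      affine = solve-∀ ℚ-ring
      collect : ∀ I μ A τ M α ν φ₀ φ₁ p q r →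
        (- (I * ½ * μ)) * (fromℕ 2 - fromℕ 2 * M * p) + I * ½ * μ * (1ℚ - τ) * (fromℕ 2 - fromℕ 2 * M * q)
          + I * ½ * μ * τ * (fromℕ 2 - fromℕ 2 * M * r)
          + (I * ½ * μ * (A * (1ℚ - fromℕ 2 * τ) - A * (1ℚ - fromℕ 2 * τ)) - ½ * A * μ * ν * (φ₁ - φ₀))
            * (α * M * (r - q)) ≡
        μ * M * (I * (p - (1ℚ - τ) * q - τ * r) - α * A * (½ * ν * (φ₁ - φ₀) * (r - q)))
      collect = solve-∀ ℚ-ring
      tidy : ∀ I τ σ p q r → 1ℚ * (I * (p - (1ℚ - τ) * q - τ * r) - 1ℚ * (σ * (r - q))) ≡
        I * p + (σ - I * (1ℚ - τ)) * q + (- σ - I * τ) * r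
      tidy = solve-∀ ℚ-ring

    Δφ : ∀ j w i → Δ (φ j w) i ≡
      fromℕ 2 - fromℕ 2 * K * mix (t w) ⟦ i ≟ j ⟧ ⟦ i ≟ next j ⟧
    Δφ j w i = trans
      (linear (t w) (arcs i j) (arcs (next i) j) (arcs (prev i) j)
                    (arcs i (next j)) (arcs (next i) (next j)) (arcs (prev i) (next j)))
      (trans (cong₂ (mix (t w)) (arcs-Δ i j) (arcs-Δ i (next j)))
             (simplify (t w) K ⟦ i ≟ j ⟧ ⟦ i ≟ next j ⟧))
      where
      linear : ∀ τ a a⁺ a⁻ b b⁺ b⁻ →
        (1ℚ - τ) * a + τ * b + ((1ℚ - τ) * a + τ * b)
          - ((1ℚ - τ) * a⁺ + τ * b⁺ + ((1ℚ - τ) * a⁻ + τ * b⁻)) ≡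
        (1ℚ - τ) * (a + a - (a⁺ + a⁻)) + τ * (b + b - (b⁺ + b⁻))
      linear = solve-∀ ℚ-ring
      simplify : ∀ τ K p q →
        (1ℚ - τ) * (fromℕ 2 - fromℕ 2 * K * p) + τ * (fromℕ 2 - fromℕ 2 * K * q) ≡
        fromℕ 2 - fromℕ 2 * K * ((1ℚ - τ) * p + τ * q)
      simplify = solve-∀ ℚ-ring

    -- The current injected at (j , w) leaves through the glued vertices.
    sink : Fin N → ℚ
    sink s = ν * ∑[ i < n ] ⟦ g i x ≟ s ⟧

    -- What a copy receives at its y is booked at the x of the next copy; then all currents except
    -- the source sit at the n junctions, and `balance` evaluates them.
    green-laplacian : ∀ s j w →
      ∑[ i < n ] ∑[ v < m ] (⟦ g i v ≟ s ⟧ * Δ (λ u → green i u j w) v) ≡ ⟦ g j w ≟ s ⟧ - sink s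
    green-laplacian s j w = begin
      ∑[ i < n ] ∑[ v < m ] (⟦ g i v ≟ s ⟧ * Δ (λ u → green i u j w) v)
        ≡⟨ ∑-cong (λ i → trans (∑-cong λ v → cong (⟦ g i v ≟ s ⟧ *_) (green-Δ i j v w)) (contract i)) ⟩
      ∑[ i < n ] (⟦ i ≟ j ⟧ * at w i + Y i * at x i + Z i * at y i)
        ≡⟨ trans (∑-distrib-+ (λ i → ⟦ i ≟ j ⟧ * at w i + Y i * at x i) (λ i → Z i * at y i))
                 (cong (_+ ∑[ i < n ] (Z i * at y i))
                       (∑-distrib-+ (λ i → ⟦ i ≟ j ⟧ * at w i) (λ i → Y i * at x i))) ⟩
      ∑[ i < n ] (⟦ i ≟ j ⟧ * at w i) + ∑[ i < n ] (Y i * at x i) + ∑[ i < n ] (Z i * at y i)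
        ≡⟨ cong₂ (λ a b → a + ∑[ i < n ] (Y i * at x i) + b) (∑-δ′ j (at w)) rotate ⟩
      at w j + ∑[ i < n ] (Y i * at x i) + ∑[ i < n ] (Z (prev i) * at x i)
        ≡⟨ trans (ℚₚ.+-assoc (at w j) _ _)
                 (cong (at w j +_) (sym (∑-distrib-+ (λ i → Y i * at x i) (λ i → Z (prev i) * at x i)))) ⟩
      at w j + ∑[ i < n ] (Y i * at x i + Z (prev i) * at x i)
        ≡⟨ cong (at w j +_) (trans (∑-cong balance) (sym (*-distribˡ-sum (- ν) (at x)))) ⟩
      at w j + (- ν) * ∑[ i < n ] at x i
        ≡⟨ negate (at w j) ν (∑[ i < n ] at x i) ⟩
      at w j - sink s ∎
      where
      open ≡-Reasoning
      at : Fin m → Fin n → ℚ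
      at v i = ⟦ g i v ≟ s ⟧
      slope Y Z : Fin n → ℚ
      slope i = ½ * ν * (φ j w (next i) - φ j w i)
      Y i = slope i - ⟦ i ≟ j ⟧ * (1ℚ - t w)
      Z i = - slope i - ⟦ i ≟ j ⟧ * t w
      negate : ∀ a b c → a + (- b) * c ≡ a - b * c
      negate = solve-∀ ℚ-ring
      spread : ∀ h X Y Z p q r → h * (X * p + Y * q + Z * r) ≡ p * (X * h) + q * (Y * h) + r * (Z * h)
      spread = solve-∀ ℚ-ring
      contract : ∀ i → ∑[ v < m ] (at v i * (⟦ i ≟ j ⟧ * ⟦ v ≟ w ⟧ + Y i * ⟦ v ≟ x ⟧ + Z i * ⟦ v ≟ y ⟧)) ≡
                 ⟦ i ≟ j ⟧ * at w i + Y i * at x i + Z i * at y i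
      contract i = trans
        (∑-cong λ v → spread (at v i) ⟦ i ≟ j ⟧ (Y i) (Z i) ⟦ v ≟ w ⟧ ⟦ v ≟ x ⟧ ⟦ v ≟ y ⟧)
        (trans (∑-distrib-+ (λ v → ⟦ v ≟ w ⟧ * (⟦ i ≟ j ⟧ * at v i) + ⟦ v ≟ x ⟧ * (Y i * at v i))
                            (λ v → ⟦ v ≟ y ⟧ * (Z i * at v i)))
        (cong₂ _+_ (trans (∑-distrib-+ (λ v → ⟦ v ≟ w ⟧ * (⟦ i ≟ j ⟧ * at v i)) (λ v → ⟦ v ≟ x ⟧ * (Y i * at v i)))
                          (cong₂ _+_ (∑-δ′ w λ v → ⟦ i ≟ j ⟧ * at v i) (∑-δ′ x λ v → Y i * at v i)))
                   (∑-δ′ y λ v → Z i * at v i)))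
      rotate : ∑[ i < n ] (Z i * at y i) ≡ ∑[ i < n ] (Z (prev i) * at x i)
      rotate = trans
        (∑-cong λ i → cong₂ _*_ (cong Z (sym (prev-next i))) (cong (λ r → ⟦ r ≟ s ⟧) (g-y i)))
        (∑-next λ i → Z (prev i) * at x i)
      -- The through currents of the two copies meeting at junction i form ½ ν times the Laplacian
      -- of φ. Its delta part cancels the charges 1 - t w and t w, and its constant part 2 leaves ν.
      balance : ∀ i → Y i * at x i + Z (prev i) * at x i ≡ (- ν) * at x i
      balance i = begin
        Y i * at x i + Z (prev i) * at x i
          ≡⟨ cong₂ (λ p q → Y i * at x i + (- (½ * ν * (φ j w p - φ j w (prev i))) - q * t w) * at x i)
               (next-prev i) (⟦⟧-cong (prev i ≟ j) (i ≟ next j) (λ { refl → sym (next-prev i) }) (λ { refl → prev-next j })) ⟩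
        _ ≡⟨ collect ν (t w) (φ j w i) (φ j w (next i)) (φ j w (prev i)) ⟦ i ≟ j ⟧ ⟦ i ≟ next j ⟧ (at x i) ⟩
        - (½ * ν * Δ (φ j w) i + mix (t w) ⟦ i ≟ j ⟧ ⟦ i ≟ next j ⟧) * at x i
          ≡⟨ cong (λ z → - (½ * ν * z + mix (t w) ⟦ i ≟ j ⟧ ⟦ i ≟ next j ⟧) * at x i) (Δφ j w i) ⟩
        _ ≡⟨ regroup ν K (mix (t w) ⟦ i ≟ j ⟧ ⟦ i ≟ next j ⟧) (at x i) ⟩
        - (ν + (1ℚ - ν * K) * mix (t w) ⟦ i ≟ j ⟧ ⟦ i ≟ next j ⟧) * at x i
          ≡⟨ cong (λ z → - (ν + (1ℚ - z) * mix (t w) ⟦ i ≟ j ⟧ ⟦ i ≟ next j ⟧) * at x i) νK ⟩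
        _ ≡⟨ finish ν (mix (t w) ⟦ i ≟ j ⟧ ⟦ i ≟ next j ⟧) (at x i) ⟩
        (- ν) * at x i ∎
        where
        collect : ∀ ν τ a b c p q h →
          (½ * ν * (b - a) - p * (1ℚ - τ)) * h + (- (½ * ν * (a - c)) - q * τ) * h ≡
          - (½ * ν * (a + a - (b + c)) + ((1ℚ - τ) * p + τ * q)) * h
        collect = solve-∀ ℚ-ring
        regroup : ∀ ν K z h → - (½ * ν * (fromℕ 2 - fromℕ 2 * K * z) + z) * h ≡ - (ν + (1ℚ - ν * K) * z) * h
        regroup = solve-∀ ℚ-ring
        finish : ∀ ν z h → - (ν + (1ℚ - 1ℚ) * z) * h ≡ (- ν) * h
        finish = solve-∀ ℚ-ring

    copyOf : Fin N → Fin n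
    copyOf s = proj₁ (proj₁ (glue-surjective {n = n} x y x≢y s))

    placeOf : Fin N → Fin m
    placeOf s = proj₂ (proj₁ (glue-surjective {n = n} x y x≢y s))

    g-copyOf : ∀ s → g (copyOf s) (placeOf s) ≡ s
    g-copyOf s = proj₂ (glue-surjective {n = n} x y x≢y s)

    -- Defined through chosen representatives; by `green-cong` and symmetry the choice is
    -- immaterial.
    G : Matrix N
    G s t = green (copyOf s) (placeOf s) (copyOf t) (placeOf t)

    G-glue : ∀ i v t → G (g i v) t ≡ green i v (copyOf t) (placeOf t)
    G-glue i v t = green-cong (g-copyOf (g i v)) (copyOf t) (placeOf t)

    G-sym : G ᵀ ≐ G
    G-sym s t = green-sym (copyOf t) (placeOf t) (copyOf s) (placeOf s)

    G-glue₂ : ∀ i v j w → G (g i v) (g j w) ≡ green i v j w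
    G-glue₂ i v j w = begin
      G (g i v) (g j w)                                    ≡⟨ G-sym (g i v) (g j w) ⟨
      G (g j w) (g i v)                                    ≡⟨ G-glue j w (g i v) ⟩
      green j w (copyOf (g i v)) (placeOf (g i v))         ≡⟨ green-sym (copyOf (g i v)) (placeOf (g i v)) j w ⟨
      green (copyOf (g i v)) (placeOf (g i v)) j w         ≡⟨ green-cong (g-copyOf (g i v)) j w ⟩
      green i v j w                                        ∎
      where open ≡-Reasoning

    LG : laplacian F ⊗ G ≐ rankOneDefect sink
    LG s t = begin
      ∑[ k < N ] (laplacian F s k * G k t)
        ≡⟨ sunflower-laplacian (λ k → G k t) s ⟩
      ∑[ i < n ] ∑[ v < m ] (⟦ g i v ≟ s ⟧ * Δ (λ u → G (g i u) t) v)
        ≡⟨ ∑-cong₂ (λ i v → cong (⟦ g i v ≟ s ⟧ *_) (Δ-cong (λ u → G-glue i u t) v)) ⟩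
      _ ≡⟨ green-laplacian s (copyOf t) (placeOf t) ⟩
      ⟦ g (copyOf t) (placeOf t) ≟ s ⟧ - sink s
        ≡⟨ cong (_- sink s) (trans (cong (λ r → ⟦ r ≟ s ⟧) (g-copyOf t)) (⟦≟⟧-sym t s)) ⟩
      ⟦ s ≟ t ⟧ - sink s ∎
      where open ≡-Reasoning

open SunflowerGreen

-- Summation of Green's function and Kemeny's constant.

module SunflowerKemeny where

  open import Data.Rational using (_+_; _*_; _-_; -_)
  open ℤ.ℤ using (pos)

  ⅓ ¼ ⅙ ¹/₁₂ : ℚ
  ⅓ = ℤ.+ 1 / 3
  ¼ = ℤ.+ 1 / 4
  ⅙ = ℤ.+ 1 / 6
  ¹/₁₂ = ℤ.+ 1 / 12

  -- The number of functions is fixed at four; shorter combinations are padded with coefficient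
  -- `0ℚ`, the source of the zero terms in later ring identities.
  ∑-affine : ∀ {N} c₀ c₁ c₂ c₃ c₄ (f₁ f₂ f₃ f₄ : Fin N → ℚ) →
    ∑[ i < N ] (c₀ + c₁ * f₁ i + c₂ * f₂ i + c₃ * f₃ i + c₄ * f₄ i) ≡
    c₀ * fromℕ N + c₁ * sum f₁ + c₂ * sum f₂ + c₃ * sum f₃ + c₄ * sum f₄
  ∑-affine {N} c₀ c₁ c₂ c₃ c₄ f₁ f₂ f₃ f₄ =
    trans (∑-distrib-+ (λ i → c₀ + c₁ * f₁ i + c₂ * f₂ i + c₃ * f₃ i) (λ i → c₄ * f₄ i)) (cong₂ _+_
   (trans (∑-distrib-+ (λ i → c₀ + c₁ * f₁ i + c₂ * f₂ i) (λ i → c₃ * f₃ i)) (cong₂ _+_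
   (trans (∑-distrib-+ (λ i → c₀ + c₁ * f₁ i) (λ i → c₂ * f₂ i)) (cong₂ _+_
   (trans (∑-distrib-+ {N} (λ i → c₀) (λ i → c₁ * f₁ i)) (cong₂ _+_
     (trans (∑-const N c₀) (ℚₚ.*-comm (fromℕ N) c₀))
     (sym (*-distribˡ-sum c₁ f₁)))) (sym (*-distribˡ-sum c₂ f₂))))
     (sym (*-distribˡ-sum c₃ f₃)))) (sym (*-distribˡ-sum c₄ f₄)))

  ∑∑-affine : ∀ {M N} c₀ c₁ c₂ c₃ c₄ (f₁ f₂ f₃ f₄ : Fin M → Fin N → ℚ) →
    ∑[ i < M ] ∑[ j < N ] (c₀ + c₁ * f₁ i j + c₂ * f₂ i j + c₃ * f₃ i j + c₄ * f₄ i j) ≡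
    c₀ * fromℕ N * fromℕ M + c₁ * sum (sum ∘ f₁) + c₂ * sum (sum ∘ f₂) + c₃ * sum (sum ∘ f₃) + c₄ * sum (sum ∘ f₄)
  ∑∑-affine {M} {N} c₀ c₁ c₂ c₃ c₄ f₁ f₂ f₃ f₄ = trans
    (∑-cong λ i → ∑-affine c₀ c₁ c₂ c₃ c₄ (f₁ i) (f₂ i) (f₃ i) (f₄ i))
    (∑-affine (c₀ * fromℕ N) c₁ c₂ c₃ c₄ (sum ∘ f₁) (sum ∘ f₂) (sum ∘ f₃) (sum ∘ f₄))

  ∑-arcs-column : ∀ {n} (w : Fin n) → ∑[ v < n ] arcs v w ≡ ⅙ * (fromℕ n * (fromℕ n * fromℕ n - 1ℚ))
  ∑-arcs-column w = trans (divide (sum λ v → arcs v w)) (cong (⅙ *_) (∑-arcs w))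
    where
    divide : ∀ s → s ≡ ⅙ * (fromℕ 6 * s)
    divide = solve-∀ ℚ-ring

  ∑-arcs-row : ∀ {n} (w : Fin n) → ∑[ v < n ] arcs w v ≡ ⅙ * (fromℕ n * (fromℕ n * fromℕ n - 1ℚ))
  ∑-arcs-row w = trans (∑-cong (arcs-sym w)) (∑-arcs-column w)

  kemenyNumerator : ℕ → ℕ → ℕ → ℤ
  kemenyNumerator m n p =
    (pos n ℤ.^ 2 ℤ.- pos 6 ℤ.* pos n ℤ.+ pos 4) ℤ.* (pos p ℤ.* pos m ℤ.- pos p ℤ.^ 2)
      ℤ.+ pos m ℤ.^ 2 ℤ.* (pos 2 ℤ.* pos n ℤ.- pos 1) ℤ.- pos 2 ℤ.* pos n ℤ.- pos 1

  -- Wrapping the equation keeps i and a visible to inference, so that a proof can copy the shape of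
  -- the polynomial that it evaluates.
  record _↦_ (i : ℤ) (a : ℚ) : Set where
    constructor ⌈_⌉
    field proof : fromℤ i ≡ a

  -- The trailing factors `1ℚ` come from unfolding the exponent 2.
  fromℤ-kemenyNumerator : ∀ m n p → let M = fromℕ m; K = fromℕ n; P = fromℕ p in
    fromℤ (kemenyNumerator m n p) ≡
    (K * (K * 1ℚ) - fromℕ 6 * K + fromℕ 4) * (P * M - P * (P * 1ℚ))
      + M * (M * 1ℚ) * (fromℕ 2 * K - 1ℚ) - fromℕ 2 * K - 1ℚ
  fromℤ-kemenyNumerator m n p = _↦_.proof
    ((((((n̂ ⊠ (n̂ ⊠ k 1)) ⊟ (k 6 ⊠ n̂)) ⊞ k 4) ⊠ ((p̂ ⊠ m̂) ⊟ (p̂ ⊠ (p̂ ⊠ k 1))))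
      ⊞ ((m̂ ⊠ (m̂ ⊠ k 1)) ⊠ ((k 2 ⊠ n̂) ⊟ k 1))) ⊟ (k 2 ⊠ n̂) ⊟ k 1)
    where
    infixl 6 _⊟_
    _⊞_ : ∀ {i j a b} → i ↦ a → j ↦ b → (i ℤ.+ j) ↦ (a + b)
    _⊞_ {i} {j} ⌈ p ⌉ ⌈ q ⌉ = ⌈ trans (fromℤ-+ i j) (cong₂ _+_ p q) ⌉
    _⊟_ : ∀ {i j a b} → i ↦ a → j ↦ b → (i ℤ.- j) ↦ (a - b)
    _⊟_ {i} {j} ⌈ p ⌉ ⌈ q ⌉ = ⌈ trans (fromℤ-- i j) (cong₂ _-_ p q) ⌉
    _⊠_ : ∀ {i j a b} → i ↦ a → j ↦ b → (i ℤ.* j) ↦ (a * b)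
    _⊠_ {i} {j} ⌈ p ⌉ ⌈ q ⌉ = ⌈ trans (fromℤ-* i j) (cong₂ _*_ p q) ⌉
    k : ∀ a → pos a ↦ fromℕ a
    k a = ⌈ refl ⌉
    m̂ : pos m ↦ fromℕ m
    m̂ = k m
    n̂ : pos n ↦ fromℕ n
    n̂ = k n
    p̂ : pos p ↦ fromℕ p
    p̂ = k p

  module Kemeny {m n : ℕ} (3≤m : 3 ℕ.≤ m) (3≤n : 3 ℕ.≤ n) (x y : Fin m) (x≢y : x ≢ y)
    (μ ν α : ℚ) (μM : μ * fromℕ m ≡ 1ℚ) (νK : ν * fromℕ n ≡ 1ℚ) (αA : α * arcs x y ≡ 1ℚ) where

    open Sunflower 3≤m 3≤n x y x≢y
    open Green 3≤m 3≤n x y x≢y μ ν α μM νK αA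

    -- The common column sums of `arcs` on C_m and on Cₙ.
    c B : ℚ
    c = ⅙ * (M * (M * M - 1ℚ))
    B = ⅙ * (K * (K * K - 1ℚ))

    -- The columns of x and of y have equal sums, so only the constant ½ survives.
    ∑-t : ∑[ v < m ] t v ≡ ½ * M
    ∑-t = trans (∑-cong λ v → affine α (arcs v x) (arcs v y))
      (trans (∑-affine ½ (½ * α) (- (½ * α)) 0ℚ 0ℚ (λ v → arcs v x) (λ v → arcs v y) t t)
      (trans (cong₂ (λ a b → ½ * M + ½ * α * a + (- (½ * α)) * b + 0ℚ * sum t + 0ℚ * sum t)
               (∑-arcs-column x) (∑-arcs-column y))
             (cancel α M c (sum t))))
      where
      affine : ∀ α a b → ½ + ½ * α * (a - b) ≡ ½ + ½ * α * a + (- (½ * α)) * b + 0ℚ * (½ + ½ * α * (a - b)) + 0ℚ * (½ + ½ * α * (a - b))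
      affine = solve-∀ ℚ-ring
      cancel : ∀ α M c s → ½ * M + ½ * α * c + (- (½ * α)) * c + 0ℚ * s + 0ℚ * s ≡ ½ * M
      cancel = solve-∀ ℚ-ring

    column : Fin m → ℚ
    column w = ¼ * (arcs w x + arcs w y - A) - κ * (M * B)

    -- The column sum c enters with total weight (1 - s) + s - 1 = 0, which leaves the constant term
    -- and the multiple of `∑-t`. Twice the result is the mean time in which the walk on C_m from w
    -- reaches x or y.
    ∑-Γ : ∀ w → ∑[ v < m ] Γ v w ≡ ¼ * (arcs w x + arcs w y - A)
    ∑-Γ w = begin
      ∑[ v < m ] Γ v w
        ≡⟨ ∑-cong (λ v → Γ-sym v w) ⟩
      ∑[ v < m ] Γ w v
        ≡⟨ ∑-cong (λ v → affine μ A s (t v) X Y (arcs w v) (arcs x v) (arcs y v)) ⟩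
      _ ≡⟨ ∑-affine (½ * μ * (X - A * s)) (½ * μ * (1ℚ - s)) (½ * μ * s) (- (½ * μ)) (½ * μ * (Y - X - A * (1ℚ - fromℕ 2 * s)))
             (arcs x) (arcs y) (arcs w) t ⟩
      _ ≡⟨ cong₂ (λ a b → ½ * μ * (X - A * s) * M + ½ * μ * (1ℚ - s) * a + ½ * μ * s * b + (- (½ * μ)) * sum (arcs w)
                           + ½ * μ * (Y - X - A * (1ℚ - fromℕ 2 * s)) * sum t) (∑-arcs-row x) (∑-arcs-row y) ⟩
      _ ≡⟨ cong₂ (λ a b → ½ * μ * (X - A * s) * M + ½ * μ * (1ℚ - s) * c + ½ * μ * s * c + (- (½ * μ)) * a
                           + ½ * μ * (Y - X - A * (1ℚ - fromℕ 2 * s)) * b) (∑-arcs-row w) ∑-t ⟩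
      _ ≡⟨ collect μ A s M X Y c ⟩
      μ * M * (¼ * (X + Y - A))
        ≡⟨ cong (_* (¼ * (X + Y - A))) μM ⟩
      1ℚ * (¼ * (X + Y - A))
        ≡⟨ ℚₚ.*-identityˡ _ ⟩
      ¼ * (X + Y - A) ∎
      where
      open ≡-Reasoning
      s X Y : ℚ
      s = t w
      X = arcs w x
      Y = arcs w y
      affine : ∀ μ A s τ X Y W a b →
        ½ * μ * ((1ℚ - s) * a + s * b + ((1ℚ - τ) * X + τ * Y) - W - A * ((1ℚ - s) * τ + s * (1ℚ - τ))) ≡
        ½ * μ * (X - A * s) + ½ * μ * (1ℚ - s) * a + ½ * μ * s * b + (- (½ * μ)) * W
          + ½ * μ * (Y - X - A * (1ℚ - fromℕ 2 * s)) * τ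
      affine = solve-∀ ℚ-ring
      collect : ∀ μ A s M X Y c →
        ½ * μ * (X - A * s) * M + ½ * μ * (1ℚ - s) * c + ½ * μ * s * c + (- (½ * μ)) * c
          + ½ * μ * (Y - X - A * (1ℚ - fromℕ 2 * s)) * (½ * M) ≡ μ * M * (¼ * (X + Y - A))
      collect = solve-∀ ℚ-ring

    mix-affine : ∀ τ a b → (1ℚ - τ) * a + τ * b ≡ 0ℚ + (1ℚ - τ) * a + τ * b + 0ℚ * a + 0ℚ * a
    mix-affine = solve-∀ ℚ-ring

    ∑-mix : ∀ {N} τ (f f′ : Fin N → ℚ) s → sum f ≡ s → sum f′ ≡ s → ∑[ i < N ] mix τ (f i) (f′ i) ≡ s
    ∑-mix {N} τ f f′ s p q = trans (∑-cong λ i → mix-affine τ (f i) (f′ i))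
      (trans (∑-affine 0ℚ (1ℚ - τ) τ 0ℚ 0ℚ f f′ f f)
      (trans (cong₂ (λ a b → 0ℚ * fromℕ N + (1ℚ - τ) * a + τ * b + 0ℚ * a + 0ℚ * a) p q)
             (cancel τ s (fromℕ N))))
      where
      cancel : ∀ τ s N → 0ℚ * N + (1ℚ - τ) * s + τ * s + 0ℚ * s + 0ℚ * s ≡ s
      cancel = solve-∀ ℚ-ring

    ∑-φ : ∀ j w → sum (φ j w) ≡ B
    ∑-φ j w = ∑-mix (t w) (λ i → arcs i j) (λ i → arcs i (next j)) B (∑-arcs-column j) (∑-arcs-column (next j))

    ∑∑-green : ∀ j w → ∑[ i < n ] ∑[ v < m ] green i v j w ≡ column w
    ∑∑-green j w = begin
      ∑[ i < n ] ∑[ v < m ] (⟦ i ≟ j ⟧ * Γ v w - κ * Φ i v)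
        ≡⟨ trans (∑-cong λ i → ∑-distrib-- (λ v → ⟦ i ≟ j ⟧ * Γ v w) (λ v → κ * Φ i v))
                 (∑-distrib-- (λ i → ∑[ v < m ] (⟦ i ≟ j ⟧ * Γ v w)) (λ i → ∑[ v < m ] (κ * Φ i v))) ⟩
      ∑[ i < n ] ∑[ v < m ] (⟦ i ≟ j ⟧ * Γ v w) - ∑[ i < n ] ∑[ v < m ] (κ * Φ i v)
        ≡⟨ cong₂ _-_ local global ⟩
      column w ∎
      where
      open ≡-Reasoning
      Φ : Fin n → Fin m → ℚ
      Φ i v = mix (t v) (φ j w i) (φ j w (next i))
      local : ∑[ i < n ] ∑[ v < m ] (⟦ i ≟ j ⟧ * Γ v w) ≡ ¼ * (arcs w x + arcs w y - A)
      local = trans (∑-cong λ i → sym (*-distribˡ-sum ⟦ i ≟ j ⟧ (λ v → Γ v w)))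
        (trans (∑-δ′ j λ _ → ∑[ v < m ] Γ v w) (∑-Γ w))
      global : ∑[ i < n ] ∑[ v < m ] (κ * Φ i v) ≡ κ * (M * B)
      global = begin
        ∑[ i < n ] ∑[ v < m ] (κ * Φ i v)
          ≡⟨ trans (*-distribˡ-sum κ (λ i → sum (Φ i))) (∑-cong λ i → *-distribˡ-sum κ (Φ i)) ⟨
        κ * ∑[ i < n ] ∑[ v < m ] Φ i v
          -- Over the copies, φ and its rotation have the same sum, so summing over i first makes
          -- the weight `t v` disappear.
          ≡⟨ cong (κ *_) (∑-comm Φ) ⟩
        κ * ∑[ v < m ] ∑[ i < n ] Φ i v
          ≡⟨ cong (κ *_) (∑-cong λ v → ∑-mix (t v) (φ j w) (φ j w ∘ next) B (∑-φ j w)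
               (trans (∑-next (φ j w)) (∑-φ j w))) ⟩
        κ * ∑[ v < m ] B
          ≡⟨ cong (κ *_) (∑-const m B) ⟩
        κ * (M * B) ∎

    -- `T` is the trace of `green` over all pairs (copy, vertex) and `D′` its mean column sum. The
    -- weighted resistances add up to 8 n m (T - D′), and 4 n m is four times the number of edges,
    -- so Kemeny's constant is 2 (T - D′).
    T D′ : ℚ
    T = K * (⅙ * (M * M - 1ℚ) - ⅓ * A - ⅙) - ⅙ * (K - 1ℚ) * (A - 1ℚ)
    D′ = ¹/₁₂ * (M * M - 1ℚ) - ¼ * A - ¹/₁₂ * A * (K * K - 1ℚ)

    ∑∑-column : ∑[ i < n ] ∑[ v < m ] column v ≡ K * M * D′
    ∑∑-column = begin
      ∑[ i < n ] ∑[ v < m ] column v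
        ≡⟨ ∑-const n (sum column) ⟩
      K * sum column
        ≡⟨ cong (K *_) (∑-cong λ v → affine A (κ * (M * B)) (arcs v x) (arcs v y)) ⟩
      _ ≡⟨ cong (K *_) (∑-affine (- (¼ * A + κ * (M * B))) ¼ ¼ 0ℚ 0ℚ (λ v → arcs v x) (λ v → arcs v y) (λ v → arcs v x) (λ v → arcs v x)) ⟩
      _ ≡⟨ cong (K *_) (cong₂ (λ a b → (- (¼ * A + κ * (M * B))) * M + ¼ * a + ¼ * b + 0ℚ * a + 0ℚ * a)
             (∑-arcs-column x) (∑-arcs-column y)) ⟩
      _ ≡⟨ collect K M A μ ν ⟩
      K * M * (¹/₁₂ * (M * M - 1ℚ) - ¼ * A - ¹/₁₂ * (μ * M) * (ν * K) * A * (K * K - 1ℚ))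
        ≡⟨ cong₂ (λ p q → K * M * (¹/₁₂ * (M * M - 1ℚ) - ¼ * A - ¹/₁₂ * p * q * A * (K * K - 1ℚ))) μM νK ⟩
      K * M * (¹/₁₂ * (M * M - 1ℚ) - ¼ * A - ¹/₁₂ * 1ℚ * 1ℚ * A * (K * K - 1ℚ))
        ≡⟨⟩
      K * M * D′ ∎
      where
      open ≡-Reasoning
      affine : ∀ A k X Y → ¼ * (X + Y - A) - k ≡ - (¼ * A + k) + ¼ * X + ¼ * Y + 0ℚ * X + 0ℚ * X
      affine = solve-∀ ℚ-ring
      collect : ∀ K M A μ ν → let c = ⅙ * (M * (M * M - 1ℚ)) in
        K * ((- (¼ * A + ½ * A * μ * ν * (M * (⅙ * (K * (K * K - 1ℚ)))))) * M + ¼ * c + ¼ * c + 0ℚ * c + 0ℚ * c) ≡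
        K * M * (¹/₁₂ * (M * M - 1ℚ) - ¼ * A - ¹/₁₂ * (μ * M) * (ν * K) * A * (K * K - 1ℚ))
      collect = solve-∀ ℚ-ring

    -- On the diagonal `t` enters only through t (1 - t) = ¼ (1 - α² (X - Y)²) and through (1 - t) X
    -- + t Y = ½ (X + Y) - ½ α (X - Y)². So the trace requires just the column sums and the sum of
    -- the squares (X - Y)².
    green-diag : ∀ i v → let X = arcs v x; Y = arcs v y in green i v i v ≡
      (- (¼ * μ * A + ¼ * μ * ν * (K - 1ℚ) * A)) + ½ * μ * X + ½ * μ * Y
        + ¼ * μ * α * (ν * (K - 1ℚ) - 1ℚ) * ((X - Y) * (X - Y)) + 0ℚ * X
    green-diag i v = begin
      green i v i v
        ≡⟨ cong₂ (λ p q → ⟦ i ≟ i ⟧ * Γ v v - κ * mix s (mix s p q) (mix s (arcs i⁺ i) (arcs i⁺ i⁺)))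
             (arcs-diag i) (arcs-next-diag i) ⟩
      _ ≡⟨ cong₂ (λ p q → ⟦ i ≟ i ⟧ * Γ v v - κ * mix s (mix s 0ℚ (K - 1ℚ)) (mix s p q))
             (trans (arcs-sym i⁺ i) (arcs-next-diag i)) (arcs-diag i⁺) ⟩
      _ ≡⟨ cong₂ (λ I W → I * (½ * μ * (mix s (arcs x v) (arcs y v) + mix s X Y - W - A * mix s s (1ℚ - s)))
               - κ * mix s (mix s 0ℚ (K - 1ℚ)) (mix s (K - 1ℚ) 0ℚ)) (⟦⟧-true (i ≟ i) refl) (arcs-diag v) ⟩
      _ ≡⟨ cong₂ (λ a b → 1ℚ * (½ * μ * (mix s a b + mix s X Y - 0ℚ - A * mix s s (1ℚ - s)))
               - κ * mix s (mix s 0ℚ (K - 1ℚ)) (mix s (K - 1ℚ) 0ℚ)) (arcs-sym x v) (arcs-sym y v) ⟩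
      _ ≡⟨ collect μ ν α A K X Y ⟩
      _ ≡⟨ cong (λ z → ½ * μ * (X + Y - α * Q - ½ * A + ½ * α * z * Q) - ¼ * μ * ν * (K - 1ℚ) * (A - α * z * Q)) αA ⟩
      _ ≡⟨ tidy μ ν α A K X Y Q ⟩
      _ ∎
      where
      open ≡-Reasoning
      i⁺ : Fin n
      i⁺ = next i
      s X Y Q : ℚ
      s = t v
      X = arcs v x
      Y = arcs v y
      Q = (X - Y) * (X - Y)
      collect : ∀ μ ν α A K X Y → let s = ½ + ½ * α * (X - Y); Q = (X - Y) * (X - Y) in
        1ℚ * (½ * μ * ((1ℚ - s) * X + s * Y + ((1ℚ - s) * X + s * Y) - 0ℚ - A * ((1ℚ - s) * s + s * (1ℚ - s))))
          - ½ * A * μ * ν * ((1ℚ - s) * ((1ℚ - s) * 0ℚ + s * (K - 1ℚ)) + s * ((1ℚ - s) * (K - 1ℚ) + s * 0ℚ)) ≡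
        ½ * μ * (X + Y - α * Q - ½ * A + ½ * α * (α * A) * Q) - ¼ * μ * ν * (K - 1ℚ) * (A - α * (α * A) * Q)
      collect = solve-∀ ℚ-ring
      tidy : ∀ μ ν α A K X Y Q →
        ½ * μ * (X + Y - α * Q - ½ * A + ½ * α * 1ℚ * Q) - ¼ * μ * ν * (K - 1ℚ) * (A - α * 1ℚ * Q) ≡
        (- (¼ * μ * A + ¼ * μ * ν * (K - 1ℚ) * A)) + ½ * μ * X + ½ * μ * Y
          + ¼ * μ * α * (ν * (K - 1ℚ) - 1ℚ) * Q + 0ℚ * X
      tidy = solve-∀ ℚ-ring

    ∑∑-green-diag : ∑[ i < n ] ∑[ v < m ] green i v i v ≡ T
    ∑∑-green-diag = begin
      ∑[ i < n ] ∑[ v < m ] green i v i v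
        ≡⟨ ∑-cong (λ i → trans (∑-cong (green-diag i)) (∑-affine c₀ (½ * μ) (½ * μ) c₃ 0ℚ X Y Q X)) ⟩
      ∑[ i < n ] (c₀ * M + ½ * μ * sum X + ½ * μ * sum Y + c₃ * sum Q + 0ℚ * sum X)
        ≡⟨ ∑-const n _ ⟩
      K * (c₀ * M + ½ * μ * sum X + ½ * μ * sum Y + c₃ * sum Q + 0ℚ * sum X)
        ≡⟨ cong₂ (λ a b → K * (c₀ * M + ½ * μ * a + ½ * μ * b + c₃ * sum Q + 0ℚ * a)) (∑-arcs-column x) (∑-arcs-column y) ⟩
      _ ≡⟨ cong (λ z → K * (c₀ * M + ½ * μ * c + ½ * μ * c + c₃ * z + 0ℚ * c)) ∑-Q ⟩
      _ ≡⟨ collect K M A μ ν α ⟩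
      formula (μ * M) (α * A) (ν * K)
        ≡⟨ cong₂ (λ p q → formula p q (ν * K)) μM αA ⟩
      formula 1ℚ 1ℚ (ν * K)
        ≡⟨ cong (formula 1ℚ 1ℚ) νK ⟩
      formula 1ℚ 1ℚ 1ℚ
        ≡⟨ tidy K M A ⟩
      T ∎
      where
      open ≡-Reasoning
      X Y Q : Fin m → ℚ
      X v = arcs v x
      Y v = arcs v y
      Q v = (X v - Y v) * (X v - Y v)
      c₀ c₃ : ℚ
      c₀ = - (¼ * μ * A + ¼ * μ * ν * (K - 1ℚ) * A)
      c₃ = ¼ * μ * α * (ν * (K - 1ℚ) - 1ℚ)
      divide : ∀ s → s ≡ ⅓ * (fromℕ 3 * s)
      divide = solve-∀ ℚ-ring
      ∑-Q : sum Q ≡ ⅓ * (M * A * (A + fromℕ 2))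
      ∑-Q = trans (divide (sum Q)) (cong (⅓ *_) (∑-arcs-squares x y))
      formula : ℚ → ℚ → ℚ → ℚ
      formula μM αA νK = μM * (⅙ * K * (M * M - 1ℚ) - ¼ * A * (K + νK * (K - 1ℚ))
        + ¹/₁₂ * αA * (νK * (K - 1ℚ) - K) * (A + fromℕ 2))
      collect : ∀ K M A μ ν α → let c = ⅙ * (M * (M * M - 1ℚ)) in
        K * ((- (¼ * μ * A + ¼ * μ * ν * (K - 1ℚ) * A)) * M + ½ * μ * c + ½ * μ * c
             + ¼ * μ * α * (ν * (K - 1ℚ) - 1ℚ) * (⅓ * (M * A * (A + fromℕ 2))) + 0ℚ * c) ≡
        μ * M * (⅙ * K * (M * M - 1ℚ) - ¼ * A * (K + ν * K * (K - 1ℚ))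
          + ¹/₁₂ * (α * A) * (ν * K * (K - 1ℚ) - K) * (A + fromℕ 2))
      collect = solve-∀ ℚ-ring
      tidy : ∀ K M A →
        1ℚ * (⅙ * K * (M * M - 1ℚ) - ¼ * A * (K + 1ℚ * (K - 1ℚ)) + ¹/₁₂ * 1ℚ * (1ℚ * (K - 1ℚ) - K) * (A + fromℕ 2)) ≡
        K * (⅙ * (M * M - 1ℚ) - ⅓ * A - ⅙) - ⅙ * (K - 1ℚ) * (A - 1ℚ)
      tidy = solve-∀ ℚ-ring

    R : Fin N → Fin N → ℚ
    R s t = G s s + G t t - G s t - G t s

    d : Fin N → ℚ
    d s = fromℕ (degree F s)

    ∑-R : ∀ i v → ∑[ t < N ] (d t * R (g i v) t) ≡ fromℕ 2 * (K * M * green i v i v + T - fromℕ 2 * column v)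
    ∑-R i v = begin
      ∑[ t < N ] (d t * R (g i v) t)
        ≡⟨ ∑-degree (R (g i v)) ⟩
      ∑[ j < n ] ∑[ w < m ] (fromℕ 2 * R (g i v) (g j w))
        ≡⟨ ∑-cong₂ (λ j w → trans
             (cong (fromℕ 2 *_) (cong₂ _-_ (cong₂ _-_ (cong₂ _+_ (G-glue₂ i v i v) (G-glue₂ j w j w)) (G-glue₂ i v j w))
               (G-glue₂ j w i v)))
             (trans (cong (λ z → fromℕ 2 * (green i v i v + green j w j w - z - green j w i v)) (green-sym i v j w))
                    (affine (green i v i v) (green j w j w) (green j w i v)))) ⟩
      _ ≡⟨ ∑∑-affine (fromℕ 2 * green i v i v) (fromℕ 2) (- fromℕ 4) 0ℚ 0ℚ
             (λ j w → green j w j w) (λ j w → green j w i v) (λ j w → green j w j w) (λ j w → green j w j w) ⟩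
      _ ≡⟨ cong₂ (λ a b → fromℕ 2 * green i v i v * M * K + fromℕ 2 * a + (- fromℕ 4) * b + 0ℚ * a + 0ℚ * a)
             ∑∑-green-diag (∑∑-green i v) ⟩
      _ ≡⟨ collect (green i v i v) M K T (column v) ⟩
      fromℕ 2 * (K * M * green i v i v + T - fromℕ 2 * column v) ∎
      where
      open ≡-Reasoning
      affine : ∀ a b z → fromℕ 2 * (a + b - z - z) ≡ fromℕ 2 * a + fromℕ 2 * b + (- fromℕ 4) * z + 0ℚ * b + 0ℚ * b
      affine = solve-∀ ℚ-ring
      collect : ∀ a M K T b → fromℕ 2 * a * M * K + fromℕ 2 * T + (- fromℕ 4) * b + 0ℚ * T + 0ℚ * T ≡
                fromℕ 2 * (K * M * a + T - fromℕ 2 * b)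
      collect = solve-∀ ℚ-ring

    ∑∑-R : ∑[ s < N ] ∑[ t < N ] (d s * d t * R s t) ≡ fromℕ 8 * (K * M * (T - D′))
    ∑∑-R = begin
      ∑[ s < N ] ∑[ t < N ] (d s * d t * R s t)
        ≡⟨ ∑-cong (λ s → trans (∑-cong λ t → ℚₚ.*-assoc (d s) (d t) (R s t)) (sym (*-distribˡ-sum (d s) (λ t → d t * R s t)))) ⟩
      ∑[ s < N ] (d s * ∑[ t < N ] (d t * R s t))
        ≡⟨ ∑-degree (λ s → ∑[ t < N ] (d t * R s t)) ⟩
      ∑[ i < n ] ∑[ v < m ] (fromℕ 2 * ∑[ t < N ] (d t * R (g i v) t))
        ≡⟨ ∑-cong₂ (λ i v → trans (cong (fromℕ 2 *_) (∑-R i v)) (affine K M T (green i v i v) (column v))) ⟩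
      _ ≡⟨ ∑∑-affine (fromℕ 4 * T) (fromℕ 4 * K * M) (- fromℕ 8) 0ℚ 0ℚ
             (λ i v → green i v i v) (λ _ v → column v) (λ i v → green i v i v) (λ i v → green i v i v) ⟩
      _ ≡⟨ cong₂ (λ a b → fromℕ 4 * T * M * K + fromℕ 4 * K * M * a + (- fromℕ 8) * b + 0ℚ * a + 0ℚ * a)
             ∑∑-green-diag ∑∑-column ⟩
      _ ≡⟨ collect K M T D′ ⟩
      fromℕ 8 * (K * M * (T - D′)) ∎
      where
      open ≡-Reasoning
      affine : ∀ K M T a b → fromℕ 2 * (fromℕ 2 * (K * M * a + T - fromℕ 2 * b)) ≡
               fromℕ 4 * T + fromℕ 4 * K * M * a + (- fromℕ 8) * b + 0ℚ * a + 0ℚ * a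
      affine = solve-∀ ℚ-ring
      collect : ∀ K M T D → fromℕ 4 * T * M * K + fromℕ 4 * K * M * T + (- fromℕ 8) * (K * M * D) + 0ℚ * T + 0ℚ * T ≡
                fromℕ 8 * (K * M * (T - D))
      collect = solve-∀ ℚ-ring

    N≢0 : NonZero N
    N≢0 = ℕₚ.m*n≢0 n (pred m) {{ℕ.>-nonZero (ℕₚ.<-≤-trans (s≤s z≤n) 3≤n)}}
                              {{ℕ.>-nonZero (ℕₚ.<-≤-trans (s≤s z≤n) (ℕₚ.pred-mono-≤ 3≤m))}}

    open GreenMatrix {{N≢0}} (laplacian F) G sink (laplacian-sym F) (laplacian-columns F) G-sym LG
      using (isPseudoinverse; quadraticForm-pseudoinverse)

    -- The number of edges is n m, which has the inverse μ ν.
    size≢0 : NonZero (size F)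
    size≢0 = ℕ.≢-nonZero λ size≡0 → 1≢0 (begin
      1ℚ                            ≡⟨ cong₂ _*_ μM νK ⟨
      μ * M * (ν * K)               ≡⟨ rearrange μ ν M K ⟩
      μ * ν * (K * M)               ≡⟨ cong (μ * ν *_) (trans (sym fromℕ-size) (cong fromℕ size≡0)) ⟩
      μ * ν * 0ℚ                    ≡⟨ ℚₚ.*-zeroʳ (μ * ν) ⟩
      0ℚ                            ∎)
      where
      open ≡-Reasoning
      1≢0 : 1ℚ ≢ 0ℚ
      1≢0 ()
      rearrange : ∀ μ ν M K → μ * M * (ν * K) ≡ μ * ν * (K * M)
      rearrange = solve-∀ ℚ-ring

    ω : ℚ
    ω = (ℤ.+ 1 / (4 ℕ.* size F)) {{ℕₚ.m*n≢0 4 (size F) {{_}} {{size≢0}}}}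

    ω-size : ω * (fromℕ 4 * (K * M)) ≡ 1ℚ
    ω-size = trans (cong (ω *_) (trans (cong (fromℕ 4 *_) (sym fromℕ-size)) (sym (fromℕ-* 4 (size F)))))
                   (recip (4 ℕ.* size F) {{ℕₚ.m*n≢0 4 (size F) {{_}} {{size≢0}}}})

    kemenyFormula-value : ∀ p → IsDistance C x y p → ∀ L† → IsPseudoinverse (laplacian F) L† →
      kemenyFormula F L† {{size≢0}} ≡ kemenyNumerator m n p / 6
    kemenyFormula-value p dist L† isPinv = begin
      ω * ∑[ s < N ] ∑[ t < N ] (d s * d t * resistance F L† s t)
        ≡⟨ cong (ω *_) (∑-cong₂ λ s t → cong (d s * d t *_) (quadraticForm-pseudoinverse s t isPinv)) ⟩
      ω * ∑[ s < N ] ∑[ t < N ] (d s * d t * R s t)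
        ≡⟨ cong (ω *_) ∑∑-R ⟩
      ω * (fromℕ 8 * (K * M * (T - D′)))
        ≡⟨ collect ω K M (T - D′) ⟩
      ω * (fromℕ 4 * (K * M)) * (fromℕ 2 * (T - D′))
        ≡⟨ cong (_* (fromℕ 2 * (T - D′))) ω-size ⟩
      1ℚ * (fromℕ 2 * (T - D′))
        ≡⟨ evaluate K M A ⟩
      ⅙ * ((K * (K * 1ℚ) - fromℕ 6 * K + fromℕ 4) * A + M * (M * 1ℚ) * (fromℕ 2 * K - 1ℚ) - fromℕ 2 * K - 1ℚ)
        -- Up to here the marked vertices appear only through A; now A becomes p m - p².
        ≡⟨ cong (λ z → ⅙ * ((K * (K * 1ℚ) - fromℕ 6 * K + fromℕ 4) * z + M * (M * 1ℚ) * (fromℕ 2 * K - 1ℚ) - fromℕ 2 * K - 1ℚ))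
             (trans (distance-arcs 3≤m dist) (expand (fromℕ p) M)) ⟩
      _ ≡⟨ cong (⅙ *_) (fromℤ-kemenyNumerator m n p) ⟨
      ⅙ * fromℤ z
        ≡⟨ cong (⅙ *_) (/-cancel z 6) ⟨
      ⅙ * (z / 6 * fromℕ 6)
        ≡⟨ cancel (z / 6) ⟩
      z / 6 ∎
      where
      open ≡-Reasoning
      z : ℤ
      z = kemenyNumerator m n p
      collect : ∀ ω K M s → ω * (fromℕ 8 * (K * M * s)) ≡ ω * (fromℕ 4 * (K * M)) * (fromℕ 2 * s)
      collect = solve-∀ ℚ-ring
      evaluate : ∀ K M A →
        1ℚ * (fromℕ 2 * (K * (⅙ * (M * M - 1ℚ) - ⅓ * A - ⅙) - ⅙ * (K - 1ℚ) * (A - 1ℚ)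
                         - (¹/₁₂ * (M * M - 1ℚ) - ¼ * A - ¹/₁₂ * A * (K * K - 1ℚ)))) ≡
        ⅙ * ((K * (K * 1ℚ) - fromℕ 6 * K + fromℕ 4) * A + M * (M * 1ℚ) * (fromℕ 2 * K - 1ℚ) - fromℕ 2 * K - 1ℚ)
      evaluate = solve-∀ ℚ-ring
      expand : ∀ p M → p * (M - p) ≡ p * M - p * (p * 1ℚ)
      expand = solve-∀ ℚ-ring
      cancel : ∀ q → ⅙ * (q * fromℕ 6) ≡ q
      cancel = solve-∀ ℚ-ring

    isKemenyConstant : ∀ p → IsDistance C x y p → IsKemenyConstant F (kemenyNumerator m n p / 6)
    isKemenyConstant p dist = record
      { connected     = sunflower-connected
      ; hasEdges      = size≢0
      ; pseudoinverse = _ , isPseudoinverse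
      ; value         = kemenyFormula-value p dist
      }

open SunflowerKemeny

open import Data.Integer using (+_; _+_; _*_; _-_; _^_)

theorem5p5 : (m n : ℕ) (3≤m : 3 ℕ.≤ m) (3≤n : 3 ℕ.≤ n)
    (x y : Fin m) (x≢y : x ≢ y)
    (p : ℕ) → IsDistance (cycle m 3≤m) x y p →
    IsKemenyConstant (sunflower n 3≤m 3≤n x y x≢y)
    ((((+ n) ^ 2 - + 6 * + n + + 4) * (+ p * + m - (+ p) ^ 2)
    + (+ m) ^ 2 * (+ 2 * + n - + 1) - + 2 * + n - + 1) / 6)
theorem5p5 m n 3≤m 3≤n x y x≢y p dist =
  let α , αA = arcs-invertible x≢y in
  Kemeny.isKemenyConstant 3≤m 3≤n x y x≢y (+ 1 / m) (+ 1 / n) α (recip m) (recip n) αA p dist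
  where
  instance
    m≢0 : NonZero m
    m≢0 = ℕ.>-nonZero (ℕₚ.<-≤-trans (s≤s z≤n) 3≤m)
    n≢0 : NonZero n
    n≢0 = ℕ.>-nonZero (ℕₚ.<-≤-trans (s≤s z≤n) 3≤n)
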